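{- For every $n\ge1$, the poset $\mathcal{FL}yn_n^w$ of bicolored Lyndon forests is a Whitney dual of $\Pi_n^w$. In particular, $\mathcal{FL}yn_n^w\cong R_{\lambda_w}(\Pi_n^w)$.
   Context: Weighted partitions: a weighted set is $A^v$ with $A$ nonempty finite and $v\in\{0,\dots,|A|-1\}$; a weighted partition of $[n]$ is a collection of weighted sets whose underlying sets partition $[n]$. In $\Pi_n^w$, $\pi\lessdot\pi'$ when $\pi'$ is obtained by replacing two blocks $A^a,B^b$ by $(A\cup B)^{a+b+u}$, $u\in\{0,1\}$; $\hat0=\{1\}^0/\cdots/\{n\}^0$. The labeling $\lambda_w$ assigns to this cover (with $\min A<\min B$) the label $(\min A,\min B)^u$ in $\Lambda_n^w=\Gamma_1\oplus\cdots\oplus\Gamma_{n-1}$ (ordinal sum), where $\Gamma_a=\{(a,b)^u:a<b\le n,u\in\{0,1\}\}$ with $(a,b)^u\le(a,c)^v$ iff $b\le c$ and $u\le v$. $R_\lambda(P)$: for a word $w$ over a poset of labels, $\mathrm{sort}(w)$ is obtained by repeatedly taking the smallest index $i$ with $w_i<w_{i+1}$ and swapping $w_i,w_{i+1}$ until none exists. For $P$ with edge labeling $\lambda$, $R_\lambda(P)$ is the set of pairs $(x,w)$ with $x\in P$ and $w$ the label sequence of an ascent-free saturated chain from $\hat0$ to $x$ (no consecutive labels with $\ell_i<\ell_{i+1}$), with $(x,w)\lessdot(y,u)$ iff $x\lessdot y$ and $u=\mathrm{sort}(w\,\lambda(x\lessdot y))$. Trees: a bicolored binary forest on $[n]$ is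 a forest of rooted planar binary trees (left child $L(v)$, right child $R(v)$) with leaves bijectively labeled by $[n]$ and internal vertices colored in $\{0,1\}$. $\nu(v)$ is the smallest leaf label below $v$; normalized means $\nu(v)=\nu(L(v))$ for all internal $v$; $v$ is Lyndon if $L(v)$ is a leaf or $\nu(R(L(v)))>\nu(R(v))$. A normalized bicolored binary tree is a bicolored Lyndon tree if every internal $v$ whose left child is internal is Lyndon or satisfies $\mathrm{color}(L(v))>\mathrm{color}(v)$; a bicolored Lyndon forest has all components bicolored Lyndon trees. To $u$-merge two bicolored Lyndon trees $T_1,T_2$ (min leaf of $T_1$ smaller), create a new vertex $r$ of color $u$ with left child the root of $T_1$ and right child the root of $T_2$; while the result is not a bicolored Lyndon tree, slide $r$ past its left child, replacing the subtree $r(x(X_L,X_R),Y)$ by $x(r(X_L,Y),X_R)$ (colors kept). $\mathcal{FL}yn_n^w$ is the set of bicolored Lyndon forests on $[n]$ with $F\lessdot F'$ iff $F'$ is obtained by $u$-merging exactly two trees of $F$ for some $u\in\{0,1\}$. Whitney numbers: $w_k(P)=\sum_{\rho(x)=k}\mu(\hat0,x)$, $W_k(P)=\#\{x:\rho(x)=k\}$; $P,Q$ are Whitney duals if $|w_k(P)|=W_k(Q)$ and $|w_k(Q)|=W_k(P)$ for all $k$. -}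

module Defs where

open import Data.Bool using (Bool; true; false; _∧_; _∨_; not; if_then_else_; T)
open import Data.Nat using (ℕ; zero; suc; _+_; _*_; _⊓_; _≡ᵇ_; _<ᵇ_; _≤ᵇ_; _≤_)
open import Data.Integer using (ℤ; ∣_∣) renaming (_+_ to _+ℤ_; -_ to -ℤ_; +_ to ℤ+)
open import Data.Fin using (Fin; toℕ) renaming (zero to fz; suc to fs)
open import Data.Vec using (Vec; []; _∷_; lookup; tabulate; toList)
import Data.Vec as V
open import Data.List using (List; []; _∷_; _++_; [_]; map; length; filterᵇ;
  deduplicateᵇ; upTo; allFin; cartesianProductWith; concat; concatMap; foldr)
open import Data.Bool.ListAction using (any; all)
open import Data.Maybe using (Maybe; just; nothing)
import Data.Maybe as M
open import Data.Product using (Σ; _×_; _,_; proj₁; proj₂)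
open import Function using (_∘_)
open import Function.Bundles using (_⤖_; _⇔_; Bijection)
open import Relation.Binary.PropositionalEquality using (_≡_)

-- A finite poset is presented by a type of "raw" objects with a boolean
-- (structural) equality, a finite list 'rawAll' containing every element
-- (possibly together with invalid raw objects), a validity predicate cutting
-- out the elements, a boolean cover relation and the bottom element.
-- The order is the reflexive-transitive closure of the cover relation.
record FinPoset : Set₁ where
  field
    Raw    : Set
    _==_   : Raw → Raw → Bool
    rawAll : List Raw
    valid  : Raw → Bool
    _⋖_    : Raw → Raw → Bool
    bot    : Raw

sumℤ : List ℤ → ℤ
sumℤ = foldr _+ℤ_ (ℤ+ 0)

module _ (P : FinPoset) where
  open FinPoset P

  elems : List Raw
  elems = deduplicateᵇ _==_ (filterᵇ valid rawAll)

  Elem : Set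
  Elem = Σ Raw (T ∘ valid)

  reach : ℕ → Raw → Raw → Bool
  reach zero    x y = x == y
  reach (suc k) x y = any (λ z → (x ⋖ z) ∧ reach k z y) elems

  -- x ≤ y in P (every chain of covers in P has length < |P|)
  leq : Raw → Raw → Bool
  leq x y = any (λ k → reach k x y) (upTo (suc (length elems)))

  lt : Raw → Raw → Bool
  lt x y = leq x y ∧ not (x == y)

  rankIs : ℕ → Raw → Bool
  rankIs k x = reach k bot x

  -- μ(0̂,x) via μ(0̂,0̂)=1, μ(0̂,x) = - Σ_{0̂ ≤ y < x} μ(0̂,y);
  -- the fuel |P| exceeds the length of every strict chain, so it never runs out.
  muFuel : ℕ → Raw → ℤ
  muFuel zero    x = if x == bot then ℤ+ 1 else ℤ+ 0
  muFuel (suc f) x = if x == bot then ℤ+ 1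
    else -ℤ (sumℤ (map (muFuel f) (filterᵇ (λ y → leq bot y ∧ lt y x) elems)))

  mobius : Raw → ℤ
  mobius = muFuel (length elems)

  whitney1 : ℕ → ℤ
  whitney1 k = sumℤ (map mobius (filterᵇ (rankIs k) elems))

  whitney2 : ℕ → ℕ
  whitney2 k = length (filterᵇ (rankIs k) elems)

WhitneyDual : FinPoset → FinPoset → Set
WhitneyDual P Q = ∀ k → (∣ whitney1 P k ∣ ≡ whitney2 Q k) × (∣ whitney1 Q k ∣ ≡ whitney2 P k)

_≅_ : FinPoset → FinPoset → Set
P ≅ Q = Σ (Elem P ⤖ Elem Q) λ f →
  ∀ x y → T (FinPoset._⋖_ P (proj₁ x) (proj₁ y))
        ⇔ T (FinPoset._⋖_ Q (proj₁ (Bijection.to f x)) (proj₁ (Bijection.to f y)))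

_=F_ : ∀ {n} → Fin n → Fin n → Bool
i =F j = toℕ i ≡ᵇ toℕ j

vecEq : ∀ {A : Set} {k} → (A → A → Bool) → Vec A k → Vec A k → Bool
vecEq e [] [] = true
vecEq e (x ∷ xs) (y ∷ ys) = e x y ∧ vecEq e xs ys

listEq : ∀ {A : Set} → (A → A → Bool) → List A → List A → Bool
listEq e [] [] = true
listEq e (x ∷ xs) (y ∷ ys) = e x y ∧ listEq e xs ys
listEq e _ _ = false

allVecs : ∀ {A : Set} → List A → (k : ℕ) → List (Vec A k)
allVecs as zero    = [] ∷ []
allVecs as (suc k) = cartesianProductWith _∷_ as (allVecs as k)

allListsBelow : ∀ {A : Set} → List A → ℕ → List (List A)
allListsBelow as m = concatMap (λ k → map toList (allVecs as k)) (upTo m)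

count : ∀ {A : Set} → (A → Bool) → List A → ℕ
count p xs = length (filterᵇ p xs)

fin0 : ∀ {n} → Fin n → Fin n
fin0 fz     = fz
fin0 (fs _) = fz

-- A weighted partition of [n] (points 0,…,n-1) is encoded canonically by
-- (r , w): r[i] is the least element of the block of i, and for a block
-- with least element m, w[m] is its weight (w[i] = 0 when i is not a least element).
RawΠ : ℕ → Set
RawΠ n = Vec (Fin n) n × Vec (Fin n) n

eqΠ : ∀ {n} → RawΠ n → RawΠ n → Bool
eqΠ (r , w) (r' , w') = vecEq _=F_ r r' ∧ vecEq _=F_ w w'

validΠ : ∀ {n} → RawΠ n → Bool
validΠ {n} (r , w) = all ok (allFin n)
  where
  ok : Fin n → Bool
  ok i = (toℕ (lookup r i) ≤ᵇ toℕ i)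
       ∧ (lookup r (lookup r i) =F lookup r i)
       ∧ (if lookup r i =F i
            then toℕ (lookup w i) <ᵇ count (λ j → lookup r j =F i) (allFin n)
            else toℕ (lookup w i) ≡ᵇ 0)

Label : ℕ → Set
Label n = Fin n × Fin n × Fin 2

allLabels : ∀ n → List (Label n)
allLabels n = cartesianProductWith _,_ (allFin n)
                (cartesianProductWith _,_ (allFin n) (allFin 2))

eqLabel : ∀ {n} → Label n → Label n → Bool
eqLabel (a , b , u) (a' , b' , u') = (a =F a') ∧ (b =F b') ∧ (u =F u')

-- order of Λ_n^w = Γ_1 ⊕ ⋯ ⊕ Γ_{n-1}
labLe : ∀ {n} → Label n → Label n → Bool
labLe (a , b , u) (a' , b' , v) =
  (toℕ a <ᵇ toℕ a') ∨ ((a =F a') ∧ (toℕ b ≤ᵇ toℕ b') ∧ (toℕ u ≤ᵇ toℕ v))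

labLt : ∀ {n} → Label n → Label n → Bool
labLt l l' = labLe l l' ∧ not (eqLabel l l')

-- π ⋖ π' by merging the blocks with least elements a < b with u, i.e. the
-- cover is labelled (a,b)^u by λ_w
coverLΠ : ∀ {n} → RawΠ n → RawΠ n → Label n → Bool
coverLΠ {n} (r , w) (r' , w') (a , b , u) =
  (toℕ a <ᵇ toℕ b) ∧ (lookup r a =F a) ∧ (lookup r b =F b)
  ∧ vecEq _=F_ r' (V.map (λ x → if x =F b then a else x) r)
  ∧ (toℕ (lookup w' a) ≡ᵇ toℕ (lookup w a) + toℕ (lookup w b) + toℕ u)
  ∧ all (λ i → (i =F a) ∨
          (toℕ (lookup w' i) ≡ᵇ (if i =F b then 0 else toℕ (lookup w i))))
        (allFin n)

coverΠ : ∀ {n} → RawΠ n → RawΠ n → Bool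
coverΠ {n} π π' = any (coverLΠ π π') (allLabels n)

botΠ : ∀ n → RawΠ n
botΠ n = tabulate (λ i → i) , tabulate fin0

PiW : ℕ → FinPoset
PiW n = record
  { Raw = RawΠ n ; _==_ = eqΠ
  ; rawAll = cartesianProductWith _,_ (allVecs (allFin n) n) (allVecs (allFin n) n)
  ; valid = validΠ ; _⋖_ = coverΠ ; bot = botΠ n }

sortStep : ∀ {n} → List (Label n) → Maybe (List (Label n))
sortStep (x ∷ y ∷ rest) =
  if labLt x y then just (y ∷ x ∷ rest) else M.map (x ∷_) (sortStep (y ∷ rest))
sortStep _ = nothing

sortFuel : ∀ {n} → ℕ → List (Label n) → List (Label n)
sortFuel zero    w = w
sortFuel (suc f) w with sortStep w
... | nothing = w
... | just w' = sortFuel f w'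

-- each swap removes one pair i<j with w_i<w_j, so |w|² steps always suffice
sortW : ∀ {n} → List (Label n) → List (Label n)
sortW w = sortFuel (length w * length w) w

hasAscent : ∀ {n} → List (Label n) → Bool
hasAscent (x ∷ y ∷ rest) = labLt x y ∨ hasAscent (y ∷ rest)
hasAscent _ = false

chainWord : ∀ {n} → RawΠ n → List (Label n) → RawΠ n → Bool
chainWord y [] x = eqΠ y x
chainWord {n} y (l ∷ w) x = any (λ z → coverLΠ y z l ∧ chainWord z w x) (elems (PiW n))

RawR : ℕ → Set
RawR n = RawΠ n × List (Label n)

RPiW : ℕ → FinPoset
RPiW n = record
  { Raw = RawR n
  ; _==_ = λ { (x , w) (y , u) → eqΠ x y ∧ listEq eqLabel w u }
  ; rawAll = cartesianProductWith _,_ (FinPoset.rawAll (PiW n))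
               (allListsBelow (allLabels n) (suc n))
  ; valid = λ { (x , w) → validΠ x ∧ chainWord (botΠ n) w x ∧ not (hasAscent w) }
  ; _⋖_ = λ { (x , w) (y , u) → any (λ l → coverLΠ x y l ∧ listEq eqLabel u (sortW (w ++ [ l ])))
                                     (allLabels n) }
  ; bot = botΠ n , [] }

data Tree (n : ℕ) : Set where
  leaf : Fin n → Tree n
  node : Fin 2 → Tree n → Tree n → Tree n   -- color, left child, right child

treeEq : ∀ {n} → Tree n → Tree n → Bool
treeEq (leaf i) (leaf j) = i =F j
treeEq (node c l r) (node c' l' r') = (c =F c') ∧ treeEq l l' ∧ treeEq r r'
treeEq _ _ = false

ν : ∀ {n} → Tree n → ℕ
ν (leaf i) = toℕ i
ν (node _ l r) = ν l ⊓ ν r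

leaves : ∀ {n} → Tree n → List (Fin n)
leaves (leaf i) = i ∷ []
leaves (node _ l r) = leaves l ++ leaves r

normalized : ∀ {n} → Tree n → Bool
normalized (leaf _) = true
normalized (node c l r) = (ν (node c l r) ≡ᵇ ν l) ∧ normalized l ∧ normalized r

isLyndonVertex : ∀ {n} → Fin 2 → Tree n → Tree n → Bool
isLyndonVertex c (leaf _) r = true
isLyndonVertex c (node c' ll lr) r = ν r <ᵇ ν lr

lyndonCond : ∀ {n} → Tree n → Bool
lyndonCond (leaf _) = true
lyndonCond (node c (leaf i) r) = lyndonCond r
lyndonCond (node c (node c' ll lr) r) =
  (isLyndonVertex c (node c' ll lr) r ∨ (toℕ c <ᵇ toℕ c'))
  ∧ lyndonCond (node c' ll lr) ∧ lyndonCond r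

isBLyndon : ∀ {n} → Tree n → Bool
isBLyndon t = normalized t ∧ lyndonCond t

-- the new root r (color u) with current left subtree X and right subtree Y,
-- sitting in context ctx; slide r past its left child while not Lyndon
mergeAux : ∀ {n} → (Tree n → Tree n) → Fin 2 → Tree n → Tree n → Tree n
mergeAux ctx u X Y with isBLyndon (ctx (node u X Y))
... | true = ctx (node u X Y)
mergeAux ctx u (leaf i) Y | false = ctx (node u (leaf i) Y)
mergeAux ctx u (node c XL XR) Y | false = mergeAux (λ h → ctx (node c h XR)) u XL Y

-- u-merge of T₁, T₂ (with ν T₁ < ν T₂)
umerge : ∀ {n} → Fin 2 → Tree n → Tree n → Tree n
umerge u T₁ T₂ = mergeAux (λ t → t) u T₁ T₂

-- forests are stored as lists of trees sorted by increasing ν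
Forest : ℕ → Set
Forest n = List (Tree n)

sortedν : ∀ {n} → Forest n → Bool
sortedν (s ∷ t ∷ ts) = (ν s <ᵇ ν t) ∧ sortedν (t ∷ ts)
sortedν _ = true

insertν : ∀ {n} → Tree n → Forest n → Forest n
insertν t [] = t ∷ []
insertν t (s ∷ ss) = if ν t <ᵇ ν s then t ∷ s ∷ ss else s ∷ insertν t ss

validF : ∀ {n} → Forest n → Bool
validF {n} F = sortedν F ∧ all isBLyndon F
  ∧ (length (concatMap leaves F) ≡ᵇ n)
  ∧ all (λ i → any (λ j → i =F j) (concatMap leaves F)) (allFin n)

picks : ∀ {A : Set} → List A → List (A × List A)
picks [] = []
picks (x ∷ xs) = (x , xs) ∷ map (λ { (y , rest) → y , x ∷ rest }) (picks xs)

pairs : ∀ {A : Set} → List A → List (A × A × List A)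
pairs [] = []
pairs (x ∷ xs) = map (λ { (y , rest) → x , y , rest }) (picks xs)
              ++ map (λ { (a , b , rest) → a , b , x ∷ rest }) (pairs xs)

coverF : ∀ {n} → Forest n → Forest n → Bool
coverF F F' = any (λ { (T₁ , T₂ , rest) → any (λ u →
    listEq treeEq F' (insertν (if ν T₁ <ᵇ ν T₂ then umerge u T₁ T₂ else umerge u T₂ T₁) rest))
    (allFin 2) }) (pairs F)

treesDepth : ∀ n → ℕ → List (Tree n)
treesDepth n zero = map leaf (allFin n)
treesDepth n (suc d) = map leaf (allFin n) ++
  concatMap (λ c → concatMap (λ l → map (node c l) (treesDepth n d)) (treesDepth n d)) (allFin 2)

FLynW : ℕ → FinPoset
FLynW n = record
  { Raw = Forest n ; _==_ = listEq treeEq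
  ; rawAll = allListsBelow (treesDepth n n) (suc n)
  ; valid = validF ; _⋖_ = coverF ; bot = map leaf (allFin n) }

{-# OPTIONS --safe #-}

-- A bicolored Lyndon forest is determined by the labels (ν v, ν (R v))^color(v) of its internal vertices:
-- those with first entry a form the left spine above leaf a, and the Lyndon condition says that a spine,
-- read upwards, has no ascent.  Concatenating the spines by decreasing a gives a bijection between Lyndon
-- forests and ascent-free label sequences of chains from the bottom of Π, under which u-merging inserts
-- the new label by exactly the swaps made by `sort`; hence the isomorphism.
--
-- For the Whitney numbers, both Möbius functions are found by a sign-reversing involution. In Π, μ(x) is
-- the signed number of ascent-free chains to x: an ascent-free chain ending at some y ≤ x loses its last
-- label if that is smaller than the first label t of the unique increasing chain from y to x (or if y =
-- x), and gains t otherwise. In FLyn, μ(F) is ± 1 if the reversed label sequence of F is an increasing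
-- chain and 0 otherwise: for F above the bottom, the forests G ≤ F of that kind cancel in pairs by
-- toggling the first label of F in G. Since each element of Π is reached by exactly one increasing chain,
-- these forests are counted by the elements of Π.

module Submission where

open import Defs
open import Data.Bool using (Bool; true; false; _∧_; _∨_; not; if_then_else_; T; T?)
open import Data.Bool.ListAction using (any; all)
open import Data.Bool.Properties using (T-irrelevant)
open import Data.Nat
  using (ℕ; zero; suc; _+_; _*_; _∸_; _⊓_; _≤_; _<_; z≤n; s≤s; _≡ᵇ_; _<ᵇ_; _≤ᵇ_; _≤?_; _<?_)
import Data.Nat.Properties as ℕ
open import Data.Integer as ℤ using (ℤ; ∣_∣)
import Data.Integer.Properties as ℤ
import Algebra.Properties.CommutativeSemigroup ℕ.+-commutativeSemigroup as ℕ+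
import Algebra.Properties.CommutativeSemigroup ℤ.+-commutativeSemigroup as ℤ+
import Algebra.Properties.AbelianGroup ℤ.+-0-abelianGroup as Group
open import Data.Fin using (Fin; toℕ; fromℕ<; _≟_) renaming (zero to fz; suc to fs)
import Data.Fin.Properties as Fin
open import Data.Vec using (Vec; lookup; tabulate)
import Data.Vec as Vec
import Data.Vec.Properties as Vec
import Data.List as List
open import Data.List
  using (List; []; _∷_; _++_; [_]; map; length; filterᵇ; deduplicateᵇ; upTo; allFin;
         concatMap; foldr; reverse; _ʳ++_; head; drop)
open import Data.List.Properties
  using (length-map; length-++; length-tabulate; length-upTo; map-++; ++-assoc; ++-identityʳ;
         ʳ++-defn; reverse-involutive; reverse-injective; length-reverse; reverse-++; map-∘;
         filter-accept; filter-reject; filter-none; filter-++)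
open import Data.List.Membership.Propositional using (_∈_; _∉_; lose; find)
open import Data.List.Membership.Propositional.Properties
open import Data.List.Relation.Unary.Any using (Any; here; there)
import Data.List.Relation.Unary.Any as Any
import Data.List.Relation.Unary.Any.Properties as Any
open import Data.List.Relation.Unary.All using (All; []; _∷_)
import Data.List.Relation.Unary.All as All
import Data.List.Relation.Unary.All.Properties as All
open import Data.List.Relation.Unary.AllPairs using (AllPairs; []; _∷_)
import Data.List.Relation.Unary.AllPairs as AllPairs
import Data.List.Relation.Unary.AllPairs.Properties as AllPairs
open import Data.List.Relation.Unary.Linked using (Linked; []; [-]; _∷_; linked?)
import Data.List.Relation.Unary.Linked as Linked
open import Data.List.Relation.Unary.Linked.Properties using (Linked⇒AllPairs)
open import Data.List.Relation.Unary.Unique.Propositional using (Unique)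
import Data.List.Relation.Unary.Unique.Propositional.Properties as Unique
open import Data.List.Relation.Binary.Permutation.Propositional
  using (_↭_; ↭-refl; ↭-sym; ↭-trans; ↭-reflexive; prep; swap)
  renaming (refl to prefl; trans to ptrans)
import Data.List.Relation.Binary.Permutation.Propositional.Properties as Perm
open import Data.Maybe using (Maybe; just; nothing)
import Data.Maybe as Maybe
open import Data.Product using (∃; _×_; _,_; proj₁; proj₂)
open import Data.Sum using (_⊎_; inj₁; inj₂)
open import Data.Empty using (⊥; ⊥-elim)
open import Data.Unit using (⊤; tt)
open import Function using (_∘_; id; flip)
open import Function.Bundles using (_⇔_; mk⇔; mk⤖; Equivalence)
open import Relation.Nullary using (¬_; Dec; yes; no)
open import Relation.Nullary.Decidable using (¬?; _×-dec_; _⊎-dec_; _→-dec_; map′; ⌊_⌋; toWitness; fromWitness)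
open import Relation.Binary.PropositionalEquality
  using (_≡_; _≢_; refl; sym; trans; cong; cong₂; subst; subst₂; module ≡-Reasoning)

-- Lists, permutations and signed sums

-- The order on each Γ_a is a product order, so an ascent-free word need not be decreasing: for b <
-- c the labels (a,b)^1 and (a,c)^0 are incomparable and may follow each other either way. Hence the
-- words of forests comprise more than the increasing chains read backwards, and `Good` singles the
-- latter out. The harder half concerns partitions: the increasing chain from y to x must be found
-- together with its tints. First entries increase weakly along it, and within one Γ_a so do the
-- tints; so tint 0 has to be used for as long as the weight of x stays attainable by the merges
-- still to come. This calls for an arithmetic description of intervals: `Below` asks that the
-- blocks of y refine those of x and that each weight of x lies in a half-open range computed from
-- y. `Next` then pins down the first label. The toggling on the partition side works because a
-- label lies below the label forced after it exactly when it is itself forced (`Next-⊏`,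
-- `Next-pred`), so one comparison decides both about removing a label and about adding one.

∧-fst : ∀ {a b} → T (a ∧ b) → T a
∧-fst {true} _ = tt

∧-snd : ∀ {a b} → T (a ∧ b) → T b
∧-snd {true} t = t

∧-intro : ∀ {a b} → T a → T b → T (a ∧ b)
∧-intro {true} _ t = t

∨-elim : ∀ {a b} → T (a ∨ b) → T a ⊎ T b
∨-elim {true}  _ = inj₁ tt
∨-elim {false} t = inj₂ t

∨-introˡ : ∀ {a b} → T a → T (a ∨ b)
∨-introˡ {true} _ = tt

∨-introʳ : ∀ {a b} → T b → T (a ∨ b)
∨-introʳ {true}  _ = tt
∨-introʳ {false} t = t

T-not⁺ : ∀ {a} → ¬ T a → T (not a)
T-not⁺ {true}  n = n tt
T-not⁺ {false} _ = tt

T-not⁻ : ∀ {a} → T (not a) → ¬ T a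
T-not⁻ {false} _ t = t

T-ext : ∀ {a b} → (T a → T b) → (T b → T a) → a ≡ b
T-ext {true}  {true}  _ _ = refl
T-ext {true}  {false} f _ = ⊥-elim (f tt)
T-ext {false} {true}  _ g = ⊥-elim (g tt)
T-ext {false} {false} _ _ = refl

if-yes : ∀ {A : Set} {b} {x y : A} → T b → (if b then x else y) ≡ x
if-yes {b = true} _ = refl

if-no : ∀ {A : Set} {b} {x y : A} → ¬ T b → (if b then x else y) ≡ y
if-no {b = true}  n = ⊥-elim (n tt)
if-no {b = false} _ = refl

any⁺ : ∀ {A : Set} (p : A → Bool) {xs x} → x ∈ xs → T (p x) → T (any p xs)
any⁺ p i t = Any.any⁺ p (lose i t)

any⁻ : ∀ {A : Set} (p : A → Bool) xs → T (any p xs) → ∃ λ x → x ∈ xs × T (p x)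
any⁻ p xs = find ∘ Any.any⁻ p xs

all⁺ : ∀ {A : Set} (p : A → Bool) xs → (∀ {x} → x ∈ xs → T (p x)) → T (all p xs)
all⁺ p [] h = tt
all⁺ p (x ∷ xs) h = ∧-intro (h (here refl)) (all⁺ p xs (h ∘ there))

all⁻ : ∀ {A : Set} (p : A → Bool) {xs x} → T (all p xs) → x ∈ xs → T (p x)
all⁻ p t (here refl) = ∧-fst t
all⁻ p {y ∷ _} t (there i) = all⁻ p (∧-snd {p y} t) i

=F-sound : ∀ {n} {i j : Fin n} → T (i =F j) → i ≡ j
=F-sound t = Fin.toℕ-injective (ℕ.≡ᵇ⇒≡ _ _ t)

=F-refl : ∀ {n} (i : Fin n) → T (i =F i)
=F-refl i = ℕ.≡⇒≡ᵇ (toℕ i) _ refl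

=F-complete : ∀ {n} {i j : Fin n} → i ≡ j → T (i =F j)
=F-complete {i = i} refl = =F-refl i

vecEq-sound : ∀ {A : Set} {e : A → A → Bool} → (∀ {x y} → T (e x y) → x ≡ y) →
  ∀ {k} {xs ys : Vec A k} → T (vecEq e xs ys) → xs ≡ ys
vecEq-sound s {xs = Vec.[]} {Vec.[]} _ = refl
vecEq-sound {e = e} s {xs = x Vec.∷ xs} {y Vec.∷ ys} t =
  cong₂ Vec._∷_ (s (∧-fst t)) (vecEq-sound s (∧-snd {e x y} t))

vecEq-refl : ∀ {A : Set} {e : A → A → Bool} → (∀ x → T (e x x)) →
  ∀ {k} (xs : Vec A k) → T (vecEq e xs xs)
vecEq-refl r Vec.[] = tt
vecEq-refl r (x Vec.∷ xs) = ∧-intro (r x) (vecEq-refl r xs)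

listEq-sound : ∀ {A : Set} {e : A → A → Bool} → (∀ {x y} → T (e x y) → x ≡ y) →
  ∀ {xs ys : List A} → T (listEq e xs ys) → xs ≡ ys
listEq-sound s {[]} {[]} _ = refl
listEq-sound {e = e} s {x ∷ xs} {y ∷ ys} t =
  cong₂ _∷_ (s (∧-fst t)) (listEq-sound s (∧-snd {e x y} t))

listEq-refl : ∀ {A : Set} {e : A → A → Bool} → (∀ x → T (e x x)) →
  ∀ (xs : List A) → T (listEq e xs xs)
listEq-refl r [] = tt
listEq-refl r (x ∷ xs) = ∧-intro (r x) (listEq-refl r xs)

lookup-ext : ∀ {A : Set} {k} {xs ys : Vec A k} → (∀ i → lookup xs i ≡ lookup ys i) → xs ≡ ys
lookup-ext {xs = Vec.[]} {Vec.[]} h = refl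
lookup-ext {xs = x Vec.∷ xs} {y Vec.∷ ys} h = cong₂ Vec._∷_ (h fz) (lookup-ext (h ∘ fs))

filterᵇ-yes : ∀ {A : Set} (p : A → Bool) {x xs} → T (p x) → filterᵇ p (x ∷ xs) ≡ x ∷ filterᵇ p xs
filterᵇ-yes p = filter-accept (T? ∘ p)

filterᵇ-no : ∀ {A : Set} (p : A → Bool) {x xs} → ¬ T (p x) → filterᵇ p (x ∷ xs) ≡ filterᵇ p xs
filterᵇ-no p = filter-reject (T? ∘ p)

filterᵇ-none : ∀ {A : Set} (p : A → Bool) xs → (∀ {x} → x ∈ xs → ¬ T (p x)) → filterᵇ p xs ≡ []
filterᵇ-none p xs h = filter-none (T? ∘ p) (All.tabulate {xs = xs} h)

filterᵇ-cong : ∀ {A : Set} (p q : A → Bool) xs → (∀ {x} → x ∈ xs → p x ≡ q x) →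
  filterᵇ p xs ≡ filterᵇ q xs
filterᵇ-cong p q [] h = refl
filterᵇ-cong p q (x ∷ xs) h with p x | q x | h (here refl)
... | true  | .true  | refl = cong (x ∷_) (filterᵇ-cong p q xs (h ∘ there))
... | false | .false | refl = filterᵇ-cong p q xs (h ∘ there)

∈-filterᵇ⁺ : ∀ {A : Set} (p : A → Bool) {x xs} → x ∈ xs → T (p x) → x ∈ filterᵇ p xs
∈-filterᵇ⁺ p i t = ∈-filter⁺ (T? ∘ p) i t

∈-filterᵇ⁻ : ∀ {A : Set} (p : A → Bool) {x xs} → x ∈ filterᵇ p xs → x ∈ xs × T (p x)
∈-filterᵇ⁻ p {xs = xs} i = ∈-filter⁻ (T? ∘ p) {xs = xs} i

Unique-filterᵇ : ∀ {A : Set} (p : A → Bool) {xs} → Unique xs → Unique (filterᵇ p xs)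
Unique-filterᵇ p u = Unique.filter⁺ (T? ∘ p) u

∈⇒↭ : ∀ {A : Set} {x : A} {xs} → x ∈ xs → ∃ λ ys → xs ↭ x ∷ ys
∈⇒↭ {x = x} i with ∈-∃++ i
... | ys , zs , refl = ys ++ zs , Perm.shift x ys zs

Unique-resp-↭ : ∀ {A : Set} {xs ys : List A} → xs ↭ ys → Unique xs → Unique ys
Unique-resp-↭ prefl u = u
Unique-resp-↭ (prep x p) (h ∷ u) = Perm.All-resp-↭ p h ∷ Unique-resp-↭ p u
Unique-resp-↭ (swap x y p) ((x≢y ∷ h) ∷ g ∷ u) =
  ((x≢y ∘ sym) ∷ Perm.All-resp-↭ p g) ∷ Perm.All-resp-↭ p h ∷ Unique-resp-↭ p u
Unique-resp-↭ (ptrans p q) u = Unique-resp-↭ q (Unique-resp-↭ p u)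

Unique⊆⇒↭ : ∀ {A : Set} {ys xs : List A} → Unique ys → (∀ {x} → x ∈ ys → x ∈ xs) →
  ∃ λ zs → xs ↭ ys ++ zs
Unique⊆⇒↭ {ys = []} {xs} _ _ = xs , ↭-refl
Unique⊆⇒↭ {ys = y ∷ ys} (h ∷ u) s with Unique⊆⇒↭ u (s ∘ there)
... | zs , p with ∈-++⁻ ys (Perm.∈-resp-↭ p (s (here refl)))
... | inj₁ i = ⊥-elim (All.lookup h i refl)
... | inj₂ i with ∈⇒↭ i
... | zs′ , q = zs′ , ↭-trans p (↭-trans (Perm.++⁺ˡ ys q) (Perm.shift y ys zs′))

Unique⊆⇒length≤ : ∀ {A : Set} {ys xs : List A} → Unique ys → (∀ {x} → x ∈ ys → x ∈ xs) →
  length ys ≤ length xs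
Unique⊆⇒length≤ {ys = ys} u s with Unique⊆⇒↭ u s
... | zs , p = ℕ.≤-trans (ℕ.m≤m+n (length ys) (length zs))
                 (ℕ.≤-reflexive (sym (trans (Perm.↭-length p) (length-++ ys))))

-- Pigeonhole: the count leaves no room in `xs` for repetitions or further entries. In `validF⁻` it
-- turns "every point is a leaf and there are n leaves" into a permutation of the points.
Unique⊆∧length≤⇒↭ : ∀ {A : Set} {ys xs : List A} → Unique ys → (∀ {x} → x ∈ ys → x ∈ xs) →
  length xs ≤ length ys → xs ↭ ys
Unique⊆∧length≤⇒↭ {ys = ys} u s le with Unique⊆⇒↭ u s
... | [] , p = ↭-trans p (↭-reflexive (++-identityʳ ys))
... | z ∷ zs , p = ⊥-elim (ℕ.<⇒≱ {length ys} {length ys + suc (length zs)}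
        (ℕ.m<m+n (length ys) (s≤s z≤n))
        (subst (_≤ length ys) (trans (Perm.↭-length p) (length-++ ys)) le))

Unique-≈⇒↭ : ∀ {A : Set} {xs ys : List A} → Unique xs → Unique ys →
  (∀ {x} → x ∈ xs → x ∈ ys) → (∀ {x} → x ∈ ys → x ∈ xs) → xs ↭ ys
Unique-≈⇒↭ ux uy s t = Unique⊆∧length≤⇒↭ uy t (Unique⊆⇒length≤ ux s)

Unique-map⁺ : ∀ {A B : Set} (f : A → B) {xs} →
  (∀ {x y} → x ∈ xs → y ∈ xs → f x ≡ f y → x ≡ y) → Unique xs → Unique (map f xs)
Unique-map⁺ f inj [] = []
Unique-map⁺ f {x ∷ xs} inj (h ∷ u) =
  All.tabulate (λ i e → let y , j , e′ = ∈-map⁻ f i in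
    All.lookup h j (inj (here refl) (there j) (trans e e′)))
  ∷ Unique-map⁺ f (λ i j → inj (there i) (there j)) u

sumℤ-↭ : ∀ {xs ys} → xs ↭ ys → sumℤ xs ≡ sumℤ ys
sumℤ-↭ prefl = refl
sumℤ-↭ (prep x p) = cong (λ t → x ℤ.+ t) (sumℤ-↭ p)
sumℤ-↭ {_ ∷ _ ∷ xs} {_ ∷ _ ∷ ys} (swap x y p) = begin
  x ℤ.+ (y ℤ.+ sumℤ xs)   ≡⟨ ℤ.+-assoc x y _ ⟨
  (x ℤ.+ y) ℤ.+ sumℤ xs   ≡⟨ cong₂ ℤ._+_ (ℤ.+-comm x y) (sumℤ-↭ p) ⟩
  (y ℤ.+ x) ℤ.+ sumℤ ys   ≡⟨ ℤ.+-assoc y x _ ⟩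
  y ℤ.+ (x ℤ.+ sumℤ ys)   ∎
  where open ≡-Reasoning
sumℤ-↭ (ptrans p q) = trans (sumℤ-↭ p) (sumℤ-↭ q)

sumℤ-cong : ∀ {A : Set} (f g : A → ℤ) xs → (∀ {x} → x ∈ xs → f x ≡ g x) →
  sumℤ (map f xs) ≡ sumℤ (map g xs)
sumℤ-cong f g [] h = refl
sumℤ-cong f g (x ∷ xs) h = cong₂ ℤ._+_ (h (here refl)) (sumℤ-cong f g xs (h ∘ there))

sumℤ-neg : ∀ {A : Set} (f : A → ℤ) xs → sumℤ (map (ℤ.-_ ∘ f) xs) ≡ ℤ.- sumℤ (map f xs)
sumℤ-neg f [] = refl
sumℤ-neg f (x ∷ xs) =
  trans (cong (λ t → ℤ.- f x ℤ.+ t) (sumℤ-neg f xs)) (sym (ℤ.neg-distrib-+ (f x) _))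

sumℤ-+ : ∀ {A : Set} (f g : A → ℤ) xs →
  sumℤ (map (λ x → f x ℤ.+ g x) xs) ≡ sumℤ (map f xs) ℤ.+ sumℤ (map g xs)
sumℤ-+ f g [] = refl
sumℤ-+ f g (x ∷ xs) = trans (cong (λ t → f x ℤ.+ g x ℤ.+ t) (sumℤ-+ f g xs))
  (ℤ+.interchange (f x) (g x) (sumℤ (map f xs)) (sumℤ (map g xs)))

sumℤ-zero : ∀ {A : Set} (xs : List A) → sumℤ (map (λ _ → ℤ.+ 0) xs) ≡ ℤ.+ 0
sumℤ-zero [] = refl
sumℤ-zero (x ∷ xs) = trans (ℤ.+-identityˡ _) (sumℤ-zero xs)

sumℤ-swap : ∀ {A B : Set} (f : A → B → ℤ) xs ys →
  sumℤ (map (λ x → sumℤ (map (f x) ys)) xs) ≡ sumℤ (map (λ y → sumℤ (map (λ x → f x y) xs)) ys)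
sumℤ-swap f [] ys = sym (sumℤ-zero ys)
sumℤ-swap f (x ∷ xs) ys =
  trans (cong (λ t → sumℤ (map (f x) ys) ℤ.+ t) (sumℤ-swap f xs ys))
        (sym (sumℤ-+ (f x) (λ y → sumℤ (map (λ x′ → f x′ y) xs)) ys))

sumℤ-filter : ∀ {A : Set} (p : A → Bool) (f : A → ℤ) xs →
  sumℤ (map f (filterᵇ p xs)) ≡ sumℤ (map (λ x → if p x then f x else ℤ.+ 0) xs)
sumℤ-filter p f [] = refl
sumℤ-filter p f (x ∷ xs) with p x
... | true  = cong (λ t → f x ℤ.+ t) (sumℤ-filter p f xs)
... | false = trans (sumℤ-filter p f xs) (sym (ℤ.+-identityˡ _))

≡-neg⇒≡0 : ∀ i → i ≡ ℤ.- i → i ≡ ℤ.+ 0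
≡-neg⇒≡0 (ℤ.+ zero) _ = refl
≡-neg⇒≡0 (ℤ.+ suc _) ()
≡-neg⇒≡0 ℤ.-[1+ _ ] ()

-- An involution permutes `xs`, so the sum equals its own negative, and in ℤ this forces zero. No
-- orbits have to be paired off.
sumℤ-involution : ∀ {A : Set} (g : A → ℤ) (f : A → A) xs → Unique xs →
  (∀ {x} → x ∈ xs → f x ∈ xs × f (f x) ≡ x × g (f x) ≡ ℤ.- g x) → sumℤ (map g xs) ≡ ℤ.+ 0
sumℤ-involution g f xs u h = ≡-neg⇒≡0 _ (begin
  sumℤ (map g xs)              ≡⟨ sumℤ-↭ (Perm.map⁺ g perm) ⟩
  sumℤ (map g (map f xs))      ≡⟨ cong sumℤ (map-∘ xs) ⟨
  sumℤ (map (g ∘ f) xs)        ≡⟨ sumℤ-cong (g ∘ f) (ℤ.-_ ∘ g) xs (proj₂ ∘ proj₂ ∘ h) ⟩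
  sumℤ (map (ℤ.-_ ∘ g) xs)     ≡⟨ sumℤ-neg g xs ⟩
  ℤ.- sumℤ (map g xs)          ∎)
  where
  open ≡-Reasoning
  inv : ∀ {x} → x ∈ xs → f (f x) ≡ x
  inv = proj₁ ∘ proj₂ ∘ h
  into : ∀ {x} → x ∈ map f xs → x ∈ xs
  into i with ∈-map⁻ f i
  ... | y , j , refl = proj₁ (h j)
  perm : xs ↭ map f xs
  perm = Unique-≈⇒↭ u
    (Unique-map⁺ f (λ i j e → trans (sym (inv i)) (trans (cong f e) (inv j))) u)
    (λ i → subst (_∈ map f xs) (inv i) (∈-map⁺ f (proj₁ (h i)))) into

sgn : ℕ → ℤ
sgn zero    = ℤ.+ 1
sgn (suc k) = ℤ.- sgn k

∣sgn∣ : ∀ k → ∣ sgn k ∣ ≡ 1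
∣sgn∣ zero    = refl
∣sgn∣ (suc k) = trans (ℤ.∣-i∣≡∣i∣ (sgn k)) (∣sgn∣ k)

sumℤ-const : ∀ {A : Set} (c : ℤ) (xs : List A) → sumℤ (map (λ _ → c) xs) ≡ (ℤ.+ length xs) ℤ.* c
sumℤ-const c [] = sym (ℤ.*-zeroˡ c)
sumℤ-const c (x ∷ xs) = trans (cong (λ t → c ℤ.+ t) (sumℤ-const c xs)) (sym (ℤ.suc-* (ℤ.+ length xs) c))

∣sumℤ-sgn∣ : ∀ {A : Set} (f : A → ℤ) k xs → (∀ {x} → x ∈ xs → f x ≡ sgn k) →
  ∣ sumℤ (map f xs) ∣ ≡ length xs
∣sumℤ-sgn∣ f k xs h = begin
  ∣ sumℤ (map f xs) ∣            ≡⟨ cong ∣_∣ (sumℤ-cong f (λ _ → sgn k) xs h) ⟩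
  ∣ sumℤ (map (λ _ → sgn k) xs) ∣ ≡⟨ cong ∣_∣ (sumℤ-const (sgn k) xs) ⟩
  ∣ (ℤ.+ length xs) ℤ.* sgn k ∣  ≡⟨ ℤ.∣i*j∣≡∣i∣*∣j∣ (ℤ.+ length xs) (sgn k) ⟩
  length xs * ∣ sgn k ∣          ≡⟨ cong (length xs *_) (∣sgn∣ k) ⟩
  length xs * 1                  ≡⟨ ℕ.*-identityʳ _ ⟩
  length xs                      ∎
  where open ≡-Reasoning

-- Möbius functions of graded posets

module _ {A : Set} (r : A → A → Bool) (sound : ∀ {x y} → T (r x y) → x ≡ y) (rfl : ∀ x → T (r x x)) where

  ∈-deduplicateᵇ⁻ : ∀ {x} xs → x ∈ deduplicateᵇ r xs → x ∈ xs
  ∈-deduplicateᵇ⁻ (y ∷ xs) (here e) = here e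
  ∈-deduplicateᵇ⁻ (y ∷ xs) (there i) =
    there (∈-deduplicateᵇ⁻ xs (proj₁ (∈-filter⁻ (λ z → ¬? (T? (r y z))) i)))

  ∈-deduplicateᵇ⁺ : ∀ {x} xs → x ∈ xs → x ∈ deduplicateᵇ r xs
  ∈-deduplicateᵇ⁺ (y ∷ xs) (here e) = here e
  ∈-deduplicateᵇ⁺ {x} (y ∷ xs) (there i) with T? (r y x)
  ... | yes t = here (sym (sound t))
  ... | no ¬t = there (∈-filter⁺ (λ z → ¬? (T? (r y z))) (∈-deduplicateᵇ⁺ xs i) ¬t)

  Unique-deduplicateᵇ : ∀ xs → Unique (deduplicateᵇ r xs)
  Unique-deduplicateᵇ [] = []
  Unique-deduplicateᵇ (x ∷ xs) =
    All.tabulate (λ { i refl → proj₂ (∈-filter⁻ (λ z → ¬? (T? (r x z))) {xs = deduplicateᵇ r xs} i) (rfl x) })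
    ∷ Unique.filter⁺ (λ z → ¬? (T? (r x z))) (Unique-deduplicateᵇ xs)

Reach : (P : FinPoset) → ℕ → FinPoset.Raw P → FinPoset.Raw P → Set
Reach P zero    x y = x ≡ y
Reach P (suc k) x y = ∃ λ z → T (FinPoset.valid P z) × T (FinPoset._⋖_ P x z) × Reach P k z y

-- The data that tie the fuel-driven Boolean definitions to order theory: ranks make `rankIs` an
-- equation and bound the length of chains in `leq` and `muFuel`.
record Graded (P : FinPoset) : Set where
  open FinPoset P
  field
    ==-sound : ∀ {x y} → T (x == y) → x ≡ y
    ==-refl  : ∀ x → T (x == x)
    complete : ∀ {x} → T (valid x) → x ∈ rawAll
    rk       : Raw → ℕ
    ⊥-valid  : T (valid bot)
    rk-⊥     : rk bot ≡ 0
    rk-⋖     : ∀ {x y} → T (valid x) → T (valid y) → T (x ⋖ y) → rk y ≡ suc (rk x)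
    from-⊥   : ∀ {x} → T (valid x) → Reach P (rk x) bot x

module Graded-Properties {P : FinPoset} (G : Graded P) where
  open FinPoset P
  open Graded G

  ∈-elems⁺ : ∀ {x} → T (valid x) → x ∈ elems P
  ∈-elems⁺ t = ∈-deduplicateᵇ⁺ _==_ ==-sound ==-refl _ (∈-filterᵇ⁺ valid (complete t) t)

  ∈-elems⁻ : ∀ {x} → x ∈ elems P → T (valid x)
  ∈-elems⁻ i = proj₂ (∈-filterᵇ⁻ valid {xs = rawAll}
    (∈-deduplicateᵇ⁻ _==_ ==-sound ==-refl (filterᵇ valid rawAll) i))

  Unique-elems : Unique (elems P)
  Unique-elems = Unique-deduplicateᵇ _==_ ==-sound ==-refl (filterᵇ valid rawAll)

  ==-complete : ∀ {x y} → x ≡ y → T (x == y)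
  ==-complete refl = ==-refl _

  reach⁺ : ∀ k {x y} → Reach P k x y → T (reach P k x y)
  reach⁺ zero refl = ==-refl _
  reach⁺ (suc k) (z , v , c , r) = any⁺ _ (∈-elems⁺ v) (∧-intro c (reach⁺ k r))

  reach⁻ : ∀ k {x y} → T (reach P k x y) → Reach P k x y
  reach⁻ zero t = ==-sound t
  reach⁻ (suc k) {x} t with any⁻ _ (elems P) t
  ... | z , i , h = z , ∈-elems⁻ i , ∧-fst h , reach⁻ k (∧-snd {x ⋖ z} h)

  Reach-rk : ∀ k {x y} → T (valid x) → Reach P k x y → T (valid y) × rk y ≡ k + rk x
  Reach-rk zero v refl = v , refl
  Reach-rk (suc k) {x} v (z , vz , c , r) with Reach-rk k vz r
  ... | vy , e = vy , trans e (trans (cong (k +_) (rk-⋖ v vz c)) (ℕ.+-suc k (rk x)))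

  rank-inhabited : ∀ k {x y} → T (valid x) → Reach P k x y → ∀ i → i ≤ k →
    ∃ λ z → T (valid z) × rk z ≡ i + rk x
  rank-inhabited k {x} v r zero _ = x , v , refl
  rank-inhabited (suc k) {x} v (z , vz , c , r) (suc i) (s≤s le) with rank-inhabited k vz r i le
  ... | w , vw , e = w , vw , trans e (trans (cong (i +_) (rk-⋖ v vz c)) (ℕ.+-suc i (rk x)))

  -- A chain from the bottom to `x` meets each of the ranks 0 to `rk x`, so `rk` takes at least
  -- `suc (rk x)` values on the elements.
  rk<∣P∣ : ∀ {x} → T (valid x) → rk x < length (elems P)
  rk<∣P∣ {x} v = subst₂ _≤_ (length-upTo (suc (rk x))) (length-map rk (elems P))
    (Unique⊆⇒length≤ (Unique.upTo⁺ (suc (rk x))) into)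
    where
    into : ∀ {i} → i ∈ upTo (suc (rk x)) → i ∈ map rk (elems P)
    into {i} m with rank-inhabited (rk x) ⊥-valid (from-⊥ v) i (ℕ.≤-pred (∈-upTo⁻ m))
    ... | z , vz , e = subst (_∈ map rk (elems P)) (trans e (trans (cong (i +_) rk-⊥) (ℕ.+-identityʳ i)))
                         (∈-map⁺ rk (∈-elems⁺ vz))

  leq⁺ : ∀ k {x y} → T (valid x) → Reach P k x y → T (leq P x y)
  leq⁺ k {x} {y} v r = any⁺ (λ j → reach P j x y) (∈-upTo⁺ (s≤s k≤)) (reach⁺ k r)
    where
    k≤ : k ≤ length (elems P)
    k≤ with Reach-rk k v r
    ... | vy , e = ℕ.≤-trans (ℕ.m≤m+n k (rk x)) (ℕ.≤-trans (ℕ.≤-reflexive (sym e)) (ℕ.<⇒≤ (rk<∣P∣ vy)))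

  leq⁻ : ∀ {x y} → T (leq P x y) → ∃ λ k → Reach P k x y
  leq⁻ {x} {y} t with any⁻ (λ j → reach P j x y) (upTo (suc (length (elems P)))) t
  ... | k , _ , h = k , reach⁻ k h

  rankIs⁻ : ∀ {k x} → T (rankIs P k x) → rk x ≡ k
  rankIs⁻ {k} t =
    trans (proj₂ (Reach-rk k ⊥-valid (reach⁻ k t))) (trans (cong (k +_) rk-⊥) (ℕ.+-identityʳ k))

  rankIs⁺ : ∀ {k x} → T (valid x) → rk x ≡ k → T (rankIs P k x)
  rankIs⁺ v refl = reach⁺ _ (from-⊥ v)

  module _ (m : Raw → ℤ) (m-⊥ : m bot ≡ ℤ.+ 1)
    (m-sum : ∀ {x} → T (valid x) → x ≢ bot →
       sumℤ (map m (filterᵇ (λ y → leq P y x) (elems P))) ≡ ℤ.+ 0) where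

    private
      below : Raw → List Raw
      below x = filterᵇ (λ y → leq P bot y ∧ lt P y x) (elems P)

    below-↭ : ∀ {x} → T (valid x) → filterᵇ (λ y → leq P y x) (elems P) ↭ x ∷ below x
    below-↭ {x} v = Unique-≈⇒↭ (Unique-filterᵇ _ Unique-elems)
      (All.tabulate (λ { i refl → T-not⁻ (∧-snd {leq P x x} (∧-snd {leq P bot x}
          (proj₂ (∈-filterᵇ⁻ _ {xs = elems P} i)))) (==-refl x) })
       ∷ Unique-filterᵇ _ Unique-elems)
      into back
      where
      into : ∀ {y} → y ∈ filterᵇ (λ y → leq P y x) (elems P) → y ∈ x ∷ below x
      into {y} i with ∈-filterᵇ⁻ (λ y → leq P y x) {xs = elems P} i
      ... | j , t with T? (y == x)
      ... | yes e = here (==-sound e)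
      ... | no ¬e = there (∈-filterᵇ⁺ _ j (∧-intro (leq⁺ _ ⊥-valid (from-⊥ (∈-elems⁻ j)))
                                              (∧-intro t (T-not⁺ ¬e))))
      back : ∀ {y} → y ∈ x ∷ below x → y ∈ filterᵇ (λ y → leq P y x) (elems P)
      back (here refl) = ∈-filterᵇ⁺ _ (∈-elems⁺ v) (leq⁺ 0 v refl)
      back {y} (there i) with ∈-filterᵇ⁻ _ {xs = elems P} i
      ... | j , t = ∈-filterᵇ⁺ _ j (∧-fst (∧-snd {leq P bot y} t))

    below-rk : ∀ {x y} → T (valid x) → y ∈ below x → T (valid y) × rk y < rk x
    below-rk {x} {y} v i with ∈-filterᵇ⁻ _ {xs = elems P} i
    ... | j , t with leq⁻ {y} {x} (∧-fst (∧-snd {leq P bot y} t))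
    ... | zero , refl = ⊥-elim (T-not⁻ (∧-snd {leq P y y} (∧-snd {leq P bot y} t)) (==-refl y))
    ... | suc k , r = ∈-elems⁻ j , subst (rk y <_) (sym (proj₂ (Reach-rk (suc k) (∈-elems⁻ j) r)))
                                     (s≤s (ℕ.m≤n+m (rk y) k))

    -- Elements strictly below `x` have smaller rank, so fuel equal to the rank is enough. A guess
    -- `m` obeys the same recursion, because `m-sum` runs over everything below or equal to `x` and
    -- `below-↭` splits off the term at `x`.
    muFuel-unique : ∀ f {x} → T (valid x) → rk x ≤ f → muFuel P f x ≡ m x
    muFuel-unique f {x} v le with T? (x == bot)
    muFuel-unique zero {x} v le | yes t =
      trans (if-yes t) (trans (sym m-⊥) (cong m (sym (==-sound t))))
    muFuel-unique (suc f) {x} v le | yes t =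
      trans (if-yes t) (trans (sym m-⊥) (cong m (sym (==-sound t))))
    muFuel-unique zero {x} v le | no ¬t =
      ⊥-elim (¬t (==-complete (sym (subst (λ k → Reach P k bot x) (ℕ.n≤0⇒n≡0 le) (from-⊥ v)))))
    muFuel-unique (suc f) {x} v le | no ¬t = begin
      muFuel P (suc f) x                     ≡⟨ if-no ¬t ⟩
      ℤ.- sumℤ (map (muFuel P f) (below x))  ≡⟨ cong ℤ.-_ (sumℤ-cong _ m (below x) ih) ⟩
      ℤ.- sumℤ (map m (below x))             ≡⟨ sym (Group.inverseˡ-unique (m x) _ total) ⟩
      m x                                    ∎
      where
      open ≡-Reasoning
      ih : ∀ {y} → y ∈ below x → muFuel P f y ≡ m y
      ih i with below-rk v i
      ... | vy , lt = muFuel-unique f vy (ℕ.≤-pred (ℕ.≤-trans lt le))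
      total : m x ℤ.+ sumℤ (map m (below x)) ≡ ℤ.+ 0
      total = trans (sym (sumℤ-↭ (Perm.map⁺ m (below-↭ v))))
                (m-sum v (λ e → ¬t (==-complete e)))

    mobius-unique : ∀ {x} → T (valid x) → mobius P x ≡ m x
    mobius-unique v = muFuel-unique _ v (ℕ.<⇒≤ (rk<∣P∣ v))

-- Words of labels

Word : ℕ → Set
Word n = List (Label n)

lo hi : ∀ {n} → Label n → Fin n
lo = proj₁
hi = proj₁ ∘ proj₂

tint : ∀ {n} → Label n → Fin 2
tint = proj₂ ∘ proj₂

eqLabel-sound : ∀ {n} {x y : Label n} → T (eqLabel x y) → x ≡ y
eqLabel-sound {x = a , b , u} {a′ , b′ , u′} t
  with =F-sound {i = a} (∧-fst t) | =F-sound {i = b} (∧-fst (∧-snd {a =F a′} t))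
     | =F-sound {i = u} (∧-snd {b =F b′} (∧-snd {a =F a′} t))
... | refl | refl | refl = refl

eqLabel-refl : ∀ {n} (x : Label n) → T (eqLabel x x)
eqLabel-refl (a , b , u) = ∧-intro (=F-refl a) (∧-intro (=F-refl b) (=F-refl u))

_≟L_ : ∀ {n} (x y : Label n) → Dec (x ≡ y)
x ≟L y with T? (eqLabel x y)
... | yes t = yes (eqLabel-sound t)
... | no ¬t = no λ { refl → ¬t (eqLabel-refl x) }

∈-allLabels : ∀ {n} (l : Label n) → l ∈ allLabels n
∈-allLabels (a , b , u) =
  ∈-cartesianProductWith⁺ _,_ (∈-allFin a) (∈-cartesianProductWith⁺ _,_ (∈-allFin b) (∈-allFin u))

-- A wrapper that keeps `x` and `y` inferable from a proof; `T (labLt x y)` unfolds and loses them.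
record _⊏_ {n} (x y : Label n) : Set where
  constructor mk⊏
  field un⊏ : T (labLt x y)
open _⊏_

_⊏?_ : ∀ {n} (x y : Label n) → Dec (x ⊏ y)
x ⊏? y with T? (labLt x y)
... | yes t = yes (mk⊏ t)
... | no ¬t = no (¬t ∘ un⊏)

⊏⁻ : ∀ {n} {x y : Label n} → x ⊏ y → toℕ (lo x) < toℕ (lo y) ⊎
  (lo x ≡ lo y × toℕ (hi x) ≤ toℕ (hi y) × toℕ (tint x) ≤ toℕ (tint y) × x ≢ y)
⊏⁻ {x = x@(a , b , u)} {y@(a′ , b′ , v)} (mk⊏ t) with ∨-elim (∧-fst {labLe x y} t)
... | inj₁ h = inj₁ (ℕ.<ᵇ⇒< _ _ h)
... | inj₂ h = inj₂ ( =F-sound (∧-fst h)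
                    , ℕ.≤ᵇ⇒≤ _ _ (∧-fst (∧-snd {a =F a′} h))
                    , ℕ.≤ᵇ⇒≤ _ _ (∧-snd {toℕ b ≤ᵇ toℕ b′} (∧-snd {a =F a′} h))
                    , λ { refl → T-not⁻ (∧-snd {labLe x y} t) (eqLabel-refl x) })

⊏-lo : ∀ {n} {x y : Label n} → toℕ (lo x) < toℕ (lo y) → x ⊏ y
⊏-lo {x = x} {y} lt = mk⊏ (∧-intro (∨-introˡ (ℕ.<⇒<ᵇ lt))
  (T-not⁺ λ e → ℕ.<-irrefl (cong (toℕ ∘ lo) (eqLabel-sound {x = x} {y} e)) lt))

⊏-hi : ∀ {n} {x y : Label n} → lo x ≡ lo y → toℕ (hi x) ≤ toℕ (hi y) → toℕ (tint x) ≤ toℕ (tint y) →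
  x ≢ y → x ⊏ y
⊏-hi {x = x} {y} e le le′ ne = mk⊏
  (∧-intro (∨-introʳ {toℕ (lo x) <ᵇ toℕ (lo y)}
            (∧-intro (=F-complete e) (∧-intro (ℕ.≤⇒≤ᵇ le) (ℕ.≤⇒≤ᵇ le′))))
          (T-not⁺ (ne ∘ eqLabel-sound)))

⊏⇒lo≤ : ∀ {n} {x y : Label n} → x ⊏ y → toℕ (lo x) ≤ toℕ (lo y)
⊏⇒lo≤ p with ⊏⁻ p
... | inj₁ lt = ℕ.<⇒≤ lt
... | inj₂ (e , _) = ℕ.≤-reflexive (cong toℕ e)

⊏-trans : ∀ {n} {x y z : Label n} → x ⊏ y → y ⊏ z → x ⊏ z
⊏-trans {x = x} {y} {z} p q with ⊏⁻ p | ⊏⁻ q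
... | inj₁ lt | _ = ⊏-lo (ℕ.<-≤-trans lt (⊏⇒lo≤ q))
... | inj₂ (e , _) | inj₁ lt = ⊏-lo (subst (λ a → toℕ a < toℕ (lo z)) (sym e) lt)
... | inj₂ (e , b≤ , u≤ , ne) | inj₂ (e′ , b≤′ , u≤′ , ne′) =
  ⊏-hi (trans e e′) (ℕ.≤-trans b≤ b≤′) (ℕ.≤-trans u≤ u≤′)
    λ { refl → ne (cong₂ _,_ e (cong₂ _,_ (Fin.toℕ-injective (ℕ.≤-antisym b≤ b≤′))
                                          (Fin.toℕ-injective (ℕ.≤-antisym u≤ u≤′)))) }

⊏-irrefl : ∀ {n} {x : Label n} → ¬ (x ⊏ x)
⊏-irrefl {x = x} (mk⊏ p) = T-not⁻ (∧-snd {labLe x x} p) (eqLabel-refl x)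

⊏-asym : ∀ {n} {x y : Label n} → x ⊏ y → ¬ (y ⊏ x)
⊏-asym p q = ⊏-irrefl (⊏-trans p q)

-- A merge labelled (a,b)^u makes `b` cease to be the least element of a block and changes no other
-- least element. So the block minima after `v` are the points outside `his v`.
his : ∀ {n} → Word n → List (Fin n)
his = map hi

-- Words are stored with the latest label first, so the label sequence of a chain is the reverse
-- of the word; `Val` says that the letters form a chain from the bottom of the partition poset.
app : ∀ {n} → Label n → Word n → Set
app (a , b , u) v = toℕ a < toℕ b × a ∉ his v × b ∉ his v

Val : ∀ {n} → Word n → Set
Val []      = ⊤
Val (l ∷ v) = app l v × Val v

-- Ascent-freeness of the chain, read from its last label backwards.
Fall : ∀ {n} → Word n → Set
Fall = Linked (λ x y → ¬ (y ⊏ x))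

-- What `sort` does to an ascent-free word with `l` appended. The label stops at the first one that
-- is not smaller, even if smaller ones, incomparable to that one, lie beyond.
insR : ∀ {n} → Label n → Word n → Word n
insR l []      = l ∷ []
insR l (x ∷ v) = if labLt x l then x ∷ insR l v else l ∷ x ∷ v

insR-< : ∀ {n} {l x : Label n} v → x ⊏ l → insR l (x ∷ v) ≡ x ∷ insR l v
insR-< v (mk⊏ p) = if-yes p

insR-≮ : ∀ {n} {l x : Label n} v → ¬ (x ⊏ l) → insR l (x ∷ v) ≡ l ∷ x ∷ v
insR-≮ v n = if-no (n ∘ mk⊏)

insR-↭ : ∀ {n} (l : Label n) v → insR l v ↭ l ∷ v
insR-↭ l [] = ↭-refl
insR-↭ l (x ∷ v) with x ⊏? l
... | yes p = ↭-trans (↭-reflexive (insR-< v p)) (↭-trans (prep x (insR-↭ l v)) (swap x l ↭-refl))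
... | no ¬p = ↭-reflexive (insR-≮ v ¬p)

app-↭ : ∀ {n} {l : Label n} {v w} → v ↭ w → app l v → app l w
app-↭ p (lt , a∉ , b∉) = lt , a∉ ∘ Perm.∈-resp-↭ (Perm.map⁺ hi (↭-sym p))
                             , b∉ ∘ Perm.∈-resp-↭ (Perm.map⁺ hi (↭-sym p))

app-∷⁻ : ∀ {n} {l x : Label n} {v} → app l (x ∷ v) → app l v
app-∷⁻ (lt , a∉ , b∉) = lt , a∉ ∘ there , b∉ ∘ there

-- Exchanging the two merges could fail only if `x` needed `hi l` as a block minimum. It does not:
-- `lo x ≤ lo l < hi l`, and the second entries differ.
Val-swap : ∀ {n} {l x : Label n} {v} → Val (l ∷ x ∷ v) → x ⊏ l → Val (x ∷ l ∷ v)
Val-swap {l = a , b , u} {x = x@(a′ , b′ , u′)} ((lt , a∉ , b∉) , (lt′ , a′∉ , b′∉) , V) p =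
  (lt′ , (λ { (here e) → ℕ.<-irrefl (cong toℕ e) (ℕ.≤-<-trans (⊏⇒lo≤ p) lt) ; (there i) → a′∉ i })
       , (λ { (here e) → b∉ (here (sym e)) ; (there i) → b′∉ i }))
  , (lt , a∉ ∘ there , b∉ ∘ there) , V

Val-insR : ∀ {n} (l : Label n) v → Val (l ∷ v) → Val (insR l v)
Val-insR l [] V = V
Val-insR l (x ∷ v) V with x ⊏? l
... | no ¬p = subst Val (sym (insR-≮ v ¬p)) V
... | yes p with Val-swap {l = l} {x} V p
... | ax , V′ = subst Val (sym (insR-< v p)) (app-↭ {l = x} (↭-sym (insR-↭ l v)) ax , Val-insR l v V′)

insR-Fall : ∀ {n} {l : Label n} {v} → Fall (l ∷ v) → insR l v ≡ l ∷ v
insR-Fall [-] = refl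
insR-Fall (¬p ∷ F) = insR-≮ _ ¬p

Linked-ʳ++ : ∀ {A : Set} {R : A → A → Set} x xs {ys} → Linked R (x ∷ xs) → Linked (flip R) (x ∷ ys) →
  Linked (flip R) (xs ʳ++ (x ∷ ys))
Linked-ʳ++ x [] [-] L′ = L′
Linked-ʳ++ x (y ∷ xs) (r ∷ L) L′ = Linked-ʳ++ y xs L (r ∷ L′)

Linked-reverse : ∀ {A : Set} {R : A → A → Set} {xs} → Linked R xs → Linked (flip R) (reverse xs)
Linked-reverse {xs = []} L = []
Linked-reverse {xs = x ∷ xs} L = Linked-ʳ++ x xs L [-]

NoAscent : ∀ {n} → Word n → Set
NoAscent = Linked (λ x y → ¬ (x ⊏ y))

hasAscent⁻ : ∀ {n} (w : Word n) → ¬ T (hasAscent w) → NoAscent w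
hasAscent⁻ [] _ = []
hasAscent⁻ (x ∷ []) _ = [-]
hasAscent⁻ (x ∷ y ∷ w) h = (h ∘ ∨-introˡ ∘ un⊏) ∷ hasAscent⁻ (y ∷ w) (h ∘ ∨-introʳ {labLt x y})

hasAscent⁺ : ∀ {n} {w : Word n} → NoAscent w → ¬ T (hasAscent w)
hasAscent⁺ {w = x ∷ y ∷ w} (n ∷ L) t with ∨-elim {labLt x y} t
... | inj₁ p = n (mk⊏ p)
... | inj₂ h = hasAscent⁺ L h

sortStep-NoAscent : ∀ {n} {w : Word n} → NoAscent w → sortStep w ≡ nothing
sortStep-NoAscent [] = refl
sortStep-NoAscent [-] = refl
sortStep-NoAscent (n ∷ L) = trans (if-no (n ∘ mk⊏)) (cong (Maybe.map _) (sortStep-NoAscent L))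

-- There is no ascent up to and including `y`, so the leftmost one lies in `y ∷ w`.
sortStep-ʳ++ : ∀ {n} v (y : Label n) w → Fall (y ∷ v) →
  sortStep (v ʳ++ (y ∷ w)) ≡ Maybe.map (v ʳ++_) (sortStep (y ∷ w))
sortStep-ʳ++ [] y w F = sym (mapid (sortStep (y ∷ w)))
  where
  mapid : ∀ {A : Set} (m : Maybe A) → Maybe.map id m ≡ m
  mapid (just _) = refl
  mapid nothing  = refl
sortStep-ʳ++ (x ∷ v) y w (n ∷ F) =
  trans (sortStep-ʳ++ v x (y ∷ w) F)
    (trans (cong (Maybe.map (v ʳ++_)) (if-no (n ∘ mk⊏))) (map-map (sortStep (y ∷ w))))
  where
  map-map : ∀ m → Maybe.map (v ʳ++_) (Maybe.map (x ∷_) m) ≡ Maybe.map ((x ∷ v) ʳ++_) m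
  map-map (just _) = refl
  map-map nothing  = refl

sortFuel-nothing : ∀ {n} f (w : Word n) → sortStep w ≡ nothing → sortFuel f w ≡ w
sortFuel-nothing zero w e = refl
sortFuel-nothing (suc f) w e with sortStep w | e
... | .nothing | refl = refl

sortFuel-just : ∀ {n} f (w : Word n) {w′} → sortStep w ≡ just w′ → sortFuel (suc f) w ≡ sortFuel f w′
sortFuel-just f w e with sortStep w | e
... | .(just _) | refl = refl

-- While `l` travels left, `t` collects the labels it has passed. The hypothesis `K` says that the
-- left neighbour of `l` makes no ascent with `t`; so after a swap the only possible ascent is again
-- the one just before `l`. Each swap uses up one label of `v`, which bounds the fuel.
sortFuel-insR : ∀ {n} f v (l : Label n) t → length v ≤ f → Fall v → NoAscent (l ∷ t) →
  (∀ {x v′} → v ≡ x ∷ v′ → NoAscent (x ∷ t)) → sortFuel f (v ʳ++ (l ∷ t)) ≡ insR l v ʳ++ t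
sortFuel-insR f [] l t le F N K = sortFuel-nothing f _ (sortStep-NoAscent N)
sortFuel-insR (suc f) (x ∷ v) l t (s≤s le) F N K with x ⊏? l
... | no ¬p = trans
  (sortFuel-nothing (suc f) _ (trans (sortStep-ʳ++ (x ∷ v) l t (¬p ∷ F))
                                     (cong (Maybe.map _) (sortStep-NoAscent N))))
  (cong (_ʳ++ t) (sym (insR-≮ v ¬p)))
... | yes p = trans
  (sortFuel-just f (v ʳ++ (x ∷ l ∷ t)) (trans (sortStep-ʳ++ v x (l ∷ t) F) (cong (Maybe.map (v ʳ++_)) (if-yes (un⊏ p)))))
  (trans (sortFuel-insR f v l (x ∷ t) le (Linked.tail F) (⊏-asym p ∷ K refl) (K′ F))
         (cong (_ʳ++ t) (sym (insR-< v p))))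
  where
  K′ : Fall (x ∷ v) → ∀ {y v′} → v ≡ y ∷ v′ → NoAscent (y ∷ x ∷ t)
  K′ (n ∷ _) refl = n ∷ K refl

sortW-insR : ∀ {n} v (l : Label n) → Fall v → sortW (reverse v ++ [ l ]) ≡ reverse (insR l v)
sortW-insR v l F = begin
  sortW (reverse v ++ [ l ])    ≡⟨ cong sortW (ʳ++-defn v) ⟨
  sortW (v ʳ++ [ l ])           ≡⟨ sortFuel-insR _ v l [] fuel F [-] (λ _ → [-]) ⟩
  insR l v ʳ++ []               ∎
  where
  open ≡-Reasoning
  len : length (v ʳ++ [ l ]) ≡ suc (length v)
  len = trans (cong length (ʳ++-defn v {[ l ]}))
    (trans (length-++ (reverse v)) (trans (ℕ.+-comm (length (reverse v)) 1) (cong suc (length-reverse v))))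
  fuel : length v ≤ length (v ʳ++ [ l ]) * length (v ʳ++ [ l ])
  fuel rewrite len = ℕ.≤-trans (ℕ.n≤1+n _) (ℕ.m≤m*n (suc (length v)) (suc (length v)))

-- The order of the forest poset carried over to words: a cover is an insertion (`⊑⇒Reach`,
-- `Reach⇒⊑`).
data _⊑_ {n} : Word n → Word n → Set where
  ⊑-refl : ∀ {v} → v ⊑ v
  ⊑-step : ∀ {v w} l → app l v → insR l v ⊑ w → v ⊑ w

snoc≢[] : ∀ {A : Set} (xs : List A) {x} → xs ++ [ x ] ≢ []
snoc≢[] [] ()
snoc≢[] (_ ∷ _) ()

insR-last⁻ : ∀ {n} (l f : Label n) v w → l ≢ f → insR l v ≡ w ++ [ f ] → ∃ λ v′ → v ≡ v′ ++ [ f ]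
insR-last⁻ l f [] [] ne refl = ⊥-elim (ne refl)
insR-last⁻ l f [] (_ ∷ w) ne e = ⊥-elim (snoc≢[] w (sym (cong (drop 1) e)))
insR-last⁻ l f (x ∷ v) w ne e with x ⊏? l
insR-last⁻ l f (x ∷ v) [] ne e | yes p with trans (sym (insR-< v p)) e
... | q with insR l v | insR-↭ l v
... | [] | r = ⊥-elim (ℕ.0≢1+n (Perm.↭-length r))
insR-last⁻ l f (x ∷ v) [] ne e | yes p | () | _ ∷ _ | _
insR-last⁻ l f (x ∷ v) (y ∷ w) ne e | yes p
  with insR-last⁻ l f v w ne (cong (drop 1) (trans (sym (insR-< v p)) e))
... | v′ , refl = x ∷ v′ , refl
insR-last⁻ l f (x ∷ v) [] ne e | no ¬p with trans (sym (insR-≮ v ¬p)) e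
... | ()
insR-last⁻ l f (x ∷ v) (y ∷ w) ne e | no ¬p =
  w , cong (drop 1) (trans (sym (insR-≮ v ¬p)) e)

insR-last : ∀ {n} (f : Label n) v w → f ∉ v → insR f v ≡ w ++ [ f ] → All (_⊏ f) v
insR-last f [] w f∉ e = []
insR-last f (x ∷ v) w f∉ e with x ⊏? f
insR-last f (x ∷ v) [] f∉ e | yes p with trans (sym (insR-< v p)) e
... | q with insR f v | insR-↭ f v
... | [] | r = ⊥-elim (ℕ.0≢1+n (Perm.↭-length r))
insR-last f (x ∷ v) [] f∉ e | yes p | () | _ ∷ _ | _
insR-last f (x ∷ v) (y ∷ w) f∉ e | yes p =
  p ∷ insR-last f v w (f∉ ∘ there) (cong (drop 1) (trans (sym (insR-< v p)) e))
insR-last f (x ∷ v) [] f∉ e | no ¬p with trans (sym (insR-≮ v ¬p)) e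
... | ()
insR-last f (x ∷ v) (y ∷ w) f∉ e | no ¬p =
  ⊥-elim (f∉ (subst (f ∈_) (cong (drop 1) (sym (trans (sym (insR-≮ v ¬p)) e)))
    (∈-++⁺ʳ w (here refl))))

insR-all : ∀ {n} {f : Label n} {v} → All (_⊏ f) v → insR f v ≡ v ++ [ f ]
insR-all [] = refl
insR-all {v = x ∷ v} (p ∷ h) = trans (insR-< v p) (cong (x ∷_) (insR-all h))

insR-++ : ∀ {n} {l f : Label n} v → ¬ (f ⊏ l) → insR l (v ++ [ f ]) ≡ insR l v ++ [ f ]
insR-++ [] ¬p = insR-≮ [] ¬p
insR-++ {l = l} {f} (x ∷ v) ¬p with x ⊏? l
... | yes q = trans (insR-< _ q) (trans (cong (x ∷_) (insR-++ v ¬p)) (cong (_++ [ f ]) (sym (insR-< v q))))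
... | no ¬q = trans (insR-≮ _ ¬q) (cong (_++ [ f ]) (sym (insR-≮ v ¬q)))

∈-insR : ∀ {n} {x l : Label n} {v} → x ∈ v → x ∈ insR l v
∈-insR {l = l} {v} i = Perm.∈-resp-↭ (↭-sym (insR-↭ l v)) (there i)

app⇒≢ : ∀ {n} {l f : Label n} {v} → app l v → f ∈ v → l ≢ f
app⇒≢ (_ , _ , b∉) i refl = b∉ (∈-map⁺ hi i)

-- Insertions keep the relative order of the labels already present. Anything stored after `f` in
-- `v` would still be stored after it in `w`.
⊑-last : ∀ {n} {f : Label n} {v w} → v ⊑ w → ∀ {w′} → w ≡ w′ ++ [ f ] → f ∈ v → ∃ λ v′ → v ≡ v′ ++ [ f ]
⊑-last ⊑-refl {w′} e i = w′ , e
⊑-last {f = f} {v} (⊑-step l a r) e i with ⊑-last r e (∈-insR i)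
... | u , e′ = insR-last⁻ l f v u (app⇒≢ {l = l} {f} {v} a i) e′

-- At some step `f` is inserted and travels to the very end, past everything present then; so all
-- earlier labels are smaller than `f`. Those labels never pass `f`, hence inserting `f` first leads
-- to the same word.
⊑-add-last : ∀ {n} {f : Label n} {v w} → v ⊑ w → ∀ {w′} → w ≡ w′ ++ [ f ] → f ∉ v →
  All (_⊏ f) v × app f v × (v ++ [ f ]) ⊑ w
⊑-add-last ⊑-refl {w′} refl f∉ = ⊥-elim (f∉ (∈-++⁺ʳ w′ (here refl)))
⊑-add-last {f = f} {v} {w} (⊑-step l a r) e f∉ with l ≟L f
... | yes refl with ⊑-last r e (Perm.∈-resp-↭ (↭-sym (insR-↭ l v)) (here refl))
... | u , e′ with insR-last f v u f∉ e′
... | h = h , a , subst (_⊑ w) (insR-all h) r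
⊑-add-last {n} {f} {v} {w} (⊑-step l a@(lt , a∉ , b∉) r) e f∉ | no ne
  with ⊑-add-last r e (λ i → notin (Perm.∈-resp-↭ (insR-↭ l v) i))
  where
  notin : f ∉ l ∷ v
  notin (here q) = ne (sym q)
  notin (there i) = f∉ i
... | h , af , r′ with Perm.All-resp-↭ (insR-↭ l v) h
... | l⊏f ∷ hv =
  hv , app-∷⁻ {l = f} {l} af′ , ⊑-step l (lt , a∉′ , b∉′) (subst (_⊑ w) (sym (insR-++ v (⊏-asym l⊏f))) r′)
  where
  af′ : app f (l ∷ v)
  af′ = app-↭ {l = f} (insR-↭ l v) af
  -- The extra letter `f` is no obstacle, because `l ⊏ f` gives `lo l ≤ lo f < hi f`.
  a∉′ : lo l ∉ his (v ++ [ f ])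
  a∉′ i with ∈-++⁻ (his v) (subst (lo l ∈_) (map-++ hi v [ f ]) i)
  ... | inj₁ j = a∉ j
  ... | inj₂ (here q) = ℕ.<-irrefl (cong toℕ q) (ℕ.≤-<-trans (⊏⇒lo≤ l⊏f) (proj₁ af))
  b∉′ : hi l ∉ his (v ++ [ f ])
  b∉′ i with ∈-++⁻ (his v) (subst (hi l ∈_) (map-++ hi v [ f ]) i)
  ... | inj₁ j = b∉ j
  ... | inj₂ (here q) = proj₂ (proj₂ af′) (here (sym q))

-- Read from left to right, against the storage convention of words, v is the label sequence of an
-- increasing chain.
Good : ∀ {n} → Word n → Set
Good v = Linked _⊏_ v × Val (reverse v)

Linked-snoc : ∀ {n} {f : Label n} {v} → Linked _⊏_ v → All (_⊏ f) v → Linked _⊏_ (v ++ [ f ])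
Linked-snoc [] h = [-]
Linked-snoc [-] (p ∷ []) = p ∷ [-]
Linked-snoc (q ∷ L) (p ∷ h) = q ∷ Linked-snoc L h

Linked-unsnoc : ∀ {n} {f : Label n} v → Linked _⊏_ (v ++ [ f ]) → Linked _⊏_ v × All (_⊏ f) v
Linked-unsnoc [] _ = [] , []
Linked-unsnoc (x ∷ []) (p ∷ _) = [-] , p ∷ []
Linked-unsnoc {f = f} (x ∷ y ∷ v) (q ∷ L) with Linked-unsnoc (y ∷ v) L
... | L′ , h@(p ∷ _) = q ∷ L′ , ⊏-trans q p ∷ h

Good-snoc : ∀ {n} {f : Label n} {v} → Good v → All (_⊏ f) v → app f v → Good (v ++ [ f ])
Good-snoc {f = f} {v} (L , V) h a =
  Linked-snoc L h , subst Val (sym (reverse-++ v [ f ])) (app-↭ {l = f} (↭-sym (Perm.↭-reverse v)) a , V)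

Good-unsnoc : ∀ {n} {f : Label n} v → Good (v ++ [ f ]) → Good v × All (_⊏ f) v × app f v
Good-unsnoc {f = f} v (L , V) with Linked-unsnoc v L | subst Val (reverse-++ v [ f ]) V
... | L′ , h | a , V′ = (L′ , V′) , h , app-↭ {l = f} (Perm.↭-reverse v) a

Val-unsnoc : ∀ {n} {f : Label n} v → Val (v ++ [ f ]) → Val v
Val-unsnoc [] _ = tt
Val-unsnoc {f = f} (x ∷ v) ((lt , a∉ , b∉) , V) =
  (lt , a∉ ∘ mono , b∉ ∘ mono) , Val-unsnoc v V
  where
  mono : ∀ {c} → c ∈ his v → c ∈ his (v ++ [ f ])
  mono {c} i = subst (c ∈_) (sym (map-++ hi v [ f ])) (∈-++⁺ˡ i)

ascending⇒Fall : ∀ {n} {v : Word n} → Linked _⊏_ v → Fall v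
ascending⇒Fall [] = []
ascending⇒Fall [-] = [-]
ascending⇒Fall {v = x ∷ y ∷ _} (p ∷ L) = ⊏-asym p ∷ ascending⇒Fall L

-- Weighted partitions as states of words

ΣF : ∀ {n} → (Fin n → ℕ) → ℕ
ΣF {zero}  f = 0
ΣF {suc n} f = f fz + ΣF (f ∘ fs)

ΣF-cong : ∀ {n} {f g : Fin n → ℕ} → (∀ i → f i ≡ g i) → ΣF f ≡ ΣF g
ΣF-cong {zero}  h = refl
ΣF-cong {suc n} h = cong₂ _+_ (h fz) (ΣF-cong (h ∘ fs))

ΣF-mono : ∀ {n} {f g : Fin n → ℕ} → (∀ i → f i ≤ g i) → ΣF f ≤ ΣF g
ΣF-mono {zero}  h = z≤n
ΣF-mono {suc n} h = ℕ.+-mono-≤ (h fz) (ΣF-mono (h ∘ fs))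

ΣF-+ : ∀ {n} (f g : Fin n → ℕ) → ΣF (λ i → f i + g i) ≡ ΣF f + ΣF g
ΣF-+ {zero}  f g = refl
ΣF-+ {suc n} f g = trans (cong (f fz + g fz +_) (ΣF-+ (f ∘ fs) (g ∘ fs)))
  (ℕ+.interchange (f fz) (g fz) (ΣF (f ∘ fs)) (ΣF (g ∘ fs)))

ΣF-0 : ∀ {n} {f : Fin n → ℕ} → (∀ i → f i ≡ 0) → ΣF f ≡ 0
ΣF-0 {zero}  h = refl
ΣF-0 {suc n} h = cong₂ _+_ (h fz) (ΣF-0 (h ∘ fs))

ΣF-≤n : ∀ {n} {f : Fin n → ℕ} → (∀ i → f i ≤ 1) → ΣF f ≤ n
ΣF-≤n {zero}  h = z≤n
ΣF-≤n {suc n} h = ℕ.+-mono-≤ (h fz) (ΣF-≤n (h ∘ fs))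

𝟙 : Bool → ℕ
𝟙 b = if b then 1 else 0

𝟙≤1 : ∀ b → 𝟙 b ≤ 1
𝟙≤1 true  = s≤s z≤n
𝟙≤1 false = z≤n

δ : ∀ {n} → Fin n → ℕ → Fin n → ℕ
δ a c i = if i =F a then c else 0

=F-no : ∀ {n} {i j : Fin n} → i ≢ j → ¬ T (i =F j)
=F-no ne t = ne (=F-sound t)

δ-≡ : ∀ {n} (a : Fin n) {c} → δ a c a ≡ c
δ-≡ a = if-yes (=F-refl a)

δ-≢ : ∀ {n} {a i : Fin n} {c} → i ≢ a → δ a c i ≡ 0
δ-≢ ne = if-no (=F-no ne)

ΣF-δ : ∀ {n} (a : Fin n) c → ΣF (δ a c) ≡ c
ΣF-δ {suc n} fz c = trans (cong (c +_) (ΣF-0 {n} {λ i → δ fz c (fs i)} (λ i → refl))) (ℕ.+-identityʳ c)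
ΣF-δ {suc n} (fs a) c = ΣF-δ a c

-- For two sums that differ in the terms at `a` and `b` only; the corrections are added on both
-- sides so that no truncated subtraction occurs.
ΣF-balance : ∀ {n} {f g : Fin n → ℕ} (a b : Fin n) c d → (∀ i → f i + δ b d i ≡ g i + δ a c i) →
  ΣF f + d ≡ ΣF g + c
ΣF-balance {f = f} {g} a b c d h = begin
  ΣF f + d ≡⟨ cong (ΣF f +_) (ΣF-δ b d) ⟨
  ΣF f + ΣF (δ b d) ≡⟨ ΣF-+ f (δ b d) ⟨
  ΣF (λ i → f i + δ b d i) ≡⟨ ΣF-cong h ⟩
  ΣF (λ i → g i + δ a c i) ≡⟨ ΣF-+ g (δ a c) ⟩
  ΣF g + ΣF (δ a c) ≡⟨ cong (ΣF g +_) (ΣF-δ a c) ⟩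
  ΣF g + c ∎
  where open ≡-Reasoning

count-tabulate : ∀ {A : Set} {n} (p : A → Bool) (f : Fin n → A) →
  count p (List.tabulate f) ≡ ΣF (λ i → 𝟙 (p (f i)))
count-tabulate {n = zero} p f = refl
count-tabulate {n = suc n} p f with p (f fz)
... | true  = cong suc (count-tabulate p (f ∘ fs))
... | false = count-tabulate p (f ∘ fs)

rep : ∀ {n} → RawΠ n → Fin n → Fin n
rep y i = lookup (proj₁ y) i

wt : ∀ {n} → RawΠ n → Fin n → ℕ
wt y i = toℕ (lookup (proj₂ y) i)

size : ∀ {n} → RawΠ n → Fin n → ℕ
size y i = ΣF (λ j → 𝟙 (rep y j =F i))

record ValidΠ {n} (y : RawΠ n) : Set where
  field
    rep≤    : ∀ i → toℕ (rep y i) ≤ toℕ i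
    rep-rep : ∀ i → rep y (rep y i) ≡ rep y i
    wt-min  : ∀ {i} → rep y i ≡ i → wt y i < size y i
    wt-non  : ∀ {i} → rep y i ≢ i → wt y i ≡ 0
open ValidΠ

validΠ⁻ : ∀ {n} {y : RawΠ n} → T (validΠ y) → ValidΠ y
validΠ⁻ {n} {r , w} t = record
  { rep≤ = λ i → ℕ.≤ᵇ⇒≤ _ _ (∧-fst (ok i))
  ; rep-rep = λ i → =F-sound (∧-fst (∧-snd {toℕ (lookup r i) ≤ᵇ toℕ i} (ok i)))
  ; wt-min = λ {i} e → subst (toℕ (lookup w i) <_) (count-tabulate (λ j → lookup r j =F i) id)
      (ℕ.<ᵇ⇒< _ _ (subst T (if-yes (=F-complete e)) (ok₃ i)))
  ; wt-non = λ {i} ne → ℕ.≡ᵇ⇒≡ _ _ (subst T (if-no (=F-no ne)) (ok₃ i)) }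
  where
  ok : ∀ i → T _
  ok i = all⁻ _ t (∈-allFin i)
  ok₃ : ∀ i → T (if lookup r i =F i then toℕ (lookup w i) <ᵇ count (λ j → lookup r j =F i) (allFin n)
                 else (toℕ (lookup w i) ≡ᵇ 0))
  ok₃ i = ∧-snd {lookup r (lookup r i) =F lookup r i} (∧-snd {toℕ (lookup r i) ≤ᵇ toℕ i} (ok i))

validΠ⁺ : ∀ {n} {y : RawΠ n} → ValidΠ y → T (validΠ y)
validΠ⁺ {n} {y@(r , w)} V = all⁺ _ (allFin n) λ {i} _ →
  ∧-intro (ℕ.≤⇒≤ᵇ (rep≤ V i)) (∧-intro (=F-complete (rep-rep V i)) (third i))
  where
  third : ∀ i → T (if lookup r i =F i then toℕ (lookup w i) <ᵇ count (λ j → lookup r j =F i) (allFin n)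
                   else (toℕ (lookup w i) ≡ᵇ 0))
  third i with rep y i ≟ i
  ... | yes e = subst T (sym (if-yes (=F-complete e))) (ℕ.<⇒<ᵇ
      (subst (wt y i <_) (sym (count-tabulate (λ j → lookup r j =F i) id)) (wt-min V e)))
  ... | no ne = subst T (sym (if-no (=F-no ne))) (ℕ.≡⇒≡ᵇ _ _ (wt-non V ne))

clamp : ∀ {n} → Fin n → ℕ → Fin n
clamp {n} i k with k <? n
... | yes p = fromℕ< p
... | no _  = i

clamp-< : ∀ {n} {i : Fin n} {k} → k < n → toℕ (clamp i k) ≡ k
clamp-< {n} {k = k} lt with k <? n
... | yes p = Fin.toℕ-fromℕ< p
... | no ¬p = ⊥-elim (¬p lt)

-- The weight of the merged block never reaches n on valid input, so `clamp` does not truncate there.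
merge : ∀ {n} → Label n → RawΠ n → RawΠ n
merge (a , b , u) y@(r , w) =
  Vec.map (λ x → if x =F b then a else x) r ,
  tabulate λ i → if i =F a then clamp i (wt y a + wt y b + toℕ u)
                 else (if i =F b then fin0 i else lookup w i)

appΠ : ∀ {n} → Label n → RawΠ n → Set
appΠ (a , b , u) y = toℕ a < toℕ b × rep y a ≡ a × rep y b ≡ b

<⇒≢F : ∀ {n} {a b : Fin n} → toℕ a < toℕ b → a ≢ b
<⇒≢F lt refl = ℕ.<-irrefl refl lt

toℕ-fin0 : ∀ {n} (i : Fin n) → toℕ (fin0 i) ≡ 0
toℕ-fin0 fz = refl
toℕ-fin0 (fs i) = refl

module _ {n} (a b : Fin n) (u : Fin 2) (y : RawΠ n) where
  private z = merge (a , b , u) y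

  rep-merge-≡ : ∀ {i} → rep y i ≡ b → rep z i ≡ a
  rep-merge-≡ {i} e = trans (Vec.lookup-map i _ (proj₁ y)) (if-yes (=F-complete e))

  rep-merge-≢ : ∀ {i} → rep y i ≢ b → rep z i ≡ rep y i
  rep-merge-≢ {i} ne = trans (Vec.lookup-map i _ (proj₁ y)) (if-no (=F-no ne))

  wt-merge-lo : wt y a + wt y b + toℕ u < n → wt z a ≡ wt y a + wt y b + toℕ u
  wt-merge-lo lt = trans (cong toℕ (trans (Vec.lookup∘tabulate _ a) (if-yes (=F-refl a)))) (clamp-< lt)

  wt-merge-hi : a ≢ b → wt z b ≡ 0
  wt-merge-hi ne = trans (cong toℕ (trans (Vec.lookup∘tabulate _ b)
    (trans (if-no (=F-no (ne ∘ sym))) (if-yes (=F-refl b))))) (toℕ-fin0 b)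

  wt-merge-≢ : ∀ {i} → i ≢ a → i ≢ b → wt z i ≡ wt y i
  wt-merge-≢ {i} na nb = cong toℕ (trans (Vec.lookup∘tabulate _ i) (trans (if-no (=F-no na)) (if-no (=F-no nb))))

  module Merge (V : ValidΠ y) (A : appΠ (a , b , u) y) where
    a≢b : a ≢ b
    a≢b = <⇒≢F (proj₁ A)

    rep-lo : rep z a ≡ a
    rep-lo = trans (rep-merge-≢ (λ e → a≢b (trans (sym (proj₁ (proj₂ A))) e))) (proj₁ (proj₂ A))

    rep-hi : rep z b ≡ a
    rep-hi = rep-merge-≡ (proj₂ (proj₂ A))

    rep-fix⁺ : ∀ {i} → i ≢ b → rep y i ≡ i → rep z i ≡ i
    rep-fix⁺ ne e = trans (rep-merge-≢ (λ e′ → ne (trans (sym e) e′))) e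

    rep-fix⁻ : ∀ {i} → rep z i ≡ i → i ≢ b × rep y i ≡ i
    rep-fix⁻ {i} e with rep y i ≟ b
    ... | no ne = (λ { refl → ne (proj₂ (proj₂ A)) }) , trans (sym (rep-merge-≢ ne)) e
    ... | yes e′ with trans (sym (rep-merge-≡ e′)) e
    ... | refl = ⊥-elim (a≢b (trans (sym (proj₁ (proj₂ A))) e′))

    size-lo : size z a ≡ size y a + size y b
    size-lo = trans (ΣF-cong pointwise) (ΣF-+ (λ j → 𝟙 (rep y j =F a)) (λ j → 𝟙 (rep y j =F b)))
      where
      pointwise : ∀ j → 𝟙 (rep z j =F a) ≡ 𝟙 (rep y j =F a) + 𝟙 (rep y j =F b)
      pointwise j with rep y j ≟ b
      ... | yes e = trans (if-yes (=F-complete (rep-merge-≡ e)))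
        (sym (cong₂ _+_ (if-no (=F-no (λ e′ → a≢b (trans (sym e′) e)))) (if-yes (=F-complete e))))
      ... | no ne = trans (cong (λ t → 𝟙 (t =F a)) (rep-merge-≢ ne))
        (trans (sym (ℕ.+-identityʳ _)) (cong (𝟙 (rep y j =F a) +_) (sym (if-no (=F-no ne)))))

    size-≢ : ∀ {i} → i ≢ a → i ≢ b → size z i ≡ size y i
    size-≢ {i} na nb = ΣF-cong pointwise
      where
      pointwise : ∀ j → 𝟙 (rep z j =F i) ≡ 𝟙 (rep y j =F i)
      pointwise j with rep y j ≟ b
      ... | yes e = trans (if-no (=F-no (λ e′ → na (trans (sym e′) (rep-merge-≡ e)))))
        (sym (if-no (=F-no (λ e′ → nb (trans (sym e′) e)))))
      ... | no ne = cong (λ t → 𝟙 (t =F i)) (rep-merge-≢ ne)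

    -- Each weight is at most its block size minus one, so the merged block has one unit to spare,
    -- and `u` takes at most that.
    wt-bound : wt y a + wt y b + toℕ u < size z a
    wt-bound = subst (wt y a + wt y b + toℕ u <_) (sym size-lo) (begin-strict
      wt y a + wt y b + toℕ u      ≤⟨ ℕ.+-monoʳ-≤ (wt y a + wt y b) (ℕ.≤-pred (Fin.toℕ<n u)) ⟩
      wt y a + wt y b + 1 ≡⟨ ℕ.+-assoc (wt y a) (wt y b) 1 ⟩
      wt y a + (wt y b + 1) ≡⟨ cong (wt y a +_) (ℕ.+-comm (wt y b) 1) ⟩
      wt y a + suc (wt y b)        <⟨ ℕ.+-mono-<-≤ (wt-min V (proj₁ (proj₂ A))) (wt-min V (proj₂ (proj₂ A))) ⟩
      size y a + size y b ∎)
      where open ℕ.≤-Reasoning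

    wt-fits : wt y a + wt y b + toℕ u < n
    wt-fits = ℕ.<-≤-trans wt-bound (ΣF-≤n (λ j → 𝟙≤1 (rep z j =F a)))

    wt-lo : wt z a ≡ wt y a + wt y b + toℕ u
    wt-lo = wt-merge-lo wt-fits

    merge-valid : ValidΠ z
    merge-valid = record { rep≤ = le ; rep-rep = idem ; wt-min = mn ; wt-non = nn }
      where
      le : ∀ i → toℕ (rep z i) ≤ toℕ i
      le i with rep y i ≟ b
      ... | yes e = ℕ.≤-trans (ℕ.≤-reflexive (cong toℕ (rep-merge-≡ e)))
        (ℕ.≤-trans (ℕ.<⇒≤ (proj₁ A)) (subst (λ t → toℕ t ≤ toℕ i) e (rep≤ V i)))
      ... | no ne = subst (λ t → toℕ t ≤ toℕ i) (sym (rep-merge-≢ ne)) (rep≤ V i)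
      idem : ∀ i → rep z (rep z i) ≡ rep z i
      idem i with rep y i ≟ b
      ... | yes e = subst (λ t → rep z t ≡ t) (sym (rep-merge-≡ e)) rep-lo
      ... | no ne = subst (λ t → rep z t ≡ t) (sym (rep-merge-≢ ne)) (rep-fix⁺ ne (rep-rep V i))
      mn : ∀ {i} → rep z i ≡ i → wt z i < size z i
      mn {i} e with i ≟ a
      ... | yes refl = subst (_< size z a) (sym wt-lo) wt-bound
      ... | no na with rep-fix⁻ e
      ... | nb , e′ = subst₂ _<_ (sym (wt-merge-≢ na nb)) (sym (size-≢ na nb)) (wt-min V e′)
      nn : ∀ {i} → rep z i ≢ i → wt z i ≡ 0
      nn {i} ne with i ≟ b
      ... | yes refl = wt-merge-hi a≢b
      ... | no nb = trans (wt-merge-≢ (λ { refl → ne rep-lo }) nb) (wt-non V (λ e → ne (rep-fix⁺ nb e)))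

coverLΠ⁻ : ∀ {n} {y z : RawΠ n} l → ValidΠ y → T (coverLΠ y z l) → appΠ l y × z ≡ merge l y
coverLΠ⁻ {n} {y@(r , w)} {z@(r′ , w′)} l@(a , b , u) V t =
  A , cong₂ _,_ (vecEq-sound =F-sound (∧-fst t₃)) (lookup-ext λ i → Fin.toℕ-injective (weight i))
  where
  t₁ = ∧-snd {toℕ a <ᵇ toℕ b} t
  t₂ = ∧-snd {lookup r a =F a} t₁
  t₃ = ∧-snd {lookup r b =F b} t₂
  t₄ = ∧-snd {vecEq _=F_ r′ (Vec.map (λ x → if x =F b then a else x) r)} t₃
  t₅ = ∧-snd {toℕ (lookup w′ a) ≡ᵇ toℕ (lookup w a) + toℕ (lookup w b) + toℕ u} t₄
  A : appΠ l y
  A = ℕ.<ᵇ⇒< _ _ (∧-fst t) , =F-sound (∧-fst t₁) , =F-sound (∧-fst t₂)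
  open Merge a b u y V A
  rest : ∀ i → i ≢ a → wt z i ≡ (if i =F b then 0 else wt y i)
  rest i ne with ∨-elim {i =F a} (all⁻ _ t₅ (∈-allFin i))
  ... | inj₁ e = ⊥-elim (ne (=F-sound e))
  ... | inj₂ e = ℕ.≡ᵇ⇒≡ _ _ e
  weight : ∀ i → wt z i ≡ wt (merge l y) i
  weight i with i ≟ a
  ... | yes refl = trans (ℕ.≡ᵇ⇒≡ _ _ (∧-fst t₄)) (sym wt-lo)
  ... | no na with i ≟ b
  ... | yes refl = trans (rest b na) (trans (if-yes (=F-refl b)) (sym (wt-merge-hi a b u y a≢b)))
  ... | no nb = trans (rest i na) (trans (if-no (=F-no nb)) (sym (wt-merge-≢ a b u y na nb)))

coverLΠ⁺ : ∀ {n} {y : RawΠ n} l → ValidΠ y → appΠ l y → T (coverLΠ y (merge l y) l)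
coverLΠ⁺ {n} {y} l@(a , b , u) V A@(lt , ea , eb) =
  ∧-intro (ℕ.<⇒<ᵇ lt) (∧-intro (=F-complete ea) (∧-intro (=F-complete eb)
    (∧-intro (vecEq-refl =F-refl (proj₁ (merge l y))) (∧-intro (ℕ.≡⇒≡ᵇ _ _ wt-lo) (all⁺ _ (allFin n) λ {i} _ → rest i)))))
  where
  open Merge a b u y V A
  rest : ∀ i → T ((i =F a) ∨ (wt (merge l y) i ≡ᵇ (if i =F b then 0 else wt y i)))
  rest i with i ≟ a
  ... | yes refl = ∨-introˡ (=F-refl a)
  ... | no na with i ≟ b
  ... | yes refl = ∨-introʳ {b =F a} (ℕ.≡⇒≡ᵇ _ _
          (trans (wt-merge-hi a b u y a≢b) (sym (if-yes (=F-refl b)))))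
  ... | no nb = ∨-introʳ {i =F a} (ℕ.≡⇒≡ᵇ _ _
          (trans (wt-merge-≢ a b u y na nb) (sym (if-no (=F-no nb)))))

botΠ-rep : ∀ {n} (i : Fin n) → rep (botΠ n) i ≡ i
botΠ-rep i = Vec.lookup∘tabulate id i

botΠ-wt : ∀ {n} (i : Fin n) → wt (botΠ n) i ≡ 0
botΠ-wt i = trans (cong toℕ (Vec.lookup∘tabulate fin0 i)) (toℕ-fin0 i)

size-fix : ∀ {n} {y : RawΠ n} {i} → rep y i ≡ i → 1 ≤ size y i
size-fix {y = y} {i} e = subst (_≤ size y i) (ΣF-δ i 1) (ΣF-mono pointwise)
  where
  pointwise : ∀ j → δ i 1 j ≤ 𝟙 (rep y j =F i)
  pointwise j with j ≟ i
  ... | yes refl = ℕ.≤-reflexive (trans (δ-≡ j) (sym (if-yes (=F-complete e))))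
  ... | no ne = ℕ.≤-trans (ℕ.≤-reflexive (δ-≢ ne)) z≤n

botΠ-valid : ∀ {n} → ValidΠ (botΠ n)
botΠ-valid {n} = record
  { rep≤ = λ i → ℕ.≤-reflexive (cong toℕ (botΠ-rep i))
  ; rep-rep = λ i → cong (rep (botΠ n)) (botΠ-rep i)
  ; wt-min = λ {i} e → subst (_< size (botΠ n) i) (sym (botΠ-wt i)) (size-fix {y = botΠ n} e)
  ; wt-non = λ {i} ne → ⊥-elim (ne (botΠ-rep i)) }

st : ∀ {n} → Word n → RawΠ n
st []      = botΠ _
st (l ∷ v) = merge l (st v)

mutual
  -- Mutual with the next lemmas: a merge keeps the state valid only between block minima, and to
  -- know the minima of the state one needs its validity for the shorter word.
  st-valid : ∀ {n} (v : Word n) → Val v → ValidΠ (st v)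
  st-valid [] _ = botΠ-valid
  st-valid (l@(a , b , u) ∷ v) (A , V) = Merge.merge-valid a b u (st v) (st-valid v V) (app⇒appΠ l v V A)

  rep-st⁻ : ∀ {n} (v : Word n) → Val v → ∀ {c} → rep (st v) c ≡ c → c ∉ his v
  rep-st⁻ (l@(a , b , u) ∷ v) (A , V) e i with Merge.rep-fix⁻ a b u (st v) (st-valid v V) (app⇒appΠ l v V A) e
  rep-st⁻ (l ∷ v) (A , V) e (here refl) | ne , _ = ne refl
  rep-st⁻ (l ∷ v) (A , V) e (there i) | _ , e′ = rep-st⁻ v V e′ i

  rep-st⁺ : ∀ {n} (v : Word n) → Val v → ∀ {c} → c ∉ his v → rep (st v) c ≡ c
  rep-st⁺ [] _ _ = botΠ-rep _
  rep-st⁺ (l@(a , b , u) ∷ v) (A , V) c∉ =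
    Merge.rep-fix⁺ a b u (st v) (st-valid v V) (app⇒appΠ l v V A) (c∉ ∘ here) (rep-st⁺ v V (c∉ ∘ there))

  app⇒appΠ : ∀ {n} (l : Label n) v → Val v → app l v → appΠ l (st v)
  app⇒appΠ l v V (lt , a∉ , b∉) = lt , rep-st⁺ v V a∉ , rep-st⁺ v V b∉

appΠ⇒app : ∀ {n} (l : Label n) v → Val v → appΠ l (st v) → app l v
appΠ⇒app l v V (lt , ea , eb) = lt , rep-st⁻ v V ea , rep-st⁻ v V eb

-- On valid input, `n` minus the number of blocks.
rkΠ : ∀ {n} → RawΠ n → ℕ
rkΠ y = ΣF (λ i → 𝟙 (not (rep y i =F i)))

rkΠ≤n : ∀ {n} (y : RawΠ n) → rkΠ y ≤ n
rkΠ≤n y = ΣF-≤n (λ i → 𝟙≤1 _)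

rkΠ-merge : ∀ {n} {y : RawΠ n} l → ValidΠ y → appΠ l y → rkΠ (merge l y) ≡ suc (rkΠ y)
rkΠ-merge {y = y} l@(a , b , u) V A = trans (sym (ℕ.+-identityʳ _)) (trans
  (ΣF-balance b b 1 0 pointwise) (ℕ.+-comm (rkΠ y) 1))
  where
  open Merge a b u y V A
  z = merge l y
  pointwise : ∀ i → 𝟙 (not (rep z i =F i)) + δ b 0 i ≡ 𝟙 (not (rep y i =F i)) + δ b 1 i
  pointwise i with i ≟ b
  ... | yes refl = trans
    (cong₂ _+_ (if-yes (T-not⁺ (=F-no (λ e → a≢b (trans (sym rep-hi) e))))) (δ-≡ i))
    (sym (cong₂ _+_ (if-no (λ t → T-not⁻ t (=F-complete (proj₂ (proj₂ A))))) (δ-≡ i)))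
  ... | no nb = cong₂ _+_ (cong (𝟙 ∘ not) (T-ext
      (λ t → =F-complete (proj₂ (rep-fix⁻ (=F-sound t)))) (λ t → =F-complete (rep-fix⁺ nb (=F-sound t)))))
      (trans (δ-≢ nb) (sym (δ-≢ nb)))

rkΠ-bot : ∀ n → rkΠ (botΠ n) ≡ 0
rkΠ-bot n = ΣF-0 {n} λ i → if-no (λ t → T-not⁻ {rep (botΠ n) i =F i} t (=F-complete (botΠ-rep i)))

rkΠ-st : ∀ {n} (v : Word n) → Val v → rkΠ (st v) ≡ length v
rkΠ-st {n} [] _ = rkΠ-bot n
rkΠ-st (l ∷ v) (A , V) = trans (rkΠ-merge l (st-valid v V) (app⇒appΠ l v V A)) (cong suc (rkΠ-st v V))

-- The first entries may coincide. Then the weights of three blocks and both tints add up in one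
-- block, and `shuffle` shows that their order is irrelevant.
merge-comm : ∀ {n} {y : RawΠ n} (l l′ : Label n) → ValidΠ y → appΠ l y → appΠ l′ y →
  hi l ≢ hi l′ → lo l ≢ hi l′ → lo l′ ≢ hi l → merge l (merge l′ y) ≡ merge l′ (merge l y)
merge-comm {n} {y} l@(a , b , u) l′@(a′ , b′ , u′) V A A′ bb ab ba =
  cong₂ _,_ (lookup-ext reps) (lookup-ext λ i → Fin.toℕ-injective (weights i))
  where
  z  = merge l y
  z′ = merge l′ y
  module M  = Merge a b u y V A
  module M′ = Merge a′ b′ u′ y V A′
  B′ : appΠ l′ z
  B′ = proj₁ A′ , M.rep-fix⁺ ba (proj₁ (proj₂ A′)) , M.rep-fix⁺ (bb ∘ sym) (proj₂ (proj₂ A′))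
  B : appΠ l z′
  B = proj₁ A , M′.rep-fix⁺ ab (proj₁ (proj₂ A)) , M′.rep-fix⁺ bb (proj₂ (proj₂ A))
  module N  = Merge a b u z′ M′.merge-valid B
  module N′ = Merge a′ b′ u′ z M.merge-valid B′
  reps : ∀ i → rep (merge l z′) i ≡ rep (merge l′ z) i
  reps i with rep y i ≟ b | rep y i ≟ b′
  ... | yes e | yes e′ = ⊥-elim (bb (trans (sym e) e′))
  ... | yes e | no ne′ =
    trans (rep-merge-≡ a b u z′ (trans (rep-merge-≢ a′ b′ u′ y ne′) e))
      (sym (trans (rep-merge-≢ a′ b′ u′ z (λ q → ab (trans (sym (rep-merge-≡ a b u y e)) q)))
             (rep-merge-≡ a b u y e)))
  ... | no ne | yes e′ =
    trans (rep-merge-≢ a b u z′ (λ q → ba (trans (sym (rep-merge-≡ a′ b′ u′ y e′)) q)))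
      (trans (rep-merge-≡ a′ b′ u′ y e′)
        (sym (rep-merge-≡ a′ b′ u′ z (trans (rep-merge-≢ a b u y ne) e′))))
  ... | no ne | no ne′ =
    trans (rep-merge-≢ a b u z′ (λ q → ne (trans (sym (rep-merge-≢ a′ b′ u′ y ne′)) q)))
      (trans (rep-merge-≢ a′ b′ u′ y ne′)
        (sym (trans (rep-merge-≢ a′ b′ u′ z (λ q → ne′ (trans (sym (rep-merge-≢ a b u y ne)) q)))
               (rep-merge-≢ a b u y ne))))
  wt-b′z : wt z b′ ≡ wt y b′
  wt-b′z = wt-merge-≢ a b u y (ab ∘ sym) (bb ∘ sym)
  wt-bz′ : wt z′ b ≡ wt y b
  wt-bz′ = wt-merge-≢ a′ b′ u′ y (ba ∘ sym) bb
  shuffle : ∀ p q s q′ s′ → p + q′ + s′ + q + s ≡ p + q + s + q′ + s′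
  shuffle p q s q′ s′ = begin
    p + q′ + s′ + q + s ≡⟨ ℕ.+-assoc (p + q′ + s′) q s ⟩
    (p + q′ + s′) + (q + s) ≡⟨ cong (_+ (q + s)) (ℕ.+-assoc p q′ s′) ⟩
    p + (q′ + s′) + (q + s) ≡⟨ ℕ+.xy∙z≈xz∙y p (q′ + s′) (q + s) ⟩
    p + (q + s) + (q′ + s′) ≡⟨ cong (_+ (q′ + s′)) (ℕ.+-assoc p q s) ⟨
    p + q + s + (q′ + s′) ≡⟨ ℕ.+-assoc (p + q + s) q′ s′ ⟨
    p + q + s + q′ + s′ ∎
    where open ≡-Reasoning
  weights : ∀ i → wt (merge l z′) i ≡ wt (merge l′ z) i
  weights i with i ≟ b | i ≟ b′
  ... | yes refl | _ = trans (wt-merge-hi a b u z′ M.a≢b)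
    (sym (trans (wt-merge-≢ a′ b′ u′ z (ba ∘ sym) bb) (wt-merge-hi a b u y M.a≢b)))
  ... | no _ | yes refl = trans (wt-merge-≢ a b u z′ (ab ∘ sym) (bb ∘ sym))
    (trans (wt-merge-hi a′ b′ u′ y M′.a≢b) (sym (wt-merge-hi a′ b′ u′ z M′.a≢b)))
  ... | no nb | no nb′ with i ≟ a | i ≟ a′
  ... | yes refl | yes refl = begin
    wt (merge l z′) a ≡⟨ N.wt-lo ⟩
    wt z′ a + wt z′ b + toℕ u ≡⟨ cong₂ (λ s t → s + t + toℕ u) M′.wt-lo wt-bz′ ⟩
    wt y a + wt y b′ + toℕ u′ + wt y b + toℕ u ≡⟨ shuffle (wt y a) (wt y b) (toℕ u) (wt y b′) (toℕ u′) ⟩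
    wt y a + wt y b + toℕ u + wt y b′ + toℕ u′ ≡⟨ cong₂ (λ s t → s + t + toℕ u′) M.wt-lo wt-b′z ⟨
    wt z a + wt z b′ + toℕ u′ ≡⟨ N′.wt-lo ⟨
    wt (merge l′ z) a ∎
    where open ≡-Reasoning
  ... | yes refl | no na′ = trans N.wt-lo (trans
    (cong₂ (λ s t → s + t + toℕ u) (wt-merge-≢ a′ b′ u′ y na′ nb′) wt-bz′)
    (sym (trans (wt-merge-≢ a′ b′ u′ z na′ nb′) M.wt-lo)))
  ... | no na | yes refl = trans (wt-merge-≢ a b u z′ na nb) (trans M′.wt-lo
    (sym (trans N′.wt-lo (cong₂ (λ s t → s + t + toℕ u′) (wt-merge-≢ a b u y na nb) wt-b′z))))
  ... | no na | no na′ = trans (wt-merge-≢ a b u z′ na nb) (trans (wt-merge-≢ a′ b′ u′ y na′ nb′)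
    (sym (trans (wt-merge-≢ a′ b′ u′ z na′ nb′) (wt-merge-≢ a b u y na nb))))

-- Insertion exchanges `l` with smaller labels only, and such merges commute. So sorting the label
-- sequence does not change the partition reached.
st-insR : ∀ {n} (l : Label n) v → Val (l ∷ v) → st (insR l v) ≡ st (l ∷ v)
st-insR l [] V = refl
st-insR l (x ∷ v) V@(A , Ax , V′) with x ⊏? l
... | no ¬p = cong st (insR-≮ v ¬p)
... | yes p with Val-swap {l = l} {x} V p
... | Ax′ , Al , _ = begin
  st (insR l (x ∷ v)) ≡⟨ cong st (insR-< v p) ⟩
  merge x (st (insR l v)) ≡⟨ cong (merge x) (st-insR l v (Al , V′)) ⟩
  merge x (merge l (st v)) ≡⟨ merge-comm x l (st-valid v V′) (app⇒appΠ x v V′ Ax) (app⇒appΠ l v V′ Al)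
                                    (λ e → proj₂ (proj₂ Ax′) (here e)) (λ e → proj₁ (proj₂ Ax′) (here e))
                                    (λ e → proj₁ (proj₂ A) (here e)) ⟩
  merge l (merge x (st v)) ∎
  where open ≡-Reasoning

PiW-==-sound : ∀ {n} {x y : RawΠ n} → T (eqΠ x y) → x ≡ y
PiW-==-sound {x = r , w} {r′ , w′} t =
  cong₂ _,_ (vecEq-sound =F-sound (∧-fst t)) (vecEq-sound =F-sound (∧-snd {vecEq _=F_ r r′} t))

PiW-==-refl : ∀ {n} (x : RawΠ n) → T (eqΠ x x)
PiW-==-refl (r , w) = ∧-intro (vecEq-refl =F-refl r) (vecEq-refl =F-refl w)

-- Intervals of weighted partitions

-- For x ≥ y and a block of x with least element m, the weights of x ranging over [Lo x y m, Hi x y m)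
-- are those obtainable by merging all blocks of y contained in that block.
Lo Hi : ∀ {n} → RawΠ n → RawΠ n → Fin n → ℕ
Lo x y m = ΣF (λ i → if rep x i =F m then wt y i else 0)
Hi x y m = ΣF (λ i → if rep x i =F m then wt y i + 𝟙 (rep y i =F i) else 0)

-- The relation y ≤ x in arithmetic form; `Reach⇒Below` and `Below⇒Reach` compare it with chains of
-- covers.
record Below {n} (x y : RawΠ n) : Set where
  field
    refine : ∀ i → rep x (rep y i) ≡ rep x i
    low    : ∀ m → rep x m ≡ m → Lo x y m ≤ wt x m
    high   : ∀ m → rep x m ≡ m → wt x m < Hi x y m
open Below

-- A merge inside a block of `x` shortens the range of attainable weights by one: tint 0 gives up
-- the largest value, tint 1 the smallest. The ranges of the other blocks stay.
module Step {n} (x : RawΠ n) (a b : Fin n) (u : Fin 2) (y : RawΠ n) (V : ValidΠ y)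
  (A : appΠ (a , b , u) y) (e : rep x a ≡ rep x b) where
  private
    z = merge (a , b , u) y
    m = rep x a
  open Merge a b u y V A

  Lo-≡ : Lo x z m ≡ Lo x y m + toℕ u
  Lo-≡ = ℕ.+-cancelʳ-≡ (wt y b) _ _ (begin
    Lo x z m + wt y b ≡⟨ ΣF-balance a b (wt y b + toℕ u) (wt y b) pointwise ⟩
    Lo x y m + (wt y b + toℕ u) ≡⟨ cong (Lo x y m +_) (ℕ.+-comm (wt y b) (toℕ u)) ⟩
    Lo x y m + (toℕ u + wt y b) ≡⟨ ℕ.+-assoc (Lo x y m) (toℕ u) (wt y b) ⟨
    Lo x y m + toℕ u + wt y b ∎)
    where
    open ≡-Reasoning
    pointwise : ∀ i → (if rep x i =F m then wt z i else 0) + δ b (wt y b) i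
                    ≡ (if rep x i =F m then wt y i else 0) + δ a (wt y b + toℕ u) i
    pointwise i with i ≟ a
    ... | yes refl = trans (cong₂ _+_ (trans (if-yes (=F-refl m)) wt-lo) (δ-≢ a≢b))
      (trans (ℕ.+-identityʳ _) (trans (ℕ.+-assoc (wt y a) (wt y b) (toℕ u))
        (sym (cong₂ _+_ (if-yes (=F-refl m)) (δ-≡ a)))))
    ... | no na with i ≟ b
    ... | yes refl = trans (cong₂ _+_ (trans (if-yes (=F-complete (sym e))) (wt-merge-hi a b u y a≢b)) (δ-≡ b))
      (trans (sym (ℕ.+-identityʳ _)) (sym (cong₂ _+_ (if-yes (=F-complete (sym e))) (δ-≢ na))))
    ... | no nb = cong₂ _+_ (cong (if rep x i =F m then_else 0) (wt-merge-≢ a b u y na nb))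
      (trans (δ-≢ nb) (sym (δ-≢ na)))

  fix-≡ : ∀ i → i ≢ b → 𝟙 (rep z i =F i) ≡ 𝟙 (rep y i =F i)
  fix-≡ i nb = cong 𝟙 (T-ext (λ t → =F-complete (proj₂ (rep-fix⁻ (=F-sound t))))
                             (λ t → =F-complete (rep-fix⁺ nb (=F-sound t))))

  Hi-≡ : Hi x z m + 1 ≡ Hi x y m + toℕ u
  Hi-≡ = ℕ.+-cancelʳ-≡ (wt y b) _ _ (begin
    Hi x z m + 1 + wt y b ≡⟨ ℕ.+-assoc (Hi x z m) 1 (wt y b) ⟩
    Hi x z m + (1 + wt y b) ≡⟨ ΣF-balance a b (wt y b + toℕ u) (1 + wt y b) pointwise ⟩
    Hi x y m + (wt y b + toℕ u) ≡⟨ cong (Hi x y m +_) (ℕ.+-comm (wt y b) (toℕ u)) ⟩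
    Hi x y m + (toℕ u + wt y b) ≡⟨ ℕ.+-assoc (Hi x y m) (toℕ u) (wt y b) ⟨
    Hi x y m + toℕ u + wt y b ∎)
    where
    open ≡-Reasoning
    F G : Fin n → ℕ
    F i = wt z i + 𝟙 (rep z i =F i)
    G i = wt y i + 𝟙 (rep y i =F i)
    at-a : F a ≡ G a + (wt y b + toℕ u)
    at-a = begin
      F a ≡⟨ cong₂ _+_ wt-lo (if-yes (=F-complete rep-lo)) ⟩
      wt y a + wt y b + toℕ u + 1 ≡⟨ cong (_+ 1) (ℕ.+-assoc (wt y a) (wt y b) (toℕ u)) ⟩
      wt y a + (wt y b + toℕ u) + 1 ≡⟨ ℕ.+-assoc (wt y a) _ 1 ⟩
      wt y a + ((wt y b + toℕ u) + 1) ≡⟨ cong (wt y a +_) (ℕ.+-comm _ 1) ⟩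
      wt y a + (1 + (wt y b + toℕ u)) ≡⟨ ℕ.+-assoc (wt y a) 1 _ ⟨
      wt y a + 1 + (wt y b + toℕ u) ≡⟨ cong (λ t → wt y a + t + (wt y b + toℕ u))
                                                      (if-yes (=F-complete (proj₁ (proj₂ A)))) ⟨
      G a + (wt y b + toℕ u) ∎
    at-b : F b + (1 + wt y b) ≡ G b
    at-b = begin
      F b + (1 + wt y b) ≡⟨ cong (_+ (1 + wt y b)) (cong₂ _+_ (wt-merge-hi a b u y a≢b)
                                     (if-no (=F-no (λ q → a≢b (trans (sym rep-hi) q))))) ⟩
      1 + wt y b ≡⟨ ℕ.+-comm 1 (wt y b) ⟩
      wt y b + 1 ≡⟨ cong (wt y b +_) (if-yes (=F-complete (proj₂ (proj₂ A)))) ⟨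
      G b ∎
    pointwise : ∀ i → (if rep x i =F m then F i else 0) + δ b (1 + wt y b) i
                    ≡ (if rep x i =F m then G i else 0) + δ a (wt y b + toℕ u) i
    pointwise i with i ≟ a
    ... | yes refl = trans (cong₂ _+_ (if-yes (=F-refl m)) (δ-≢ a≢b))
      (trans (ℕ.+-identityʳ _) (trans at-a (sym (cong₂ _+_ (if-yes (=F-refl m)) (δ-≡ a)))))
    ... | no na with i ≟ b
    ... | yes refl = trans (cong₂ _+_ (if-yes (=F-complete (sym e))) (δ-≡ b))
      (trans at-b (trans (sym (ℕ.+-identityʳ _)) (sym (cong₂ _+_ (if-yes (=F-complete (sym e))) (δ-≢ na)))))
    ... | no nb = cong₂ _+_ (cong (if rep x i =F m then_else 0)
                               (cong₂ _+_ (wt-merge-≢ a b u y na nb) (fix-≡ i nb)))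
      (trans (δ-≢ nb) (sym (δ-≢ na)))

  module _ {k} (ne : k ≢ m) where
    private
      off : ∀ {i} → rep x i ≡ k → i ≢ a × i ≢ b
      off q = (λ { refl → ne (sym q) }) , (λ { refl → ne (trans (sym q) (sym e)) })

    Lo-≢ : Lo x z k ≡ Lo x y k
    Lo-≢ = ΣF-cong pointwise
      where
      pointwise : ∀ i → (if rep x i =F k then wt z i else 0) ≡ (if rep x i =F k then wt y i else 0)
      pointwise i with rep x i ≟ k
      ... | yes q = cong (if rep x i =F k then_else 0) (wt-merge-≢ a b u y (proj₁ (off q)) (proj₂ (off q)))
      ... | no q = trans (if-no (=F-no q)) (sym (if-no (=F-no q)))

    Hi-≢ : Hi x z k ≡ Hi x y k
    Hi-≢ = ΣF-cong pointwise
      where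
      pointwise : ∀ i → (if rep x i =F k then wt z i + 𝟙 (rep z i =F i) else 0)
                      ≡ (if rep x i =F k then wt y i + 𝟙 (rep y i =F i) else 0)
      pointwise i with rep x i ≟ k
      ... | yes q = cong (if rep x i =F k then_else 0)
        (cong₂ _+_ (wt-merge-≢ a b u y (proj₁ (off q)) (proj₂ (off q))) (fix-≡ i (proj₂ (off q))))
      ... | no q = trans (if-no (=F-no q)) (sym (if-no (=F-no q)))

  Lo-mono : ∀ k → Lo x y k ≤ Lo x z k
  Lo-mono k with k ≟ m
  ... | yes refl = ℕ.≤-trans (ℕ.m≤m+n _ _) (ℕ.≤-reflexive (sym Lo-≡))
  ... | no ne = ℕ.≤-reflexive (sym (Lo-≢ ne))

  Hi-mono : ∀ k → Hi x z k ≤ Hi x y k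
  Hi-mono k with k ≟ m
  ... | yes refl = ℕ.+-cancelʳ-≤ 1 _ _ (ℕ.≤-trans (ℕ.≤-reflexive Hi-≡)
                     (ℕ.+-monoʳ-≤ (Hi x y m) (ℕ.≤-pred (Fin.toℕ<n u))))
  ... | no ne = ℕ.≤-reflexive (Hi-≢ ne)

merge-same : ∀ {n} {x y : RawΠ n} a b u → ValidΠ y → appΠ (a , b , u) y →
  Below x (merge (a , b , u) y) → rep x a ≡ rep x b
merge-same {x = x} {y} a b u V A B =
  trans (cong (rep x) (sym (Merge.rep-hi a b u y V A))) (refine B b)

Below-down : ∀ {n} {x y : RawΠ n} l → ValidΠ y → appΠ l y → Below x (merge l y) → Below x y
Below-down {x = x} {y} l@(a , b , u) V A B = record
  { refine = rf
  ; low = λ m q → ℕ.≤-trans (S.Lo-mono m) (low B m q)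
  ; high = λ m q → ℕ.<-≤-trans (high B m q) (S.Hi-mono m) }
  where
  e = merge-same {x = x} a b u V A B
  module S = Step x a b u y V A e
  rf : ∀ i → rep x (rep y i) ≡ rep x i
  rf i with rep y i ≟ b
  ... | yes q = trans (cong (rep x) q) (trans (sym e)
                  (trans (cong (rep x) (sym (rep-merge-≡ a b u y q))) (refine B i)))
  ... | no q = trans (cong (rep x) (sym (rep-merge-≢ a b u y q))) (refine B i)

-- With `m` the only minimum of `y` in its block, nothing is left to merge there and exactly one
-- weight is attainable.
Hi-sucLo : ∀ {n} (x y : RawΠ n) {m} → rep x m ≡ m → rep y m ≡ m →
  (∀ c → rep y c ≡ c → rep x c ≡ m → c ≡ m) → Hi x y m ≡ suc (Lo x y m)
Hi-sucLo x y {m} xm ym h = trans (sym (ℕ.+-identityʳ _))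
  (trans (ΣF-balance m m 1 0 pointwise) (ℕ.+-comm (Lo x y m) 1))
  where
  pointwise : ∀ i → (if rep x i =F m then wt y i + 𝟙 (rep y i =F i) else 0) + δ m 0 i
                  ≡ (if rep x i =F m then wt y i else 0) + δ m 1 i
  pointwise i with i ≟ m
  ... | yes refl = trans (cong₂ _+_ (if-yes (=F-complete xm)) (δ-≡ i)) (trans (ℕ.+-identityʳ _)
    (trans (cong (wt y i +_) (if-yes (=F-complete ym)))
      (sym (cong₂ _+_ (if-yes (=F-complete xm)) (δ-≡ i)))))
  ... | no ne with rep x i ≟ m
  ... | no q = cong₂ _+_ (trans (if-no (=F-no q)) (sym (if-no (=F-no q)))) (trans (δ-≢ ne) (sym (δ-≢ ne)))
  ... | yes q = cong₂ _+_ (cong (if rep x i =F m then_else 0)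
      (trans (cong (wt y i +_) (if-no (=F-no (λ r → ne (h i r q))))) (ℕ.+-identityʳ _)))
      (trans (δ-≢ ne) (sym (δ-≢ ne)))

Lo-sole : ∀ {n} (x y : RawΠ n) {m} → rep x m ≡ m → ValidΠ y →
  (∀ c → rep y c ≡ c → rep x c ≡ m → c ≡ m) → Lo x y m ≡ wt y m
Lo-sole x y {m} xm V h = trans (ΣF-cong pointwise) (ΣF-δ m (wt y m))
  where
  pointwise : ∀ i → (if rep x i =F m then wt y i else 0) ≡ δ m (wt y m) i
  pointwise i with i ≟ m
  ... | yes refl = trans (if-yes (=F-complete xm)) (sym (δ-≡ i))
  ... | no ne with rep x i ≟ m
  ... | no q = trans (if-no (=F-no q)) (sym (δ-≢ ne))
  ... | yes q = trans (if-yes (=F-complete q)) (trans (wt-non V (λ r → ne (h i r q))) (sym (δ-≢ ne)))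

Below-refl : ∀ {n} {x : RawΠ n} → ValidΠ x → Below x x
Below-refl {x = x} V = record
  { refine = rep-rep V
  ; low = λ m q → ℕ.≤-reflexive (Lo-sole x x q V (sole q))
  ; high = λ m q → ℕ.≤-reflexive (trans (cong suc (sym (Lo-sole x x q V (sole q))))
                                        (sym (Hi-sucLo x x q q (sole q)))) }
  where
  sole : ∀ {m} → rep x m ≡ m → ∀ c → rep x c ≡ c → rep x c ≡ m → c ≡ m
  sole _ c q r = trans (sym q) r

Below-⊥ : ∀ {n} {x : RawΠ n} → ValidΠ x → Below x (botΠ n)
Below-⊥ {n} {x} V = record
  { refine = λ i → cong (rep x) (botΠ-rep i)
  ; low = λ m q → ℕ.≤-trans (ℕ.≤-reflexive (ΣF-0 {f = λ i → if rep x i =F m then wt (botΠ n) i else 0} (zero-lo m))) z≤n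
  ; high = λ m q → ℕ.<-≤-trans (wt-min V q) (ℕ.≤-reflexive (ΣF-cong (one-hi m))) }
  where
  if-same : ∀ b {k : ℕ} → k ≡ 0 → (if b then k else 0) ≡ 0
  if-same true  e = e
  if-same false e = refl
  zero-lo : ∀ m i → (if rep x i =F m then wt (botΠ n) i else 0) ≡ 0
  zero-lo m i = if-same (rep x i =F m) (botΠ-wt i)
  one-hi : ∀ m i → 𝟙 (rep x i =F m)
                 ≡ (if rep x i =F m then wt (botΠ n) i + 𝟙 (rep (botΠ n) i =F i) else 0)
  one-hi m i = cong (if rep x i =F m then_else 0)
    (sym (cong₂ _+_ (botΠ-wt i) (if-yes (=F-complete (botΠ-rep i)))))

-- Here `w` is the target weight and `h` the strict upper bound for attainable weights. Tint 0
-- lowers the bound by one, so it is allowed while `suc w < h`; once `w` is the largest attainable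
-- weight, tint 1 is forced. Zeros thus precede ones, as the order of Γ_a demands.
tintOK : Fin 2 → ℕ → ℕ → Set
tintOK fz     w h = suc w < h
tintOK (fs _) w h = suc w ≡ h

tintOK? : ∀ u w h → Dec (tintOK u w h)
tintOK? fz     w h = suc w <? h
tintOK? (fs _) w h = suc w ℕ.≟ h

tintOK-unique : ∀ u v {w h} → tintOK u w h → tintOK v w h → u ≡ v
tintOK-unique fz fz _ _ = refl
tintOK-unique (fs fz) (fs fz) _ _ = refl
tintOK-unique fz (fs _) p q = ⊥-elim (ℕ.<-irrefl q p)
tintOK-unique (fs _) fz p q = ⊥-elim (ℕ.<-irrefl p q)

-- The label that an increasing chain from y to x has to start with.
record Next {n} (x y : RawΠ n) (l : Label n) : Set where
  field
    lo-eq   : rep x (hi l) ≡ lo l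
    hi-fix  : rep y (hi l) ≡ hi l
    lo≢hi   : lo l ≢ hi l
    least   : ∀ c → rep y c ≡ c → rep x c ≢ c →
                toℕ (lo l) < toℕ (rep x c) ⊎ (lo l ≡ rep x c × toℕ (hi l) ≤ toℕ c)
    tint-eq : tintOK (tint l) (wt x (lo l)) (Hi x y (lo l))
open Next

Next? : ∀ {n} (x y : RawΠ n) l → Dec (Next x y l)
Next? x y l = map′
  (λ { (p , q , r , s , t) → record { lo-eq = p ; hi-fix = q ; lo≢hi = r ; least = s ; tint-eq = t } })
  (λ N → lo-eq N , hi-fix N , lo≢hi N , least N , tint-eq N)
  ((rep x (hi l) ≟ lo l) ×-dec (rep y (hi l) ≟ hi l) ×-dec ¬? (lo l ≟ hi l)
   ×-dec Fin.all? (λ c → (rep y c ≟ c) →-dec (¬? (rep x c ≟ c) →-dec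
           ((toℕ (lo l) <? toℕ (rep x c)) ⊎-dec ((lo l ≟ rep x c) ×-dec (toℕ (hi l) ≤? toℕ c)))))
   ×-dec tintOK? (tint l) _ _)

hi-moves : ∀ {n} {x y : RawΠ n} {l} → Next x y l → rep x (hi l) ≢ hi l
hi-moves N e = lo≢hi N (trans (sym (lo-eq N)) e)

Next-unique : ∀ {n} {x y : RawΠ n} {l l′} → Next x y l → Next x y l′ → l ≡ l′
Next-unique {x = x} {y} {l} {l′} N N′
  with least N (hi l′) (hi-fix N′) (hi-moves N′) | least N′ (hi l) (hi-fix N) (hi-moves N)
... | inj₁ p | inj₁ q = ⊥-elim (ℕ.<-asym (subst (λ t → toℕ (lo l) < toℕ t) (lo-eq N′) p)
                                         (subst (λ t → toℕ (lo l′) < toℕ t) (lo-eq N) q))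
... | inj₁ p | inj₂ (q , _) = ⊥-elim (ℕ.<-irrefl (cong toℕ (sym (trans q (lo-eq N)))) (subst (λ t → toℕ (lo l) < toℕ t) (lo-eq N′) p))
... | inj₂ (p , _) | inj₁ q = ⊥-elim (ℕ.<-irrefl (cong toℕ (sym (trans p (lo-eq N′)))) (subst (λ t → toℕ (lo l′) < toℕ t) (lo-eq N) q))
... | inj₂ (p , b≤) | inj₂ (_ , b≥) =
  cong₂ _,_ e (cong₂ _,_ (Fin.toℕ-injective (ℕ.≤-antisym b≤ b≥))
    (tintOK-unique (tint l) (tint l′) (tint-eq N)
      (subst (λ t → tintOK (tint l′) (wt x t) (Hi x y t)) (sym e) (tint-eq N′))))
  where
  e : lo l ≡ lo l′
  e = trans p (lo-eq N′)

least-Fin : ∀ {n} {P : Fin n → Set} → (∀ i → Dec (P i)) → ∃ P → ∃ λ i → P i × (∀ j → P j → toℕ i ≤ toℕ j)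
least-Fin {suc n} P? w with P? fz
... | yes p = fz , p , λ _ _ → z≤n
least-Fin {suc n} P? (fz , q) | no ¬p = ⊥-elim (¬p q)
least-Fin {suc n} P? (fs i , q) | no ¬p with least-Fin (P? ∘ fs) (i , q)
... | j , r , h = fs j , r , λ { fz s → ⊥-elim (¬p s) ; (fs k) s → s≤s (h k s) }

module _ {n} {x y : RawΠ n} (Vx : ValidΠ x) (Vy : ValidΠ y) (B : Below x y) where

  min-fix : ∀ {m} → rep x m ≡ m → rep y m ≡ m
  min-fix {m} e = Fin.toℕ-injective (ℕ.≤-antisym (rep≤ Vy m)
    (subst (λ t → toℕ t ≤ toℕ (rep y m)) (trans (refine B m) e) (rep≤ Vx (rep y m))))

  -- If no minimum of `y` is left to absorb, the blocks agree and each range of attainable weights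
  -- consists of the weight in `y` alone.
  Below-≡ : (∀ c → rep y c ≡ c → rep x c ≡ c) → y ≡ x
  Below-≡ h = cong₂ _,_ (lookup-ext reps) (lookup-ext λ i → Fin.toℕ-injective (weights i))
    where
    reps : ∀ i → rep y i ≡ rep x i
    reps i = trans (sym (h (rep y i) (rep-rep Vy i))) (refine B i)
    sole : ∀ {m} c → rep y c ≡ c → rep x c ≡ m → c ≡ m
    sole c q r = trans (sym (h c q)) r
    weights : ∀ i → wt y i ≡ wt x i
    weights i with rep x i ≟ i
    ... | no ne = trans (wt-non Vy (λ e → ne (h i e))) (sym (wt-non Vx ne))
    ... | yes e = ℕ.≤-antisym
      (ℕ.≤-trans (ℕ.≤-reflexive (sym (Lo-sole x y e Vy sole))) (low B i e))
      (ℕ.≤-pred (ℕ.<-≤-trans (high B i e) (ℕ.≤-reflexive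
        (trans (Hi-sucLo x y e (min-fix e) sole) (cong suc (Lo-sole x y e Vy sole))))))

  -- Take for `a` the least block of `x` that is still split in `y`, for `b` the smallest minimum of
  -- `y` other than `a` inside it, and tint 1 only if the weight of `x` is the largest attainable.
  Next-exists : y ≢ x → ∃ λ l → Next x y l
  Next-exists ne with Fin.any? (λ c → (rep y c ≟ c) ×-dec ¬? (rep x c ≟ c))
  ... | no h = ⊥-elim (ne (Below-≡ λ c e → decide c e))
    where
    decide : ∀ c → rep y c ≡ c → rep x c ≡ c
    decide c e with rep x c ≟ c
    ... | yes q = q
    ... | no ¬q = ⊥-elim (h (c , e , ¬q))
  ... | yes (c , e , ¬e)
    with least-Fin (λ m → Fin.any? (λ c → (rep y c ≟ c) ×-dec ¬? (rep x c ≟ c) ×-dec (rep x c ≟ m)))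
                   (rep x c , c , e , ¬e , refl)
  ... | a , w , a-least
    with least-Fin (λ c → (rep y c ≟ c) ×-dec ¬? (rep x c ≟ c) ×-dec (rep x c ≟ a)) w
  ... | b , (yb , ¬xb , xb) , b-least =
    (a , b , tnt) , record { lo-eq = xb ; hi-fix = yb ; lo≢hi = λ q → ¬xb (trans xb q)
                           ; least = lst ; tint-eq = proj₂ tnt′ }
    where
    xa : rep x a ≡ a
    xa = subst (λ t → rep x t ≡ t) xb (rep-rep Vx b)
    tnt′ : ∃ λ u → tintOK u (wt x a) (Hi x y a)
    tnt′ with suc (wt x a) ℕ.≟ Hi x y a
    ... | yes q = fs fz , q
    ... | no ¬q = fz , ℕ.≤∧≢⇒< (high B a xa) ¬q
    tnt = proj₁ tnt′
    lst : ∀ c → rep y c ≡ c → rep x c ≢ c → toℕ a < toℕ (rep x c) ⊎ (a ≡ rep x c × toℕ b ≤ toℕ c)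
    lst c yc xc with rep x c ≟ a
    ... | yes q = inj₂ (sym q , b-least c (yc , xc , q))
    ... | no ¬q = inj₁ (ℕ.≤∧≢⇒< (a-least (rep x c) (c , yc , xc , refl)) (¬q ∘ sym ∘ Fin.toℕ-injective))

  module _ {l : Label n} (N : Next x y l) where
    private
      a = lo l
      b = hi l
      u = tint l
      xa : rep x a ≡ a
      xa = subst (λ t → rep x t ≡ t) (lo-eq N) (rep-rep Vx b)

    Next⇒appΠ : appΠ l y
    Next⇒appΠ = ℕ.≤∧≢⇒< (subst (λ t → toℕ t ≤ toℕ b) (lo-eq N) (rep≤ Vx b)) (lo≢hi N ∘ Fin.toℕ-injective)
      , min-fix xa , hi-fix N

    private module S = Step x a b u y Vy Next⇒appΠ (trans xa (sym (lo-eq N)))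

    -- Both `a` and `b` are minima of `y` in this block, so at least two weights are attainable.
    -- This is what lets a merge of tint 1 raise `Lo` without overshooting the target.
    Lo+2≤Hi : Lo x y a + 1 + 1 ≤ Hi x y a
    Lo+2≤Hi = subst (_≤ Hi x y a) total (ΣF-mono pointwise)
      where
      L : Fin n → ℕ
      L i = if rep x i =F a then wt y i else 0
      total : ΣF (λ i → L i + δ a 1 i + δ b 1 i) ≡ Lo x y a + 1 + 1
      total = trans (ΣF-+ (λ i → L i + δ a 1 i) (δ b 1))
        (cong₂ _+_ (trans (ΣF-+ L (δ a 1)) (cong (Lo x y a +_) (ΣF-δ a 1))) (ΣF-δ b 1))
      pointwise : ∀ i → L i + δ a 1 i + δ b 1 i ≤ (if rep x i =F a then wt y i + 𝟙 (rep y i =F i) else 0)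
      pointwise i with i ≟ a
      ... | yes refl = ℕ.≤-reflexive (trans
          (cong₂ _+_ (cong₂ _+_ (if-yes (=F-complete xa)) (δ-≡ i)) (δ-≢ (lo≢hi N)))
          (trans (ℕ.+-identityʳ _) (sym (trans (if-yes (=F-complete xa))
            (cong (wt y i +_) (if-yes (=F-complete (min-fix xa))))))))
      ... | no na with i ≟ b
      ... | yes refl = ℕ.≤-reflexive (trans
          (cong₂ _+_ (cong₂ _+_ (if-yes (=F-complete (lo-eq N))) (δ-≢ na)) (δ-≡ i))
          (trans (cong (_+ 1) (ℕ.+-identityʳ _)) (sym (trans (if-yes (=F-complete (lo-eq N)))
            (cong (wt y i +_) (if-yes (=F-complete (hi-fix N))))))))
      ... | no nb = ℕ.≤-trans (ℕ.≤-reflexive (trans (cong₂ _+_ (cong (L i +_) (δ-≢ na)) (δ-≢ nb))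
          (trans (ℕ.+-identityʳ _) (ℕ.+-identityʳ _)))) (weaken (rep x i =F a))
        where
        weaken : ∀ c → (if c then wt y i else 0) ≤ (if c then wt y i + 𝟙 (rep y i =F i) else 0)
        weaken true  = ℕ.m≤m+n _ _
        weaken false = z≤n

    Next⇒Below : Below x (merge l y)
    Next⇒Below = record { refine = rf ; low = lw ; high = hg }
      where
      z = merge l y
      rf : ∀ i → rep x (rep z i) ≡ rep x i
      rf i with rep y i ≟ b
      ... | yes q = trans (cong (rep x) (rep-merge-≡ a b u y q)) (trans xa
                      (trans (sym (lo-eq N)) (trans (cong (rep x) (sym q)) (refine B i))))
      ... | no q = trans (cong (rep x) (rep-merge-≢ a b u y q)) (refine B i)
      Lo-a : Lo x z a ≡ Lo x y a + toℕ u
      Lo-a = subst (λ t → Lo x z t ≡ Lo x y t + toℕ u) xa S.Lo-≡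
      Hi-a : Hi x z a + 1 ≡ Hi x y a + toℕ u
      Hi-a = subst (λ t → Hi x z t + 1 ≡ Hi x y t + toℕ u) xa S.Hi-≡
      lw-a : ∀ v → tintOK v (wt x a) (Hi x y a) → Lo x y a + toℕ v ≤ wt x a
      lw-a fz _ = ℕ.≤-trans (ℕ.≤-reflexive (ℕ.+-identityʳ _)) (low B a xa)
      lw-a (fs fz) q = ℕ.+-cancelʳ-≤ 1 _ _ (ℕ.≤-trans Lo+2≤Hi (ℕ.≤-reflexive (trans (sym q) (ℕ.+-comm 1 _))))
      hg-a : ∀ v h → tintOK v (wt x a) (Hi x y a) → h + 1 ≡ Hi x y a + toℕ v → wt x a < h
      hg-a fz h q r = ℕ.+-cancelʳ-≤ 1 _ _ (ℕ.≤-trans (ℕ.≤-reflexive (ℕ.+-comm (suc (wt x a)) 1))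
        (ℕ.≤-trans q (ℕ.≤-reflexive (sym (trans r (ℕ.+-identityʳ _))))))
      hg-a (fs fz) h q r = ℕ.≤-reflexive (trans q (sym (ℕ.+-cancelʳ-≡ 1 _ _ r)))
      lw : ∀ m → rep x m ≡ m → Lo x z m ≤ wt x m
      lw m e with m ≟ a
      ... | yes refl = ℕ.≤-trans (ℕ.≤-reflexive Lo-a) (lw-a u (tint-eq N))
      ... | no ne = ℕ.≤-trans (ℕ.≤-reflexive (S.Lo-≢ (λ q → ne (trans q xa)))) (low B m e)
      hg : ∀ m → rep x m ≡ m → wt x m < Hi x z m
      hg m e with m ≟ a
      ... | yes refl = hg-a u (Hi x z a) (tint-eq N) Hi-a
      ... | no ne = ℕ.<-≤-trans (high B m e) (ℕ.≤-reflexive (sym (S.Hi-≢ (λ q → ne (trans q xa)))))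

    -- The entries increase by the minimality in `least`. The tint never returns from 1 to 0 in a
    -- block: a merge of tint 1 keeps `Hi`, so the target remains the largest attainable weight.
    Next-⊏ : ∀ {t} → Next x (merge l y) t → l ⊏ t
    Next-⊏ {t} N′ with Merge.rep-fix⁻ a b u y Vy Next⇒appΠ (hi-fix N′)
    ... | ne , yf with least N (hi t) yf (hi-moves N′)
    ... | inj₁ p = ⊏-lo (subst (λ s → toℕ a < toℕ s) (lo-eq N′) p)
    ... | inj₂ (p , b≤) = ⊏-hi e b≤ (tnt u (tint t) (tint-eq N)
            (subst (λ s → tintOK (tint t) (wt x s) (Hi x (merge l y) s)) (sym e) (tint-eq N′))
            (subst (λ t → Hi x (merge l y) t + 1 ≡ Hi x y t + toℕ u) xa S.Hi-≡))
            (λ { refl → ne refl })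
      where
      e : a ≡ lo t
      e = trans p (lo-eq N′)
      tnt : ∀ u v {w h h′} → tintOK u w h → tintOK v w h′ → h′ + 1 ≡ h + toℕ u → toℕ u ≤ toℕ v
      tnt fz v _ _ _ = z≤n
      tnt (fs fz) (fs fz) _ _ _ = ℕ.≤-refl
      tnt (fs fz) fz q r s = ⊥-elim (ℕ.<-irrefl (trans q (sym (ℕ.+-cancelʳ-≡ 1 _ _ s))) r)

-- A label smaller than the one forced after it is itself forced: this makes increasing chains unique.
Next-pred : ∀ {n} {x y : RawΠ n} l → ValidΠ x → ValidΠ y → appΠ l y → Below x (merge l y) →
  (∀ {t} → Next x (merge l y) t → l ⊏ t) → Next x y l
Next-pred {n} {x} {y} l@(a , b , u) Vx Vy A B h = record
  { lo-eq = trans (sym ab) xa ; hi-fix = proj₂ (proj₂ A) ; lo≢hi = a≢b ; least = lst ; tint-eq = tnt u refl }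
  where
  open Merge a b u y Vy A
  z = merge l y
  ab : rep x a ≡ rep x b
  ab = merge-same {x = x} a b u Vy A B
  after : ∀ {c} → rep z c ≡ c → rep x c ≢ c → ∃ λ t → Next x z t
  after zc xc = Next-exists Vx merge-valid B λ e → xc (subst (λ w → rep w _ ≡ _) e zc)
  -- Otherwise `a` itself still has to be absorbed, and the next forced label has first entry at
  -- most `rep x a`, which is smaller than `a`. It could not lie above `l`.
  xa : rep x a ≡ a
  xa with rep x a ≟ a
  ... | yes q = q
  ... | no ¬q with after rep-lo ¬q
  ... | t , N with least N a rep-lo ¬q
  ... | inj₁ p = ⊥-elim (ℕ.<⇒≱ p (ℕ.≤-trans (rep≤ Vx a) (⊏⇒lo≤ (h N))))
  ... | inj₂ (p , _) = ⊥-elim (¬q (Fin.toℕ-injective (ℕ.≤-antisym (rep≤ Vx a)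
                         (ℕ.≤-trans (⊏⇒lo≤ (h N)) (ℕ.≤-reflexive (cong toℕ p))))))
  lst : ∀ c → rep y c ≡ c → rep x c ≢ c → toℕ a < toℕ (rep x c) ⊎ (a ≡ rep x c × toℕ b ≤ toℕ c)
  lst c yc xc with c ≟ b
  ... | yes refl = inj₂ (trans (sym xa) ab , ℕ.≤-refl)
  ... | no nb with after (rep-fix⁺ nb yc) xc
  ... | t , N with ⊏⁻ (h N) | least N c (rep-fix⁺ nb yc) xc
  ... | inj₁ p | inj₁ q = inj₁ (ℕ.<-trans p q)
  ... | inj₁ p | inj₂ (q , _) = inj₁ (subst (λ s → toℕ a < toℕ s) q p)
  ... | inj₂ (refl , _) | inj₁ q = inj₁ q
  ... | inj₂ (refl , b≤ , _) | inj₂ (q , c≥) = inj₂ (q , ℕ.≤-trans b≤ c≥)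
  module S = Step x a b u y Vy A ab
  Hi-a : Hi x z a + 1 ≡ Hi x y a + toℕ u
  Hi-a = subst (λ t → Hi x z t + 1 ≡ Hi x y t + toℕ u) xa S.Hi-≡
  -- For tint 0 the bound after the merge is one less and still exceeds the target. For tint 1 the
  -- bound is unchanged: either the block is now complete and has one attainable weight, or the next
  -- forced label lies in the same block with tint at least 1, which says that the target is already
  -- the largest.
  tnt : ∀ v → u ≡ v → tintOK v (wt x a) (Hi x y a)
  tnt fz refl = ℕ.≤-trans (s≤s (high B a xa))
    (ℕ.≤-reflexive (trans (ℕ.+-comm 1 _) (trans Hi-a (ℕ.+-identityʳ _))))
  tnt (fs fz) refl with Fin.any? (λ c → (rep z c ≟ c) ×-dec ¬? (rep x c ≟ c) ×-dec (rep x c ≟ a))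
  ... | no none = trans (ℕ.≤-antisym (high B a xa) (ℕ.≤-trans
      (ℕ.≤-reflexive (Hi-sucLo x z xa rep-lo sole)) (s≤s (low B a xa)))) (ℕ.+-cancelʳ-≡ 1 _ _ Hi-a)
    where
    sole : ∀ c → rep z c ≡ c → rep x c ≡ a → c ≡ a
    sole c zc xc with rep x c ≟ c
    ... | yes q = trans (sym q) xc
    ... | no ¬q = ⊥-elim (none (c , zc , ¬q , xc))
  ... | yes (c , zc , ¬xc , xc) with after zc ¬xc
  ... | t , N with ⊏⁻ (h N) | least N c zc ¬xc
  ... | inj₁ p | inj₁ q = ⊥-elim (ℕ.<-irrefl (cong toℕ (sym xc)) (ℕ.<-trans p q))
  ... | inj₁ p | inj₂ (q , _) = ⊥-elim (ℕ.<-irrefl (cong toℕ (sym (trans q xc))) p)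
  ... | inj₂ (e , _) | inj₁ q = ⊥-elim (ℕ.<-irrefl (cong toℕ (trans (sym e) (sym xc))) q)
  ... | inj₂ (e , _ , u≤ , _) | inj₂ _ = trans (force (tint t) u≤ (tint-eq N)) (ℕ.+-cancelʳ-≡ 1 _ _ Hi-a)
    where
    force : ∀ v → 1 ≤ toℕ v → tintOK v (wt x (lo t)) (Hi x z (lo t)) → suc (wt x a) ≡ Hi x z a
    force (fs fz) _ q = subst (λ s → suc (wt x s) ≡ Hi x z s) (sym e) q

-- Increasing chains of weighted partitions

Reach-snoc : ∀ {P} k {x y z} → Reach P k x y → T (FinPoset.valid P z) → T (FinPoset._⋖_ P y z) →
  Reach P (suc k) x z
Reach-snoc zero refl v c = _ , v , c , refl
Reach-snoc (suc k) (w , vw , cw , r) v c = w , vw , cw , Reach-snoc k r v c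

coverΠ⁺ : ∀ {n} {y : RawΠ n} l → ValidΠ y → appΠ l y → T (coverΠ y (merge l y))
coverΠ⁺ {y = y} l V A = any⁺ (coverLΠ y (merge l y)) (∈-allLabels l) (coverLΠ⁺ l V A)

coverΠ⁻ : ∀ {n} {y z : RawΠ n} → ValidΠ y → T (coverΠ y z) → ∃ λ l → appΠ l y × z ≡ merge l y
coverΠ⁻ {n} {y} {z} V t with any⁻ (coverLΠ y z) (allLabels n) t
... | l , _ , c = l , coverLΠ⁻ l V c

merge-validΠ : ∀ {n} {y : RawΠ n} l → ValidΠ y → appΠ l y → ValidΠ (merge l y)
merge-validΠ {y = y} (a , b , u) V A = Merge.merge-valid a b u y V A

Reach-st : ∀ {n} (v : Word n) → Val v → Reach (PiW n) (length v) (botΠ n) (st v)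
Reach-st [] _ = refl
Reach-st (l ∷ v) (A , V) = Reach-snoc {PiW _} (length v) (Reach-st v V)
  (validΠ⁺ (merge-validΠ l (st-valid v V) (app⇒appΠ l v V A)))
  (coverΠ⁺ l (st-valid v V) (app⇒appΠ l v V A))

Inc : ∀ {n} → Word n → Set
Inc v = Linked (flip _⊏_) v × Val v

module _ {n} {x : RawΠ n} (Vx : ValidΠ x) where

  -- Forced labels are appended until `x` is reached; `Next-⊏` keeps the chain increasing. The
  -- length of `v` is the rank of its state and so at most `n`, which is why the fuel cannot run
  -- out.
  inc-extend : ∀ f (v : Word n) → n < length v + f → Inc v → Below x (st v) →
    (∀ {l w t} → v ≡ l ∷ w → Next x (st v) t → l ⊏ t) → ∃ λ v′ → Inc v′ × st v′ ≡ x
  inc-extend zero v lt (_ , V) B h = ⊥-elim (ℕ.<⇒≱ lt (ℕ.≤-trans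
    (ℕ.≤-reflexive (trans (ℕ.+-identityʳ _) (sym (rkΠ-st v V)))) (rkΠ≤n (st v))))
  inc-extend (suc f) v lt I@(L , V) B h with T? (eqΠ (st v) x)
  ... | yes e = v , I , PiW-==-sound e
  ... | no ¬e with Next-exists Vx (st-valid v V) B (λ { refl → ¬e (PiW-==-refl x) })
  ... | t , N = inc-extend f (t ∷ v) (subst (n <_) (ℕ.+-suc (length v) f) lt)
        (link v L (λ e → h e N) , appΠ⇒app t v V (Next⇒appΠ Vx (st-valid v V) B N) , V)
        (Next⇒Below Vx (st-valid v V) B N)
        λ { refl N′ → Next-⊏ Vx (st-valid v V) B N N′ }
    where
    link : ∀ v → Linked (flip _⊏_) v → (∀ {l w} → v ≡ l ∷ w → l ⊏ t) → Linked (flip _⊏_) (t ∷ v)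
    link [] _ _ = [-]
    link (_ ∷ _) L h = h refl ∷ L

  inc-exists : ∃ λ v → Inc v × st v ≡ x
  inc-exists = inc-extend (suc n) [] ℕ.≤-refl ([] , tt) (Below-⊥ Vx) λ ()

  Forced : Word n → Set
  Forced [] = ⊤
  Forced (l ∷ v) = Next x (st v) l × Forced v

  Forced-unique : ∀ v w → length v ≡ length w → Forced v → Forced w → v ≡ w
  Forced-unique [] [] _ _ _ = refl
  Forced-unique (l ∷ v) (l′ ∷ w) e (N , F) (N′ , F′) with Forced-unique v w (cong (_∸ 1) e) F F′
  ... | refl = cong (_∷ v) (Next-unique N N′)

  -- Induction from the last label of the chain back to its first. At `x` nothing is forced, so the
  -- condition of `Next-pred` is vacuous for the last label; each label found to be forced then
  -- supplies the condition for its predecessor.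
  Inc⇒Forced : ∀ v → Inc v → Below x (st v) → (∀ {l w t} → v ≡ l ∷ w → Next x (st v) t → l ⊏ t) → Forced v
  Inc⇒Forced [] _ _ _ = tt
  Inc⇒Forced (l ∷ v) (L , A , V) B h = N , Inc⇒Forced v (Linked.tail L , V)
      (Below-down l (st-valid v V) A′ B) (below v L N)
    where
    A′ = app⇒appΠ l v V A
    N : Next x (st v) l
    N = Next-pred l Vx (st-valid v V) A′ B (h refl)
    below : ∀ v → Linked (flip _⊏_) (l ∷ v) → Next x (st v) l →
      ∀ {l′ w t} → v ≡ l′ ∷ w → Next x (st v) t → l′ ⊏ t
    below (l′ ∷ _) (p ∷ _) N refl N′ = subst (l′ ⊏_) (Next-unique N N′) p

  No-Next-self : ∀ {t} → ¬ Next x x t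
  No-Next-self N = hi-moves N (hi-fix N)

  inc-unique : ∀ {v w} → Inc v → Inc w → st v ≡ x → st w ≡ x → v ≡ w
  inc-unique {v} {w} I@(_ , V) I′@(_ , W) refl e = Forced-unique v w
    (trans (sym (rkΠ-st v V)) (trans (cong rkΠ (sym e)) (rkΠ-st w W))) (forced I refl) (forced I′ e)
    where
    forced : ∀ {v} → Inc v → st v ≡ x → Forced v
    forced {v} I e = Inc⇒Forced v I (subst (Below x) (sym e) (Below-refl Vx))
      λ _ N → ⊥-elim (No-Next-self (subst (λ y → Next x y _) e N))

  toggle-add : Word n → Word n
  toggle-add v = extend (head (List.filter (Next? x (st v)) (allLabels n)))
    where
    extend : Maybe (Label n) → Word n
    extend (just l) = l ∷ v
    extend nothing  = v

  toggle : Word n → Word n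
  toggle [] = toggle-add []
  toggle (l ∷ v) = if ⌊ Next? x (st v) l ⌋ then v else toggle-add (l ∷ v)

  toggle-add-≡ : ∀ {v l} → Next x (st v) l → toggle-add v ≡ l ∷ v
  toggle-add-≡ {v} {l} N with List.filter (Next? x (st v)) (allLabels n)
                            | ∈-filter⁺ (Next? x (st v)) (∈-allLabels l) N
                            | (λ {t} → ∈-filter⁻ (Next? x (st v)) {v = t} {xs = allLabels n})
  ... | t ∷ _ | _ | h = cong (_∷ v) (Next-unique (proj₂ (h (here refl))) N)

  toggle-yes : ∀ {l v} → Next x (st v) l → toggle (l ∷ v) ≡ v
  toggle-yes {l} {v} N with Next? x (st v) l
  ... | yes _ = refl
  ... | no ¬N = ⊥-elim (¬N N)

  toggle-no : ∀ v → (∀ {l w} → v ≡ l ∷ w → ¬ Next x (st w) l) → toggle v ≡ toggle-add v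
  toggle-no [] h = refl
  toggle-no (l ∷ v) h with Next? x (st v) l
  ... | yes N = ⊥-elim (h refl N)
  ... | no _  = refl

  ChainBelow : Word n → Set
  ChainBelow v = Val v × Fall v × Below x (st v)

  -- Toggling whether the last label of the falling chain belongs to the increasing chain that
  -- continues it up to x.
  toggle-spec : x ≢ botΠ n → ∀ {v} → ChainBelow v →
    ChainBelow (toggle v) × toggle (toggle v) ≡ v × sgn (length (toggle v)) ≡ ℤ.- sgn (length v)
  toggle-spec x≢⊥ {v} (V , F , B) with removable v
    where
    removable : ∀ v → (∃ λ l → ∃ λ w → v ≡ l ∷ w × Next x (st w) l) ⊎ (∀ {l w} → v ≡ l ∷ w → ¬ Next x (st w) l)
    removable [] = inj₂ λ ()
    removable (l ∷ w) with Next? x (st w) l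
    ... | yes N = inj₁ (l , w , refl , N)
    ... | no ¬N = inj₂ λ { refl → ¬N }
  toggle-spec x≢⊥ {l ∷ v} ((A , V) , F , B) | inj₁ (l , v , refl , N)
    rewrite toggle-yes {l} {v} N =
      (V , Linked.tail F , Below-down l (st-valid v V) (app⇒appΠ l v V A) B)
    , trans (toggle-no v (λ e → not-removable e F)) (toggle-add-≡ N)
    , sym (ℤ.neg-involutive (sgn (length v)))
    where
    -- Two forced labels in a row would be an ascent of a falling word. So after the removal of `l`
    -- toggling does not remove again but puts `l` back.
    not-removable : ∀ {l′ w} → v ≡ l′ ∷ w → Fall (l ∷ v) → ¬ Next x (st w) l′
    not-removable {l′} {w} refl (¬p ∷ _) N′ = ¬p (Next-⊏ Vx (st-valid w (proj₂ V))
      (Below-down l′ (st-valid w (proj₂ V)) (app⇒appΠ l′ w (proj₂ V) (proj₁ V))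
        (Below-down l (st-valid v V) (app⇒appΠ l v V A) B)) N′ N)
  toggle-spec x≢⊥ {v} (V , F , B) | inj₂ fixed = result (Next-exists Vx (st-valid v V) B (st≢x v refl))
    where
    -- By `Next-pred`, a last label below whatever is forced after it would be removable. Hence the
    -- chain does not end at `x` yet, and adding the forced label creates no ascent.
    last-forced : ∀ {l w} → v ≡ l ∷ w → (∀ {t} → Next x (st v) t → l ⊏ t) → ⊥
    last-forced {l} {w} refl h = fixed refl (Next-pred l Vx (st-valid w (proj₂ V))
      (app⇒appΠ l w (proj₂ V) (proj₁ V)) B h)
    st≢x : ∀ w → v ≡ w → st v ≢ x
    st≢x [] refl e = x≢⊥ (sym e)
    st≢x (l ∷ w) refl e = last-forced refl λ N → ⊥-elim (No-Next-self (subst (λ y → Next x y _) e N))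
    falls : ∀ w {t} → v ≡ w → Next x (st v) t → Fall (t ∷ v)
    falls [] refl N = [-]
    falls (l ∷ w) refl N = (λ p → last-forced refl λ N′ → subst (l ⊏_) (Next-unique N N′) p) ∷ F
    result : (∃ λ t → Next x (st v) t) →
      ChainBelow (toggle v) × toggle (toggle v) ≡ v × sgn (length (toggle v)) ≡ ℤ.- sgn (length v)
    result (t , N) rewrite toggle-no v fixed | toggle-add-≡ {v} N =
      ((appΠ⇒app t v V (Next⇒appΠ Vx (st-valid v V) B N) , V) , falls v refl N , Next⇒Below Vx (st-valid v V) B N)
      , toggle-yes N , refl

allVecs-complete : ∀ {A : Set} {as : List A} → (∀ a → a ∈ as) → ∀ {k} (v : Vec A k) → v ∈ allVecs as k
allVecs-complete h Vec.[] = here refl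
allVecs-complete h (a Vec.∷ v) = ∈-cartesianProductWith⁺ Vec._∷_ (h a) (allVecs-complete h v)

PiW-graded : ∀ n → Graded (PiW n)
PiW-graded n = record
  { ==-sound = PiW-==-sound
  ; ==-refl = PiW-==-refl
  ; complete = λ {x} _ → ∈-cartesianProductWith⁺ _,_ (allVecs-complete ∈-allFin (proj₁ x))
                                                     (allVecs-complete ∈-allFin (proj₂ x))
  ; rk = rkΠ
  ; ⊥-valid = validΠ⁺ (botΠ-valid {n})
  ; rk-⊥ = rkΠ-bot n
  ; rk-⋖ = λ {x} {y} vx _ c → let l , A , e = coverΠ⁻ {y = x} {y} (validΠ⁻ {y = x} vx) c in
      trans (cong rkΠ e) (rkΠ-merge l (validΠ⁻ {y = x} vx) A)
  ; from-⊥ = from }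
  where
  from : ∀ {x} → T (validΠ x) → Reach (PiW n) (rkΠ x) (botΠ n) x
  from {x} v with inc-exists (validΠ⁻ {y = x} v)
  ... | w , (_ , W) , refl = subst (λ k → Reach (PiW n) k (botΠ n) (st w)) (sym (rkΠ-st w W)) (Reach-st w W)

Reach⇒Below : ∀ {n} k {x y : RawΠ n} → ValidΠ y → Reach (PiW n) k y x → Below x y
Reach⇒Below zero V refl = Below-refl V
Reach⇒Below (suc k) {y = y} V (z , vz , c , r) with coverΠ⁻ {y = y} {z} V c
... | l , A , refl = Below-down l V A (Reach⇒Below k (validΠ⁻ {y = z} vz) r)

-- Merging along forced labels climbs from `y` to `x`; every merge raises the rank, which is at most
-- `n`.
Below⇒Reach : ∀ {n} f {x y : RawΠ n} → n < rkΠ y + f → ValidΠ x → ValidΠ y → Below x y →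
  ∃ λ k → Reach (PiW n) k y x
Below⇒Reach zero {y = y} lt _ _ _ =
  ⊥-elim (ℕ.<⇒≱ lt (ℕ.≤-trans (ℕ.≤-reflexive (ℕ.+-identityʳ _)) (rkΠ≤n y)))
Below⇒Reach {n} (suc f) {x} {y} lt Vx Vy B with T? (eqΠ y x)
... | yes e = 0 , PiW-==-sound e
... | no ¬e with Next-exists Vx Vy B (λ { refl → ¬e (PiW-==-refl x) })
... | l , N with Next⇒appΠ Vx Vy B N
... | A with Below⇒Reach f (subst (n <_) (trans (ℕ.+-suc (rkΠ y) f) (cong (_+ f) (sym (rkΠ-merge l Vy A)))) lt)
               Vx (merge-validΠ l Vy A) (Next⇒Below Vx Vy B N)
... | k , r = suc k , merge l y , validΠ⁺ (merge-validΠ l Vy A) , coverΠ⁺ l Vy A , r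

-- Bicolored Lyndon trees

Unique-++⁻ : ∀ {A : Set} (xs : List A) {ys} → Unique (xs ++ ys) →
  Unique xs × Unique ys × (∀ {x} → x ∈ xs → x ∉ ys)
Unique-++⁻ [] u = [] , u , λ ()
Unique-++⁻ (x ∷ xs) (h ∷ u) with Unique-++⁻ xs u
... | ux , uy , d = All.++⁻ˡ xs h ∷ ux , uy ,
  λ { (here refl) j → All.lookup h (∈-++⁺ʳ xs j) refl ; (there i) j → d i j }

-- The leftmost leaf. For normalized trees it is the least one (`toℕ-νF`), and unlike `ν` it is a
-- point rather than a number.
νF : ∀ {n} → Tree n → Fin n
νF (leaf i)     = i
νF (node _ l r) = νF l

-- In preorder, so that a left spine is listed from its top down, the latest label first as in
-- words.
labels : ∀ {n} → Tree n → Word n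
labels (leaf i)     = []
labels (node u l r) = (νF l , νF r , u) ∷ labels l ++ labels r

νF∈leaves : ∀ {n} (t : Tree n) → νF t ∈ leaves t
νF∈leaves (leaf i) = here refl
νF∈leaves (node _ l r) = ∈-++⁺ˡ (νF∈leaves l)

labels⊆leaves : ∀ {n} (t : Tree n) {l} → l ∈ labels t → lo l ∈ leaves t × hi l ∈ leaves t
labels⊆leaves (node _ l r) (here refl) = ∈-++⁺ˡ (νF∈leaves l) , ∈-++⁺ʳ (leaves l) (νF∈leaves r)
labels⊆leaves (node _ l r) (there i) with ∈-++⁻ (labels l) i
... | inj₁ j = let p , q = labels⊆leaves l j in ∈-++⁺ˡ p , ∈-++⁺ˡ q
... | inj₂ j = let p , q = labels⊆leaves r j in ∈-++⁺ʳ (leaves l) p , ∈-++⁺ʳ (leaves l) q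

-- Each leaf but the leftmost one is the leftmost leaf of the right subtree at exactly one vertex,
-- the parent of the top of its left spine.
his-leaves : ∀ {n} (t : Tree n) → νF t ∷ his (labels t) ↭ leaves t
his-leaves (leaf i) = ↭-refl
his-leaves (node u l r) = ↭-trans
  (prep (νF l) (↭-trans (prep (νF r) (↭-reflexive (map-++ hi (labels l) (labels r))))
                        (↭-sym (Perm.shift (νF r) (his (labels l)) (his (labels r))))))
  (Perm.++⁺ (his-leaves l) (his-leaves r))

treeEq-sound : ∀ {n} {s t : Tree n} → T (treeEq s t) → s ≡ t
treeEq-sound {s = leaf i} {leaf j} e = cong leaf (=F-sound e)
treeEq-sound {s = node c l r} {node c′ l′ r′} e
  with =F-sound {i = c} (∧-fst e) | treeEq-sound {s = l} (∧-fst (∧-snd {c =F c′} e))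
     | treeEq-sound {s = r} (∧-snd {treeEq l l′} (∧-snd {c =F c′} e))
... | refl | refl | refl = refl

treeEq-refl : ∀ {n} (t : Tree n) → T (treeEq t t)
treeEq-refl (leaf i) = =F-refl i
treeEq-refl (node c l r) = ∧-intro (=F-refl c) (∧-intro (treeEq-refl l) (treeEq-refl r))

BL : ∀ {n} → Tree n → Set
BL t = T (isBLyndon t)

vertexOK : ∀ {n} → Fin 2 → Tree n → Tree n → Bool
vertexOK c (leaf _) r = true
vertexOK c l@(node c′ _ _) r = isLyndonVertex c l r ∨ (toℕ c <ᵇ toℕ c′)

module _ {n} (c : Fin 2) (l r : Tree n) where
  BL-node⁺ : ν l ≤ ν r → T (vertexOK c l r) → BL l → BL r → BL (node c l r)
  BL-node⁺ le v bl br = ∧-intro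
    (∧-intro (ℕ.≡⇒≡ᵇ _ _ (ℕ.m≤n⇒m⊓n≡m le)) (∧-intro {normalized l} (∧-fst bl) (∧-fst {normalized r} br)))
    (lyndon l v (∧-snd {normalized l} bl) (∧-snd {normalized r} br))
    where
    lyndon : ∀ l → T (vertexOK c l r) → T (lyndonCond l) → T (lyndonCond r) → T (lyndonCond (node c l r))
    lyndon (leaf _) _ _ br = br
    lyndon (node _ _ _) v bl br = ∧-intro v (∧-intro bl br)

  BL-node⁻ : BL (node c l r) → ν l ≤ ν r × T (vertexOK c l r) × BL l × BL r
  BL-node⁻ b = ℕ.m⊓n≡m⇒m≤n (ℕ.≡ᵇ⇒≡ _ _ (∧-fst (∧-fst b)))
    , vertex l y , ∧-intro (∧-fst x) (left l y) , ∧-intro (∧-snd {normalized l} x) (right l y)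
    where
    x = ∧-snd {ν l ⊓ ν r ≡ᵇ ν l} (∧-fst b)
    y = ∧-snd {normalized (node c l r)} b
    vertex : ∀ l → T (lyndonCond (node c l r)) → T (vertexOK c l r)
    vertex (leaf _) _ = tt
    vertex (node _ _ _) t = ∧-fst t
    left : ∀ l → T (lyndonCond (node c l r)) → T (lyndonCond l)
    left (leaf _) _ = tt
    left l@(node _ _ _) t = ∧-fst (∧-snd {vertexOK c l r} t)
    right : ∀ l → T (lyndonCond (node c l r)) → T (lyndonCond r)
    right (leaf _) t = t
    right l@(node _ _ _) t = ∧-snd {lyndonCond l} (∧-snd {vertexOK c l r} t)

toℕ-νF : ∀ {n} (t : Tree n) → BL t → toℕ (νF t) ≡ ν t
toℕ-νF (leaf i) _ = refl
toℕ-νF (node c l r) b with BL-node⁻ c l r b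
... | le , _ , bl , _ = trans (toℕ-νF l bl) (sym (ℕ.m≤n⇒m⊓n≡m le))

-- The functional context of `mergeAux` as a list of frames, innermost first, to allow induction.
-- One frame type suffices because the new vertex descends to left children only.
Context : ℕ → Set
Context n = List (Fin 2 × Tree n)

plug : ∀ {n} → Context n → Tree n → Tree n
plug [] h            = h
plug ((c , R) ∷ k) h = plug k (node c h R)

BL-plug⁻ : ∀ {n} (k : Context n) {h} → BL (plug k h) → BL h
BL-plug⁻ [] b = b
BL-plug⁻ ((c , R) ∷ k) {h} b = proj₁ (proj₂ (proj₂ (BL-node⁻ c h R (BL-plug⁻ k b))))

-- A vertex depends on its left child through the color, the right subtree and the value `ν` of that
-- child. Replacing `h` therefore affects the condition at its parent only, and that one is assumed.
plug-replace : ∀ {n} (k : Context n) c h h′ R → ν h ≡ ν h′ → BL (plug k (node c h R)) →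
  BL (node c h′ R) → BL (plug k (node c h′ R))
plug-replace [] c h h′ R e b b′ = b′
plug-replace ((c₁ , R₁) ∷ k) c h h′ R e b b′ with BL-node⁻ c₁ (node c h R) R₁ (BL-plug⁻ k b)
... | le , v , _ , bR = plug-replace k c₁ (node c h R) (node c h′ R) R₁ e′ b
    (BL-node⁺ c₁ (node c h′ R) R₁ (subst (_≤ ν R₁) e′ le) v b′ bR)
  where
  e′ : ν h ⊓ ν R ≡ ν h′ ⊓ ν R
  e′ = cong (_⊓ ν R) e

-- Merging with a test at the new vertex alone, where `mergeAux` tests the whole tree.
ins : ∀ {n} → Fin 2 → Tree n → Tree n → Tree n
ins u (leaf i) Y = node u (leaf i) Y
ins u X@(node c XL XR) Y = if vertexOK u X Y then node u X Y else node c (ins u XL Y) XR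

ins-stop : ∀ {n} u c (XL XR Y : Tree n) → T (vertexOK u (node c XL XR) Y) →
  ins u (node c XL XR) Y ≡ node u (node c XL XR) Y
ins-stop u c XL XR Y = if-yes

ins-slide : ∀ {n} u c (XL XR Y : Tree n) → ¬ T (vertexOK u (node c XL XR) Y) →
  ins u (node c XL XR) Y ≡ node c (ins u XL Y) XR
ins-slide u c XL XR Y = if-no

mergeAux-stop : ∀ {n} (ctx : Tree n → Tree n) u X Y → BL (ctx (node u X Y)) →
  mergeAux ctx u X Y ≡ ctx (node u X Y)
mergeAux-stop ctx u X Y b with isBLyndon (ctx (node u X Y))
... | true = refl

mergeAux-slide : ∀ {n} (ctx : Tree n → Tree n) u c XL XR Y → ¬ BL (ctx (node u (node c XL XR) Y)) →
  mergeAux ctx u (node c XL XR) Y ≡ mergeAux (λ h → ctx (node c h XR)) u XL Y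
mergeAux-slide ctx u c XL XR Y b with isBLyndon (ctx (node u (node c XL XR) Y))
... | true  = ⊥-elim (b tt)
... | false = refl

ν∈leaves : ∀ {n} (t : Tree n) → ∃ λ i → i ∈ leaves t × toℕ i ≡ ν t
ν∈leaves (leaf i) = i , here refl , refl
ν∈leaves (node _ l r) with ν∈leaves l | ν∈leaves r | ℕ.⊓-sel (ν l) (ν r)
... | i , p , e | _ | inj₁ q = i , ∈-++⁺ˡ p , trans e (sym q)
... | _ | j , p , e | inj₂ q = j , ∈-++⁺ʳ (leaves l) p , trans e (sym q)

Disjoint : ∀ {n} → Tree n → Tree n → Set
Disjoint X Y = ∀ {i} → i ∈ leaves X → i ∉ leaves Y

Disjoint⇒ν≢ : ∀ {n} (X Y : Tree n) → Disjoint X Y → ν X ≢ ν Y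
Disjoint⇒ν≢ X Y d e with ν∈leaves X | ν∈leaves Y
... | i , p , ei | j , q , ej = d p (subst (_∈ leaves Y) (Fin.toℕ-injective (trans ej (trans (sym e) (sym ei)))) q)

-- After sliding, the vertex passed over stays admissible because the order of the two labels is reversed.
Passed : ∀ {n} → Context n → Fin 2 → Tree n → Set
Passed [] u Y = ⊤
Passed ((c , R) ∷ _) u Y = T ((ν R <ᵇ ν Y) ∨ (toℕ c <ᵇ toℕ u))

-- The two tests agree because the new vertex is the only one that can fail: `Passed` covers the
-- vertex just above it, and `plug-replace` those further up. The slide ends at the latest at a
-- leaf, where every vertex is admissible.
mergeAux-ins : ∀ {n} (k : Context n) u X Y → BL (plug k X) → BL Y → ν X ≤ ν Y → Disjoint X Y → Passed k u Y →
  mergeAux (plug k) u X Y ≡ plug k (ins u X Y) × BL (plug k (ins u X Y))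
mergeAux-ins {n} k u X Y bX bY le d p with T? (vertexOK u X Y)
... | yes v = trans (mergeAux-stop (plug k) u X Y b) (cong (plug k) (sym (stop X v)))
            , subst (BL ∘ plug k) (sym (stop X v)) b
  where
  stop : ∀ X → T (vertexOK u X Y) → ins u X Y ≡ node u X Y
  stop (leaf i) _ = refl
  stop (node c XL XR) v = ins-stop u c XL XR Y v
  b₀ : BL (node u X Y)
  b₀ = BL-node⁺ u X Y le v (BL-plug⁻ k bX) bY
  e : ν X ≡ ν X ⊓ ν Y
  e = sym (ℕ.m≤n⇒m⊓n≡m le)
  around : ∀ k → Passed k u Y → BL (plug k X) → BL (plug k (node u X Y))
  around [] _ _ = b₀
  around ((c , R) ∷ k) p bX with BL-node⁻ c X R (BL-plug⁻ k bX)
  ... | leR , _ , _ , bR = plug-replace k c X (node u X Y) R e bX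
          (BL-node⁺ c (node u X Y) R (subst (_≤ ν R) e leR) p b₀ bR)
  b : BL (plug k (node u X Y))
  b = around k p bX
mergeAux-ins k u (leaf i) Y bX bY le d p | no ¬v = ⊥-elim (¬v tt)
mergeAux-ins k u X@(node c XL XR) Y bX bY le d p | no ¬v =
  trans (mergeAux-slide (plug k) u c XL XR Y ¬b) (trans (proj₁ ih) (cong (plug k) (sym slide)))
  , subst (BL ∘ plug k) (sym slide) (proj₂ ih)
  where
  slide = ins-slide u c XL XR Y ¬v
  ¬b : ¬ BL (plug k (node u X Y))
  ¬b b = ¬v (proj₁ (proj₂ (BL-node⁻ u X Y (BL-plug⁻ k b))))
  leX : ν XL ≤ ν XR
  leX = proj₁ (BL-node⁻ c XL XR (BL-plug⁻ k bX))
  -- A failed test rules out `ν Y < ν XR`, and disjointness rules out equality. Hence the new vertex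
  -- remains normalized one level down, and the passed vertex is Lyndon.
  XR<Y : ν XR < ν Y
  XR<Y = ℕ.≤∧≢⇒< (ℕ.≮⇒≥ (λ lt → ¬v (∨-introˡ (ℕ.<⇒<ᵇ lt))))
           (Disjoint⇒ν≢ XR Y (λ i → d (∈-++⁺ʳ (leaves XL) i)))
  ih = mergeAux-ins ((c , XR) ∷ k) u XL Y bX bY
         (ℕ.≤-trans leX (ℕ.<⇒≤ XR<Y)) (λ i → d (∈-++⁺ˡ i)) (∨-introˡ (ℕ.<⇒<ᵇ XR<Y))

umerge-ins : ∀ {n} u (X Y : Tree n) → BL X → BL Y → ν X ≤ ν Y → Disjoint X Y →
  umerge u X Y ≡ ins u X Y × BL (ins u X Y)
umerge-ins u X Y bX bY le d = mergeAux-ins [] u X Y bX bY le d tt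

leaves-ins : ∀ {n} u (X Y : Tree n) → leaves (ins u X Y) ↭ leaves X ++ leaves Y
leaves-ins u (leaf i) Y = ↭-refl
leaves-ins u X@(node c XL XR) Y with T? (vertexOK u X Y)
... | yes v = ↭-reflexive (cong leaves (ins-stop u c XL XR Y v))
... | no ¬v = ↭-trans (↭-reflexive (cong leaves (ins-slide u c XL XR Y ¬v)))
  (↭-trans (Perm.++⁺ʳ (leaves XR) (leaves-ins u XL Y))
  (↭-trans (↭-reflexive (++-assoc (leaves XL) (leaves Y) (leaves XR)))
  (↭-trans (Perm.++⁺ˡ (leaves XL) (Perm.++-comm (leaves Y) (leaves XR)))
           (↭-reflexive (sym (++-assoc (leaves XL) (leaves XR) (leaves Y)))))))

νF-ins : ∀ {n} u (X Y : Tree n) → νF (ins u X Y) ≡ νF X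
νF-ins u (leaf i) Y = refl
νF-ins u X@(node c XL XR) Y with T? (vertexOK u X Y)
... | yes v = cong νF (ins-stop u c XL XR Y v)
... | no ¬v = trans (cong νF (ins-slide u c XL XR Y ¬v)) (νF-ins u XL Y)

-- Left spines as words

infixl 6 _at_
_at_ : ∀ {n} → Word n → Fin n → Word n
v at a = filterᵇ (λ l → lo l =F a) v

at-yes : ∀ {n} (l : Label n) v {a} → lo l ≡ a → (l ∷ v) at a ≡ l ∷ (v at a)
at-yes l v {a} e = filterᵇ-yes (λ x → lo x =F a) {l} {v} (=F-complete e)

at-no : ∀ {n} (l : Label n) v {a} → lo l ≢ a → (l ∷ v) at a ≡ v at a
at-no l v {a} ne = filterᵇ-no (λ x → lo x =F a) {l} {v} (=F-no ne)

at-++ : ∀ {n} (v w : Word n) {a} → (v ++ w) at a ≡ (v at a) ++ (w at a)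
at-++ v w {a} = filter-++ (λ x → T? (lo x =F a)) v w

at-none : ∀ {n} (v : Word n) {a} → (∀ {l} → l ∈ v → lo l ≢ a) → v at a ≡ []
at-none v {a} h = filterᵇ-none (λ x → lo x =F a) v (λ i → =F-no (h i))

labels-none : ∀ {n} (t : Tree n) {a} → a ∉ leaves t → labels t at a ≡ []
labels-none t a∉ = at-none (labels t) (λ { i refl → a∉ (proj₁ (labels⊆leaves t i)) })

rootLabel : ∀ {n} → Fin 2 → Tree n → Tree n → Label n
rootLabel u X Y = νF X , νF Y , u

-- Sliding past the left child is exactly the comparison of the two labels on the left spine.
vertexOK⇔ : ∀ {n} u c (XL XR Y : Tree n) → BL XR → BL Y → ν XR ≢ ν Y →
  (T (vertexOK u (node c XL XR) Y) → ¬ (rootLabel c XL XR ⊏ rootLabel u (node c XL XR) Y))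
  × (¬ T (vertexOK u (node c XL XR) Y) → rootLabel c XL XR ⊏ rootLabel u (node c XL XR) Y)
vertexOK⇔ u c XL XR Y bR bY ne = to , from
  where
  to : T (vertexOK u (node c XL XR) Y) → ¬ (rootLabel c XL XR ⊏ rootLabel u (node c XL XR) Y)
  to v p with ⊏⁻ p | ∨-elim {ν Y <ᵇ ν XR} v
  ... | inj₁ lt | _ = ℕ.<-irrefl refl lt
  ... | inj₂ (_ , b≤ , _) | inj₁ q = ℕ.<⇒≱ (ℕ.<ᵇ⇒< _ _ q) (subst₂ _≤_ (toℕ-νF XR bR) (toℕ-νF Y bY) b≤)
  ... | inj₂ (_ , _ , u≤ , _) | inj₂ q = ℕ.<⇒≱ (ℕ.<ᵇ⇒< _ _ q) u≤
  from : ¬ T (vertexOK u (node c XL XR) Y) → rootLabel c XL XR ⊏ rootLabel u (node c XL XR) Y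
  from ¬v = ⊏-hi refl
    (subst₂ _≤_ (sym (toℕ-νF XR bR)) (sym (toℕ-νF Y bY)) (ℕ.≮⇒≥ (λ lt → ¬v (∨-introˡ (ℕ.<⇒<ᵇ lt)))))
    (ℕ.≮⇒≥ (λ lt → ¬v (∨-introʳ {ν Y <ᵇ ν XR} (ℕ.<⇒<ᵇ lt))))
    (λ e → ne (trans (sym (toℕ-νF XR bR)) (trans (cong (toℕ ∘ hi) e) (toℕ-νF Y bY))))

module _ {n} (u : Fin 2) (Y : Tree n) (bY : BL Y) where

  -- At each spine vertex the slide and `insR` make the same decision. The labels of `Y` and of the
  -- right subtrees have other first entries and drop out.
  labels-ins-at : ∀ X → BL X → Unique (leaves X) → Disjoint X Y →
    labels (ins u X Y) at νF X ≡ insR (rootLabel u X Y) (labels X at νF X)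
  labels-ins-at X@(leaf i) bX uX d = trans (at-yes (rootLabel u X Y) (labels Y) refl) (cong (rootLabel u X Y ∷_) (labels-none Y (d (here refl))))
  labels-ins-at X@(node c XL XR) bX uX d
    with T? (vertexOK u X Y) | Unique-++⁻ (leaves XL) uX | BL-node⁻ c XL XR bX
  ... | yes v | _ , _ , dX | _ , _ , _ , bR = begin
    labels (ins u X Y) at a ≡⟨ cong (λ t → labels t at a) (ins-stop u c XL XR Y v) ⟩
    (l ∷ labels X ++ labels Y) at a ≡⟨ at-yes l (labels X ++ labels Y) refl ⟩
    l ∷ ((labels X ++ labels Y) at a) ≡⟨ cong (l ∷_) (at-++ (labels X) (labels Y)) ⟩
    l ∷ (labels X at a) ++ (labels Y at a) ≡⟨ cong (λ w → l ∷ (labels X at a) ++ w) (labels-none Y (d (νF∈leaves X))) ⟩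
    l ∷ (labels X at a) ++ [] ≡⟨ cong (l ∷_) (++-identityʳ _) ⟩
    l ∷ (labels X at a) ≡⟨ cong (l ∷_) (at-yes x (labels XL ++ labels XR) refl) ⟩
    l ∷ x ∷ ((labels XL ++ labels XR) at a) ≡⟨ insR-≮ _ (proj₁ (vertexOK⇔ u c XL XR Y bR bY ne) v) ⟨
    insR l (x ∷ ((labels XL ++ labels XR) at a)) ≡⟨ cong (insR l) (at-yes x (labels XL ++ labels XR) refl) ⟨
    insR l (labels X at a) ∎
    where
    open ≡-Reasoning
    a = νF X
    l = rootLabel u X Y
    x = rootLabel c XL XR
    ne = Disjoint⇒ν≢ XR Y (λ i → d (∈-++⁺ʳ (leaves XL) i))
  ... | no ¬v | uL , _ , dX | _ , _ , bL , bR = begin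
    labels (ins u X Y) at a ≡⟨ cong (λ t → labels t at a) (ins-slide u c XL XR Y ¬v) ⟩
    labels (node c (ins u XL Y) XR) at a ≡⟨ at-yes x′ (labels (ins u XL Y) ++ labels XR) (νF-ins u XL Y) ⟩
    x′ ∷ ((labels (ins u XL Y) ++ labels XR) at a) ≡⟨ cong (λ i → (i , νF XR , c) ∷ ((labels (ins u XL Y) ++ labels XR) at a)) (νF-ins u XL Y) ⟩
    x ∷ ((labels (ins u XL Y) ++ labels XR) at a) ≡⟨ cong (x ∷_) (at-++ (labels (ins u XL Y)) (labels XR)) ⟩
    x ∷ (labels (ins u XL Y) at a) ++ (labels XR at a) ≡⟨ cong (λ w → x ∷ (labels (ins u XL Y) at a) ++ w) R-none ⟩
    x ∷ (labels (ins u XL Y) at a) ++ [] ≡⟨ cong (x ∷_) (++-identityʳ _) ⟩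
    x ∷ (labels (ins u XL Y) at a) ≡⟨ cong (x ∷_) (labels-ins-at XL bL uL (λ i → d (∈-++⁺ˡ i))) ⟩
    x ∷ insR l (labels XL at a) ≡⟨ insR-< _ (proj₂ (vertexOK⇔ u c XL XR Y bR bY ne) ¬v) ⟨
    insR l (x ∷ (labels XL at a)) ≡⟨ cong (λ w → insR l (x ∷ w)) (trans (cong ((labels XL at a) ++_) R-none) (++-identityʳ _)) ⟨
    insR l (x ∷ (labels XL at a) ++ (labels XR at a)) ≡⟨ cong (λ w → insR l (x ∷ w)) (at-++ (labels XL) (labels XR)) ⟨
    insR l (x ∷ ((labels XL ++ labels XR) at a)) ≡⟨ cong (insR l) (at-yes x (labels XL ++ labels XR) refl) ⟨
    insR l (labels X at a) ∎
    where
    open ≡-Reasoning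
    a = νF X
    l = rootLabel u X Y
    x = rootLabel c XL XR
    x′ = rootLabel c (ins u XL Y) XR
    ne = Disjoint⇒ν≢ XR Y (λ i → d (∈-++⁺ʳ (leaves XL) i))
    R-none : labels XR at a ≡ []
    R-none = labels-none XR (dX (νF∈leaves XL))

  labels-ins-off : ∀ X {b} → Unique (leaves X) → Disjoint X Y → νF X ≢ b →
    labels (ins u X Y) at b ≡ (labels X at b) ++ (labels Y at b)
  labels-ins-off X@(leaf i) uX d ne = at-no (rootLabel u X Y) (labels Y) ne
  labels-ins-off X@(node c XL XR) {b} uX d ne with T? (vertexOK u X Y) | Unique-++⁻ (leaves XL) uX
  ... | yes v | _ = trans (cong (λ t → labels t at b) (ins-stop u c XL XR Y v))
                      (trans (at-no (rootLabel u X Y) (labels X ++ labels Y) ne) (at-++ (labels X) (labels Y)))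
  ... | no ¬v | uL , _ , _ = begin
    labels (ins u X Y) at b ≡⟨ cong (λ t → labels t at b) (ins-slide u c XL XR Y ¬v) ⟩
    labels (node c (ins u XL Y) XR) at b ≡⟨ at-no (rootLabel c (ins u XL Y) XR) (labels (ins u XL Y) ++ labels XR)
                                                               (λ e → ne (trans (sym (νF-ins u XL Y)) e)) ⟩
    (labels (ins u XL Y) ++ labels XR) at b ≡⟨ at-++ (labels (ins u XL Y)) (labels XR) ⟩
    (labels (ins u XL Y) at b) ++ R ≡⟨ cong (_++ R) (labels-ins-off XL uL (λ i → d (∈-++⁺ˡ i)) ne) ⟩
    (L ++ labels Y at b) ++ R ≡⟨ ++-assoc L _ R ⟩
    L ++ ((labels Y at b) ++ R) ≡⟨ cong (L ++_) commute ⟩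
    L ++ (R ++ (labels Y at b)) ≡⟨ ++-assoc L R _ ⟨
    (L ++ R) ++ (labels Y at b) ≡⟨ cong (_++ (labels Y at b)) (at-++ (labels XL) (labels XR)) ⟨
    ((labels XL ++ labels XR) at b) ++ (labels Y at b) ≡⟨ cong (_++ (labels Y at b)) (at-no (rootLabel c XL XR) (labels XL ++ labels XR) ne) ⟨
    (labels X at b) ++ (labels Y at b) ∎
    where
    open ≡-Reasoning
    L = labels XL at b
    R = labels XR at b
    -- The slide lists `Y` before `XR`, but `b` is a leaf of at most one of them, so one of the two
    -- words is empty.
    commute : (labels Y at b) ++ R ≡ R ++ (labels Y at b)
    commute with Any.any? (b ≟_) (leaves Y)
    ... | no b∉ = trans (cong (_++ R) (labels-none Y b∉))
                    (trans (sym (++-identityʳ R)) (cong (R ++_) (sym (labels-none Y b∉))))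
    ... | yes b∈ = trans (cong ((labels Y at b) ++_) R-none)
                     (trans (++-identityʳ _) (cong (_++ (labels Y at b)) (sym R-none)))
      where
      R-none : R ≡ []
      R-none = labels-none XR (λ i → d (∈-++⁺ʳ (leaves XL) i) b∈)

labels-lo<hi : ∀ {n} (t : Tree n) → BL t → Unique (leaves t) → ∀ {l} → l ∈ labels t → toℕ (lo l) < toℕ (hi l)
labels-lo<hi (node c L R) b u i with BL-node⁻ c L R b | Unique-++⁻ (leaves L) u
labels-lo<hi (node c L R) b u (here refl) | le , _ , bL , bR | uL , uR , d =
  subst₂ _<_ (sym (toℕ-νF L bL)) (sym (toℕ-νF R bR)) (ℕ.≤∧≢⇒< le (Disjoint⇒ν≢ L R d))
labels-lo<hi (node c L R) b u (there i) | le , _ , bL , bR | uL , uR , d with ∈-++⁻ (labels L) i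
... | inj₁ j = labels-lo<hi L bL uL j
... | inj₂ j = labels-lo<hi R bR uR j

at-either : ∀ {n} (v w : Word n) a → (∀ {l l′} → l ∈ v → l′ ∈ w → lo l ≢ lo l′) →
  (v ++ w) at a ≡ v at a ⊎ (v ++ w) at a ≡ w at a
at-either v w a d with Any.any? (λ l → lo l ≟ a) v
... | no none = inj₂ (trans (at-++ v w) (cong (_++ (w at a)) (at-none v (λ i e → none (lose i e)))))
... | yes some with find some
... | l , i , e = inj₁ (trans (at-++ v w) (trans
        (cong ((v at a) ++_) (at-none w (λ j e′ → d i j (trans e (sym e′))))) (++-identityʳ _)))

labels-Fall : ∀ {n} (t : Tree n) → BL t → Unique (leaves t) → ∀ a → Fall (labels t at a)
labels-Fall (leaf i) b u a = []
labels-Fall (node c L R) b u a with BL-node⁻ c L R b | Unique-++⁻ (leaves L) u | νF L ≟ a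
... | le , v , bL , bR | uL , uR , d | no ne
  with at-either (labels L) (labels R) a
         (λ i j e → d (proj₁ (labels⊆leaves L i)) (subst (_∈ leaves R) (sym e) (proj₁ (labels⊆leaves R j))))
... | inj₁ e = subst Fall (sym (trans (at-no (rootLabel c L R) (labels L ++ labels R) ne) e)) (labels-Fall L bL uL a)
... | inj₂ e = subst Fall (sym (trans (at-no (rootLabel c L R) (labels L ++ labels R) ne) e)) (labels-Fall R bR uR a)
labels-Fall (node c L R) b u a | le , v , bL , bR | uL , uR , d | yes refl =
  subst Fall (sym (trans (at-yes (rootLabel c L R) (labels L ++ labels R) refl) (cong (rootLabel c L R ∷_) (trans (at-++ (labels L) (labels R))
    (trans (cong ((labels L at νF L) ++_) (labels-none R (d (νF∈leaves L)))) (++-identityʳ _))))))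
    (cons L v bL uL d (labels-Fall L bL uL (νF L)))
  where
  cons : ∀ L → T (vertexOK c L R) → BL L → Unique (leaves L) → Disjoint L R → Fall (labels L at νF L) →
    Fall (rootLabel c L R ∷ (labels L at νF L))
  cons (leaf _) _ _ _ _ _ = [-]
  cons (node c′ LL LR) v bL uL d F with BL-node⁻ c′ LL LR bL
  ... | _ , _ , _ , bLR = subst (λ w → Fall (rootLabel c (node c′ LL LR) R ∷ w)) (sym (at-yes (rootLabel c′ LL LR) (labels LL ++ labels LR) refl))
    (proj₁ (vertexOK⇔ c c′ LL LR R bLR bR (Disjoint⇒ν≢ LR R (λ i → d (∈-++⁺ʳ (leaves LL) i)))) v
     ∷ subst Fall (at-yes (rootLabel c′ LL LR) (labels LL ++ labels LR) refl) F)

-- Bicolored Lyndon forests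

-- A stable insertion by first entry: every spine keeps its inner order. Increasing first entries in
-- a stored word mean decreasing ones along the chain.
insS : ∀ {n} → Label n → Word n → Word n
insS l []      = l ∷ []
insS l (x ∷ v) = if toℕ (lo x) <ᵇ toℕ (lo l) then x ∷ insS l v else l ∷ x ∷ v

isort : ∀ {n} → Word n → Word n
isort = foldr insS []

insS-< : ∀ {n} {l x : Label n} v → toℕ (lo x) < toℕ (lo l) → insS l (x ∷ v) ≡ x ∷ insS l v
insS-< v p = if-yes (ℕ.<⇒<ᵇ p)

insS-≮ : ∀ {n} {l x : Label n} v → ¬ (toℕ (lo x) < toℕ (lo l)) → insS l (x ∷ v) ≡ l ∷ x ∷ v
insS-≮ v p = if-no (p ∘ ℕ.<ᵇ⇒< _ _)

LoSorted : ∀ {n} → Word n → Set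
LoSorted = AllPairs (λ x y → toℕ (lo x) ≤ toℕ (lo y))

insS-↭ : ∀ {n} (l : Label n) v → insS l v ↭ l ∷ v
insS-↭ l [] = ↭-refl
insS-↭ l (x ∷ v) with toℕ (lo x) <? toℕ (lo l)
... | yes p = ↭-trans (↭-reflexive (insS-< v p)) (↭-trans (prep x (insS-↭ l v)) (swap x l ↭-refl))
... | no ¬p = ↭-reflexive (insS-≮ v ¬p)

isort-↭ : ∀ {n} (v : Word n) → isort v ↭ v
isort-↭ [] = ↭-refl
isort-↭ (l ∷ v) = ↭-trans (insS-↭ l (isort v)) (prep l (isort-↭ v))

insS-LoSorted : ∀ {n} (l : Label n) {v} → LoSorted v → LoSorted (insS l v)
insS-LoSorted l [] = [] ∷ []
insS-LoSorted l {x ∷ v} (h ∷ s) with toℕ (lo x) <? toℕ (lo l)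
... | yes p = subst LoSorted (sym (insS-< v p))
    (Perm.All-resp-↭ (↭-sym (insS-↭ l v)) (ℕ.<⇒≤ p ∷ h) ∷ insS-LoSorted l s)
... | no ¬p = subst LoSorted (sym (insS-≮ v ¬p))
    ((ℕ.≮⇒≥ ¬p ∷ All.map (ℕ.≤-trans (ℕ.≮⇒≥ ¬p)) h) ∷ h ∷ s)

isort-LoSorted : ∀ {n} (v : Word n) → LoSorted (isort v)
isort-LoSorted [] = []
isort-LoSorted (l ∷ v) = insS-LoSorted l (isort-LoSorted v)

insS-at : ∀ {n} (l : Label n) v a → insS l v at a ≡ (l ∷ v) at a
insS-at l [] a = refl
insS-at l (x ∷ v) a with toℕ (lo x) <? toℕ (lo l)
... | no ¬p = cong (_at a) (insS-≮ v ¬p)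
... | yes p with lo x ≟ a | lo l ≟ a
... | yes refl | yes q = ⊥-elim (ℕ.<-irrefl (cong toℕ (sym q)) p)
... | yes q | no ne = begin
  insS l (x ∷ v) at a ≡⟨ cong (_at a) (insS-< v p) ⟩
  (x ∷ insS l v) at a ≡⟨ at-yes x (insS l v) q ⟩
  x ∷ (insS l v at a) ≡⟨ cong (x ∷_) (trans (insS-at l v a) (at-no l v ne)) ⟩
  x ∷ (v at a) ≡⟨ at-yes x v q ⟨
  (x ∷ v) at a ≡⟨ at-no l (x ∷ v) ne ⟨
  (l ∷ x ∷ v) at a ∎
  where open ≡-Reasoning
... | no ne | yes q = begin
  insS l (x ∷ v) at a ≡⟨ cong (_at a) (insS-< v p) ⟩
  (x ∷ insS l v) at a ≡⟨ at-no x (insS l v) ne ⟩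
  insS l v at a ≡⟨ trans (insS-at l v a) (at-yes l v q) ⟩
  l ∷ (v at a) ≡⟨ cong (l ∷_) (at-no x v ne) ⟨
  l ∷ ((x ∷ v) at a) ≡⟨ at-yes l (x ∷ v) q ⟨
  (l ∷ x ∷ v) at a ∎
  where open ≡-Reasoning
... | no ne | no ne′ = begin
  insS l (x ∷ v) at a ≡⟨ cong (_at a) (insS-< v p) ⟩
  (x ∷ insS l v) at a ≡⟨ at-no x (insS l v) ne ⟩
  insS l v at a ≡⟨ trans (insS-at l v a) (at-no l v ne′) ⟩
  v at a ≡⟨ at-no x v ne ⟨
  (x ∷ v) at a ≡⟨ at-no l (x ∷ v) ne′ ⟨
  (l ∷ x ∷ v) at a ∎
  where open ≡-Reasoning

isort-at : ∀ {n} (v : Word n) a → isort v at a ≡ v at a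
isort-at [] a = refl
isort-at (l ∷ v) a = trans (insS-at l (isort v) a) cons
  where
  cons : (l ∷ isort v) at a ≡ (l ∷ v) at a
  cons with lo l ≟ a
  ... | yes q = trans (at-yes l (isort v) q) (trans (cong (l ∷_) (isort-at v a)) (sym (at-yes l v q)))
  ... | no ne = trans (at-no l (isort v) ne) (trans (isort-at v a) (sym (at-no l v ne)))

∈-at⁻ : ∀ {n} {l : Label n} v {a} → l ∈ v at a → l ∈ v
∈-at⁻ v {a} i = proj₁ (∈-filterᵇ⁻ (λ x → lo x =F a) {xs = v} i)

-- Lets equations between sorted words be checked one spine at a time.
LoSorted-ext : ∀ {n} (v w : Word n) → LoSorted v → LoSorted w → (∀ a → v at a ≡ w at a) → v ≡ w
LoSorted-ext [] [] _ _ h = refl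
LoSorted-ext [] (y ∷ w) _ _ h with trans (h (lo y)) (at-yes y w refl)
... | ()
LoSorted-ext (x ∷ v) [] _ _ h with trans (sym (h (lo x))) (at-yes x v refl)
... | ()
LoSorted-ext (x ∷ v) (y ∷ w) sv@(_ ∷ sv′) sw@(_ ∷ sw′) h
  with ℕ.≤-antisym (head≤ x v y w sw h) (head≤ y w x v sv (sym ∘ h))
  where
  head≤ : ∀ x v y w → LoSorted (y ∷ w) → (∀ a → (x ∷ v) at a ≡ (y ∷ w) at a) → toℕ (lo y) ≤ toℕ (lo x)
  head≤ x v y w (g ∷ _) h
    with ∈-at⁻ (y ∷ w) (subst (x ∈_) (trans (sym (at-yes x v refl)) (h (lo x))) (here refl))
  ... | here refl = ℕ.≤-refl
  ... | there i = All.lookup g i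
... | e = cong₂ _∷_ x≡y (LoSorted-ext v w sv′ sw′ tails)
  where
  e′ : lo y ≡ lo x
  e′ = Fin.toℕ-injective e
  both : x ∷ (v at lo x) ≡ y ∷ (w at lo x)
  both = trans (sym (at-yes x v refl)) (trans (h (lo x)) (at-yes y w e′))
  x≡y : x ≡ y
  x≡y with both
  ... | q = cong (λ { (z ∷ _) → z ; [] → x }) q
  tails : ∀ a → v at a ≡ w at a
  tails a with lo x ≟ a
  ... | yes refl = cong (drop 1) both
  ... | no ne = trans (sym (at-no x v ne)) (trans (h a) (at-no y w (λ q → ne (trans (sym e′) q))))

-- Labels with a smaller first entry lie below `l` and are passed, those with a larger one stop it.
-- So the place of `l` is decided within its own spine.
insR-at-lo : ∀ {n} (l : Label n) v → LoSorted v → insR l v at lo l ≡ insR l (v at lo l)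
insR-at-lo l [] _ = at-yes l [] refl
insR-at-lo l (x ∷ v) (h ∷ s) with x ⊏? l | lo x ≟ lo l
... | yes p | yes q = begin
  insR l (x ∷ v) at lo l ≡⟨ cong (_at lo l) (insR-< v p) ⟩
  (x ∷ insR l v) at lo l ≡⟨ at-yes x (insR l v) q ⟩
  x ∷ (insR l v at lo l) ≡⟨ cong (x ∷_) (insR-at-lo l v s) ⟩
  x ∷ insR l (v at lo l) ≡⟨ insR-< (v at lo l) p ⟨
  insR l (x ∷ (v at lo l)) ≡⟨ cong (insR l) (at-yes x v q) ⟨
  insR l ((x ∷ v) at lo l) ∎
  where open ≡-Reasoning
... | yes p | no ne = begin
  insR l (x ∷ v) at lo l ≡⟨ cong (_at lo l) (insR-< v p) ⟩
  (x ∷ insR l v) at lo l ≡⟨ at-no x (insR l v) ne ⟩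
  insR l v at lo l ≡⟨ insR-at-lo l v s ⟩
  insR l (v at lo l) ≡⟨ cong (insR l) (at-no x v ne) ⟨
  insR l ((x ∷ v) at lo l) ∎
  where open ≡-Reasoning
... | no ¬p | yes q = begin
  insR l (x ∷ v) at lo l ≡⟨ cong (_at lo l) (insR-≮ v ¬p) ⟩
  (l ∷ x ∷ v) at lo l ≡⟨ at-yes l (x ∷ v) refl ⟩
  l ∷ ((x ∷ v) at lo l) ≡⟨ cong (l ∷_) (at-yes x v q) ⟩
  l ∷ x ∷ (v at lo l) ≡⟨ insR-≮ (v at lo l) ¬p ⟨
  insR l (x ∷ (v at lo l)) ≡⟨ cong (insR l) (at-yes x v q) ⟨
  insR l ((x ∷ v) at lo l) ∎
  where open ≡-Reasoning
... | no ¬p | no ne = begin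
  insR l (x ∷ v) at lo l ≡⟨ cong (_at lo l) (insR-≮ v ¬p) ⟩
  (l ∷ x ∷ v) at lo l ≡⟨ at-yes l (x ∷ v) refl ⟩
  l ∷ ((x ∷ v) at lo l) ≡⟨ cong (l ∷_) none ⟩
  insR l [] ≡⟨ cong (insR l) none ⟨
  insR l ((x ∷ v) at lo l) ∎
  where
  open ≡-Reasoning
  gt : toℕ (lo l) < toℕ (lo x)
  gt = ℕ.≤∧≢⇒< (ℕ.≮⇒≥ (¬p ∘ ⊏-lo)) (ne ∘ sym ∘ Fin.toℕ-injective)
  none : (x ∷ v) at lo l ≡ []
  none = at-none (x ∷ v) λ { (here refl) → ne
                           ; (there i) q → ℕ.<-irrefl (cong toℕ (sym q)) (ℕ.<-≤-trans gt (All.lookup h i)) }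

insR-at-≢ : ∀ {n} (l : Label n) v {a} → lo l ≢ a → insR l v at a ≡ v at a
insR-at-≢ l [] ne = at-no l [] ne
insR-at-≢ l (x ∷ v) {a} ne with x ⊏? l | lo x ≟ a
... | no ¬p | _ = trans (cong (_at a) (insR-≮ v ¬p)) (at-no l (x ∷ v) ne)
... | yes p | yes q = trans (cong (_at a) (insR-< v p)) (trans (at-yes x (insR l v) q)
    (trans (cong (x ∷_) (insR-at-≢ l v ne)) (sym (at-yes x v q))))
... | yes p | no nq = trans (cong (_at a) (insR-< v p)) (trans (at-no x (insR l v) nq)
    (trans (insR-at-≢ l v ne) (sym (at-no x v nq))))

insR-LoSorted : ∀ {n} (l : Label n) v → LoSorted v → LoSorted (insR l v)
insR-LoSorted l [] _ = [] ∷ []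
insR-LoSorted l (x ∷ v) (h ∷ s) with x ⊏? l
... | yes p = subst LoSorted (sym (insR-< v p))
    (Perm.All-resp-↭ (↭-sym (insR-↭ l v)) (⊏⇒lo≤ p ∷ h) ∷ insR-LoSorted l v s)
... | no ¬p = subst LoSorted (sym (insR-≮ v ¬p)) ((le ∷ All.map (ℕ.≤-trans le) h) ∷ h ∷ s)
  where
  le : toℕ (lo l) ≤ toℕ (lo x)
  le = ℕ.≮⇒≥ (¬p ∘ ⊏-lo)

Fall-at⇒Fall : ∀ {n} (v : Word n) → LoSorted v → (∀ a → Fall (v at a)) → Fall v
Fall-at⇒Fall [] _ _ = []
Fall-at⇒Fall (x ∷ []) _ _ = [-]
Fall-at⇒Fall (x ∷ y ∷ v) ((le ∷ _) ∷ s) F = first ∷ Fall-at⇒Fall (y ∷ v) s rest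
  where
  first : ¬ (y ⊏ x)
  first p with lo x ≟ lo y
  ... | no ne = ne (Fin.toℕ-injective (ℕ.≤-antisym le (⊏⇒lo≤ p)))
  ... | yes q with subst Fall (trans (at-yes x (y ∷ v) q) (cong (x ∷_) (at-yes y v refl))) (F (lo y))
  ... | ¬p ∷ _ = ¬p p
  rest : ∀ a → Fall ((y ∷ v) at a)
  rest a with lo x ≟ a
  ... | yes q = Linked.tail (subst Fall (at-yes x (y ∷ v) q) (F a))
  ... | no ne = subst Fall (at-no x (y ∷ v) ne) (F a)

-- A label `l′` stored after `l` satisfies `lo l ≤ lo l′ < hi l′`, so `lo l` has not been absorbed
-- when `l` is applied.
LoSorted⇒Val : ∀ {n} (v : Word n) → LoSorted v → (∀ {l} → l ∈ v → toℕ (lo l) < toℕ (hi l)) → Unique (his v) → Val v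
LoSorted⇒Val [] _ _ _ = tt
LoSorted⇒Val (l ∷ v) (h ∷ s) lt (u ∷ us) =
  (lt (here refl) , lo∉ , λ i → All.lookup u i refl) , LoSorted⇒Val v s (lt ∘ there) us
  where
  lo∉ : lo l ∉ his v
  lo∉ i with ∈-map⁻ hi i
  ... | l′ , j , e = ℕ.<-irrefl (cong toℕ e) (ℕ.≤-<-trans (All.lookup h j) (lt (there j)))

-- Words of forests

labelsF : ∀ {n} → Forest n → Word n
labelsF = concatMap labels

leavesF : ∀ {n} → Forest n → List (Fin n)
leavesF = concatMap leaves

wd : ∀ {n} → Forest n → Word n
wd F = isort (labelsF F)

Sorted : ∀ {n} → Forest n → Set
Sorted = AllPairs (λ s t → ν s < ν t)

record ValidF {n} (F : Forest n) : Set where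
  field
    sorted  : Sorted F
    lyndon  : All BL F
    leaves↭ : leavesF F ↭ allFin n
open ValidF

sortedν⁻ : ∀ {n} (F : Forest n) → T (sortedν F) → Sorted F
sortedν⁻ F t = Linked⇒AllPairs ℕ.<-trans (linked F t)
  where
  linked : ∀ F → T (sortedν F) → Linked (λ s t → ν s < ν t) F
  linked [] _ = []
  linked (s ∷ []) _ = [-]
  linked (s ∷ t ∷ F) h = ℕ.<ᵇ⇒< _ _ (∧-fst h) ∷ linked (t ∷ F) (∧-snd {ν s <ᵇ ν t} h)

sortedν⁺ : ∀ {n} {F : Forest n} → Sorted F → T (sortedν F)
sortedν⁺ [] = tt
sortedν⁺ ([] ∷ []) = tt
sortedν⁺ ((lt ∷ _) ∷ s@(_ ∷ _)) = ∧-intro (ℕ.<⇒<ᵇ lt) (sortedν⁺ s)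

validF⁻ : ∀ {n} (F : Forest n) → T (validF F) → ValidF F
validF⁻ {n} F t = record
  { sorted = sortedν⁻ F (∧-fst t)
  ; lyndon = All.tabulate (λ i → all⁻ isBLyndon {xs = F} (∧-fst t₁) i)
  ; leaves↭ = Unique⊆∧length≤⇒↭ (Unique.allFin⁺ n) covers
      (ℕ.≤-reflexive (trans (ℕ.≡ᵇ⇒≡ _ _ (∧-fst t₂)) (sym (length-tabulate {n = n} id)))) }
  where
  t₁ = ∧-snd {sortedν F} t
  t₂ = ∧-snd {all isBLyndon F} t₁
  t₃ = ∧-snd {length (leavesF F) ≡ᵇ n} t₂
  covers : ∀ {i} → i ∈ allFin n → i ∈ leavesF F
  covers {i} j with any⁻ (λ k → i =F k) (leavesF F) (all⁻ (λ i → any (λ k → i =F k) (leavesF F)) t₃ j)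
  ... | k , m , e = subst (_∈ leavesF F) (sym (=F-sound e)) m

validF⁺ : ∀ {n} {F : Forest n} → ValidF F → T (validF F)
validF⁺ {n} {F} V = ∧-intro (sortedν⁺ (sorted V)) (∧-intro (all⁺ isBLyndon F (All.lookup (lyndon V)))
  (∧-intro (ℕ.≡⇒≡ᵇ _ _ (trans (Perm.↭-length (leaves↭ V)) (length-tabulate {n = n} id)))
    (all⁺ _ (allFin n) λ {i} j → any⁺ (λ k → i =F k) (Perm.∈-resp-↭ (↭-sym (leaves↭ V)) j) (=F-refl i))))

concatMap-↭ : ∀ {A B : Set} (f : A → List B) {xs ys} → xs ↭ ys → concatMap f xs ↭ concatMap f ys
concatMap-↭ f prefl = ↭-refl
concatMap-↭ f (prep x p) = Perm.++⁺ˡ (f x) (concatMap-↭ f p)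
concatMap-↭ f (swap x y p) = ↭-trans (Perm.shifts (f x) (f y)) (Perm.++⁺ˡ (f y) (Perm.++⁺ˡ (f x) (concatMap-↭ f p)))
concatMap-↭ f (ptrans p q) = ↭-trans (concatMap-↭ f p) (concatMap-↭ f q)

labelsF⊆leavesF : ∀ {n} (F : Forest n) {l} → l ∈ labelsF F → lo l ∈ leavesF F
labelsF⊆leavesF (t ∷ F) i with ∈-++⁻ (labels t) i
... | inj₁ j = ∈-++⁺ˡ (proj₁ (labels⊆leaves t j))
... | inj₂ j = ∈-++⁺ʳ (leaves t) (labelsF⊆leavesF F j)

∈⇒leavesF : ∀ {n} {F : Forest n} {t i} → t ∈ F → i ∈ leaves t → i ∈ leavesF F
∈⇒leavesF {F = t ∷ F} (here refl) j = ∈-++⁺ˡ j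
∈⇒leavesF {F = t ∷ F} (there m) j = ∈-++⁺ʳ (leaves t) (∈⇒leavesF m j)

Unique-leaves : ∀ {n} {F : Forest n} {t} → Unique (leavesF F) → t ∈ F → Unique (leaves t)
Unique-leaves {F = t ∷ F} u (here refl) = proj₁ (Unique-++⁻ (leaves t) u)
Unique-leaves {F = t ∷ F} u (there m) = Unique-leaves (proj₁ (proj₂ (Unique-++⁻ (leaves t) u))) m

Unique-leavesF : ∀ {n} {F : Forest n} → ValidF F → Unique (leavesF F)
Unique-leavesF {n} V = Unique-resp-↭ (↭-sym (leaves↭ V)) (Unique.allFin⁺ n)

roots-his : ∀ {n} (F : Forest n) → map νF F ++ his (labelsF F) ↭ leavesF F
roots-his [] = ↭-refl
roots-his (t ∷ F) = ↭-trans (prep (νF t) (↭-trans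
    (Perm.++⁺ˡ (map νF F) (↭-reflexive (map-++ hi (labels t) (labelsF F))))
    (Perm.shifts (map νF F) (his (labels t)))))
  (Perm.++⁺ (his-leaves t) (roots-his F))

labelsF-none : ∀ {n} (F : Forest n) {a} → a ∉ leavesF F → labelsF F at a ≡ []
labelsF-none F a∉ = at-none (labelsF F) (λ { i refl → a∉ (labelsF⊆leavesF F i) })

labelsF-at : ∀ {n} (t : Tree n) F {a} → labelsF (t ∷ F) at a ≡ (labels t at a) ++ (labelsF F at a)
labelsF-at t F = at-++ (labels t) (labelsF F)

labelsF-Fall : ∀ {n} (F : Forest n) → All BL F → Unique (leavesF F) → ∀ a → Fall (labelsF F at a)
labelsF-Fall [] _ _ a = []
labelsF-Fall (t ∷ F) (b ∷ bs) u a with Unique-++⁻ (leaves t) u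
... | ut , uF , d with at-either (labels t) (labelsF F) a
      (λ i j e → d (proj₁ (labels⊆leaves t i)) (subst (_∈ leavesF F) (sym e) (labelsF⊆leavesF F j)))
... | inj₁ e = subst Fall (sym e) (labels-Fall t b ut a)
... | inj₂ e = subst Fall (sym e) (labelsF-Fall F bs uF a)

labelsF-lo<hi : ∀ {n} (F : Forest n) → All BL F → Unique (leavesF F) →
  ∀ {l} → l ∈ labelsF F → toℕ (lo l) < toℕ (hi l)
labelsF-lo<hi (t ∷ F) (b ∷ bs) u i with Unique-++⁻ (leaves t) u | ∈-++⁻ (labels t) i
... | ut , _ , _ | inj₁ j = labels-lo<hi t b ut j
... | _ , uF , _ | inj₂ j = labelsF-lo<hi F bs uF j

his-wd : ∀ {n} (F : Forest n) → his (wd F) ↭ his (labelsF F)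
his-wd F = Perm.map⁺ hi (isort-↭ (labelsF F))

-- Every point is either the least leaf of a tree or the second entry of one label, and never both.
-- Hence the trees correspond to the points outside `his (wd F)`, the block minima.
roots-his-wd : ∀ {n} {F : Forest n} → ValidF F → map νF F ++ his (wd F) ↭ allFin n
roots-his-wd {F = F} V = ↭-trans (Perm.++⁺ˡ (map νF F) (his-wd F)) (↭-trans (roots-his F) (leaves↭ V))

Unique-roots-his : ∀ {n} {F : Forest n} → ValidF F → Unique (map νF F ++ his (wd F))
Unique-roots-his {n} V = Unique-resp-↭ (↭-sym (roots-his-wd V)) (Unique.allFin⁺ n)

wd-Val : ∀ {n} {F : Forest n} → ValidF F → Val (wd F)
wd-Val {F = F} V = LoSorted⇒Val (wd F) (isort-LoSorted (labelsF F))
  (λ i → labelsF-lo<hi F (lyndon V) (Unique-leavesF V) (Perm.∈-resp-↭ (isort-↭ (labelsF F)) i))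
  (proj₁ (proj₂ (Unique-++⁻ (map νF F) (Unique-roots-his V))))

wd-Fall : ∀ {n} {F : Forest n} → ValidF F → Fall (wd F)
wd-Fall {F = F} V = Fall-at⇒Fall (wd F) (isort-LoSorted (labelsF F))
  λ a → subst Fall (sym (isort-at (labelsF F) a)) (labelsF-Fall F (lyndon V) (Unique-leavesF V) a)

root⇒∉his : ∀ {n} {F : Forest n} → ValidF F → ∀ {c} → c ∈ map νF F → c ∉ his (wd F)
root⇒∉his {F = F} V = proj₂ (proj₂ (Unique-++⁻ (map νF F) (Unique-roots-his V)))

∉his⇒root : ∀ {n} {F : Forest n} → ValidF F → ∀ {c} → c ∉ his (wd F) → c ∈ map νF F
∉his⇒root {F = F} V {c} c∉ with ∈-++⁻ (map νF F) (Perm.∈-resp-↭ (↭-sym (roots-his-wd V)) (∈-allFin c))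
... | inj₁ i = i
... | inj₂ i = ⊥-elim (c∉ i)

-- A spine lies in a single tree, so the order of the trees does not show in it.
labelsF-at-↭ : ∀ {n} {F G : Forest n} → F ↭ G → Unique (leavesF F) → ∀ a → labelsF F at a ≡ labelsF G at a
labelsF-at-↭ prefl u a = refl
labelsF-at-↭ {F = t ∷ F} {_ ∷ G} (prep t p) u a =
  trans (labelsF-at t F) (trans (cong ((labels t at a) ++_)
    (labelsF-at-↭ p (proj₁ (proj₂ (Unique-++⁻ (leaves t) u))) a)) (sym (labelsF-at t G)))
labelsF-at-↭ {F = _ ∷ _ ∷ F} {_ ∷ _ ∷ G} (swap s t p) u a with Unique-++⁻ (leaves s) u
... | us , utF , d with Unique-++⁻ (leaves t) utF
... | ut , uF , d′ = begin
  labelsF (s ∷ t ∷ F) at a ≡⟨ trans (labelsF-at s (t ∷ F)) (cong (S ++_) (labelsF-at t F)) ⟩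
  S ++ U ++ (labelsF F at a) ≡⟨ cong (λ w → S ++ U ++ w) (labelsF-at-↭ p uF a) ⟩
  S ++ U ++ W ≡⟨ ++-assoc S U W ⟨
  (S ++ U) ++ W ≡⟨ cong (_++ W) commute ⟩
  (U ++ S) ++ W ≡⟨ ++-assoc U S W ⟩
  U ++ S ++ W ≡⟨ trans (labelsF-at t (s ∷ G)) (cong (U ++_) (labelsF-at s G)) ⟨
  labelsF (t ∷ s ∷ G) at a ∎
  where
  open ≡-Reasoning
  S = labels s at a
  U = labels t at a
  W = labelsF G at a
  commute : S ++ U ≡ U ++ S
  commute with Any.any? (a ≟_) (leaves s)
  ... | no a∉ = trans (cong (_++ U) (labels-none s a∉))
                  (trans (sym (++-identityʳ U)) (cong (U ++_) (sym (labels-none s a∉))))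
  ... | yes a∈ = trans (cong (S ++_) none) (trans (++-identityʳ S) (cong (_++ S) (sym none)))
    where
    none : U ≡ []
    none = labels-none t (λ i → d a∈ (∈-++⁺ˡ i))
labelsF-at-↭ (ptrans p q) u a =
  trans (labelsF-at-↭ p u a) (labelsF-at-↭ q (Unique-resp-↭ (concatMap-↭ leaves p) u) a)

insertν-↭ : ∀ {n} (t : Tree n) F → insertν t F ↭ t ∷ F
insertν-↭ t [] = ↭-refl
insertν-↭ t (s ∷ F) with T? (ν t <ᵇ ν s)
... | yes p = ↭-reflexive (if-yes p)
... | no ¬p = ↭-trans (↭-reflexive (if-no ¬p)) (↭-trans (prep s (insertν-↭ t F)) (swap s t ↭-refl))

insertν-Sorted : ∀ {n} (t : Tree n) {F} → Sorted F → (∀ {s} → s ∈ F → ν t ≢ ν s) → Sorted (insertν t F)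
insertν-Sorted t [] _ = [] ∷ []
insertν-Sorted t {s ∷ F} (h ∷ so) ne with T? (ν t <ᵇ ν s)
... | yes p = subst Sorted (sym (if-yes p))
  ((ℕ.<ᵇ⇒< _ _ p ∷ All.map (ℕ.<-trans (ℕ.<ᵇ⇒< _ _ p)) h) ∷ h ∷ so)
... | no ¬p = subst Sorted (sym (if-no ¬p))
  (Perm.All-resp-↭ (↭-sym (insertν-↭ t F))
     (ℕ.≤∧≢⇒< (ℕ.≮⇒≥ (¬p ∘ ℕ.<⇒<ᵇ)) (ne (here refl) ∘ sym) ∷ h)
   ∷ insertν-Sorted t so (ne ∘ there))

module UMerge {n} {F : Forest n} (V : ValidF F) (u : Fin 2) {X Y : Tree n} {rest : Forest n}
  (p : F ↭ X ∷ Y ∷ rest) (lt : ν X < ν Y) (so : Sorted rest) where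
  private
    Z = ins u X Y
    G = insertν (umerge u X Y) rest
    l = rootLabel u X Y
    bls : All BL (X ∷ Y ∷ rest)
    bls = Perm.All-resp-↭ p (lyndon V)
    bX = All.head bls
    bY = All.head (All.tail bls)
    uAll : Unique (leaves X ++ leaves Y ++ leavesF rest)
    uAll = Unique-resp-↭ (concatMap-↭ leaves p) (Unique-leavesF V)
    uX = proj₁ (Unique-++⁻ (leaves X) uAll)
    uYr = Unique-++⁻ (leaves Y) (proj₁ (proj₂ (Unique-++⁻ (leaves X) uAll)))
    dX : ∀ {i} → i ∈ leaves X → i ∉ leaves Y ++ leavesF rest
    dX = proj₂ (proj₂ (Unique-++⁻ (leaves X) uAll))
    dXY : Disjoint X Y
    dXY i j = dX i (∈-++⁺ˡ j)
    merged : umerge u X Y ≡ Z × BL Z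
    merged = umerge-ins u X Y bX bY (ℕ.<⇒≤ lt) dXY
    G-↭ : G ↭ Z ∷ rest
    G-↭ = ↭-trans (↭-reflexive (cong (λ t → insertν t rest) (proj₁ merged))) (insertν-↭ Z rest)
    leaves-↭ : leaves Z ++ leavesF rest ↭ leaves X ++ leaves Y ++ leavesF rest
    leaves-↭ = ↭-trans (Perm.++⁺ʳ (leavesF rest) (leaves-ins u X Y))
                 (↭-reflexive (++-assoc (leaves X) (leaves Y) (leavesF rest)))
    uZ : Unique (leaves Z ++ leavesF rest)
    uZ = Unique-resp-↭ (↭-sym leaves-↭) uAll

  merged-valid : ValidF G
  merged-valid = record
    { sorted = subst (λ t → Sorted (insertν t rest)) (sym (proj₁ merged)) (insertν-Sorted Z so
        λ {s} m → Disjoint⇒ν≢ Z s (λ i j → proj₂ (proj₂ (Unique-++⁻ (leaves Z) uZ)) i (∈⇒leavesF m j)))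
    ; lyndon = Perm.All-resp-↭ (↭-sym G-↭) (proj₂ merged ∷ All.tail (All.tail bls))
    ; leaves↭ = ↭-trans (concatMap-↭ leaves G-↭) (↭-trans leaves-↭
        (↭-trans (↭-sym (concatMap-↭ leaves p)) (leaves↭ V))) }

  -- Both words are sorted, so spines can be compared: the one above `νF X` receives the new label
  -- and all others are unchanged.
  wd-merged : wd G ≡ insR l (wd F)
  wd-merged = LoSorted-ext (wd G) (insR l (wd F)) (isort-LoSorted (labelsF G))
      (insR-LoSorted l (wd F) (isort-LoSorted (labelsF F))) pointwise
    where
    open ≡-Reasoning
    before : ∀ a → wd F at a ≡ (labels X at a) ++ (labels Y at a) ++ (labelsF rest at a)
    before a = trans (isort-at (labelsF F) a) (trans (labelsF-at-↭ p (Unique-leavesF V) a)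
      (trans (labelsF-at X (Y ∷ rest)) (cong ((labels X at a) ++_) (labelsF-at Y rest))))
    after : ∀ a → wd G at a ≡ (labels Z at a) ++ (labelsF rest at a)
    after a = trans (isort-at (labelsF G) a) (trans (labelsF-at-↭ G-↭
      (Unique-resp-↭ (↭-sym (concatMap-↭ leaves G-↭)) uZ) a) (labelsF-at Z rest))
    pointwise : ∀ a → wd G at a ≡ insR l (wd F) at a
    pointwise a with νF X ≟ a
    ... | yes refl = begin
      wd G at a ≡⟨ after a ⟩
      (labels Z at a) ++ (labelsF rest at a) ≡⟨ cong ((labels Z at a) ++_) rest-none ⟩
      (labels Z at a) ++ [] ≡⟨ ++-identityʳ _ ⟩
      labels Z at a ≡⟨ labels-ins-at u Y bY X bX uX dXY ⟩
      insR l (labels X at a) ≡⟨ cong (insR l) (trans (before a) (trans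
          (cong₂ (λ s t → (labels X at a) ++ s ++ t) (labels-none Y (dXY root)) rest-none) (++-identityʳ _))) ⟨
      insR l (wd F at a) ≡⟨ insR-at-lo l (wd F) (isort-LoSorted (labelsF F)) ⟨
      insR l (wd F) at a ∎
      where
      root = νF∈leaves X
      rest-none : labelsF rest at νF X ≡ []
      rest-none = labelsF-none rest (λ j → dX root (∈-++⁺ʳ (leaves Y) j))
    ... | no ne = begin
      wd G at a ≡⟨ after a ⟩
      (labels Z at a) ++ (labelsF rest at a) ≡⟨ cong (_++ (labelsF rest at a)) (labels-ins-off u Y bY X uX dXY ne) ⟩
      ((labels X at a) ++ (labels Y at a)) ++ (labelsF rest at a) ≡⟨ ++-assoc (labels X at a) (labels Y at a) (labelsF rest at a) ⟩
      (labels X at a) ++ (labels Y at a) ++ (labelsF rest at a) ≡⟨ before a ⟨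
      wd F at a ≡⟨ insR-at-≢ l (wd F) ne ⟨
      insR l (wd F) at a ∎

-- Covers of forests as insertions

picks-sound : ∀ {A : Set} {R : A → A → Set} (xs : List A) {y rest} → (y , rest) ∈ picks xs → AllPairs R xs →
  xs ↭ y ∷ rest × AllPairs R rest
picks-sound (x ∷ xs) (here refl) (h ∷ s) = ↭-refl , s
picks-sound (x ∷ xs) (there i) (h ∷ s) with ∈-map⁻ _ i
... | (y , rest) , j , refl with picks-sound xs j s
... | p , s′ = ↭-trans (prep x p) (swap x y ↭-refl) , All.tail (Perm.All-resp-↭ p h) ∷ s′

picks-complete : ∀ {A : Set} {xs : List A} {y} → y ∈ xs → ∃ λ rest → (y , rest) ∈ picks xs
picks-complete {xs = x ∷ xs} (here refl) = xs , here refl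
picks-complete {xs = x ∷ xs} (there i) with picks-complete i
... | rest , j = x ∷ rest , there (∈-map⁺ _ j)

pairs-sound : ∀ {A : Set} {R : A → A → Set} (xs : List A) {a b rest} → (a , b , rest) ∈ pairs xs → AllPairs R xs →
  xs ↭ a ∷ b ∷ rest × R a b × AllPairs R rest
pairs-sound (x ∷ xs) i (h ∷ s) with ∈-++⁻ (map _ (picks xs)) i
... | inj₁ j with ∈-map⁻ _ j
... | (y , rest) , k , refl with picks-sound xs k s
... | p , s′ = prep x p , All.head (Perm.All-resp-↭ p h) , s′
pairs-sound (x ∷ xs) i (h ∷ s) | inj₂ j with ∈-map⁻ _ j
... | (a , b , rest) , k , refl with pairs-sound xs k s
... | p , r , s′ = ↭-trans (prep x p) (↭-trans (swap x a ↭-refl) (prep a (swap x b ↭-refl)))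
  , r , All.tail (All.tail (Perm.All-resp-↭ p h)) ∷ s′

-- An unordered pair of positions is listed once, in list order. Asymmetry of `R` shows that this is
-- the orientation asked for.
pairs-complete : ∀ {A : Set} {R : A → A → Set} → (∀ {x y} → R x y → ¬ R y x) → ∀ {xs : List A} {a b} →
  AllPairs R xs → a ∈ xs → b ∈ xs → R a b → ∃ λ rest → (a , b , rest) ∈ pairs xs
pairs-complete asym {x ∷ xs} s (here refl) (here refl) r = ⊥-elim (asym r r)
pairs-complete asym {x ∷ xs} s (here refl) (there j) r with picks-complete j
... | rest , k = rest , ∈-++⁺ˡ (∈-map⁺ _ k)
pairs-complete asym {x ∷ xs} (h ∷ s) (there i) (here refl) r = ⊥-elim (asym r (All.lookup h i))
pairs-complete asym {x ∷ xs} (h ∷ s) (there i) (there j) r with pairs-complete asym s i j r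
... | rest , k = x ∷ rest , ∈-++⁺ʳ (map _ (picks xs)) (∈-map⁺ _ k)

coverF⁻ : ∀ {n} {F G : Forest n} → ValidF F → T (coverF F G) →
  ∃ λ l → app l (wd F) × wd G ≡ insR l (wd F) × ValidF G
coverF⁻ {n} {F} {G} V t with any⁻ _ (pairs F) t
... | (X , Y , rest) , i , t′ with any⁻ _ (allFin 2) t′ | pairs-sound F i (sorted V)
... | u , _ , e | p , lt , so = rootLabel u X Y , (lo<hi , root∉ X (here refl) , root∉ Y (there (here refl)))
    , trans (cong wd G≡) M.wd-merged , subst ValidF (sym G≡) M.merged-valid
  where
  module M = UMerge V u p lt so
  G≡ : G ≡ insertν (umerge u X Y) rest
  G≡ = trans (listEq-sound treeEq-sound e)
         (cong (λ t → insertν t rest) (if-yes {y = umerge u Y X} (ℕ.<⇒<ᵇ lt)))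
  bl : ∀ {t} → t ∈ X ∷ Y ∷ rest → BL t
  bl i = All.lookup (lyndon V) (Perm.∈-resp-↭ (↭-sym p) i)
  lo<hi : toℕ (νF X) < toℕ (νF Y)
  lo<hi = subst₂ _<_ (sym (toℕ-νF X (bl (here refl)))) (sym (toℕ-νF Y (bl (there (here refl))))) lt
  root∉ : ∀ t → t ∈ X ∷ Y ∷ rest → νF t ∉ his (wd F)
  root∉ t i = root⇒∉his V (∈-map⁺ νF (Perm.∈-resp-↭ (↭-sym p) i))

coverF⁺ : ∀ {n} {F : Forest n} → ValidF F → ∀ l → app l (wd F) →
  ∃ λ G → T (coverF F G) × wd G ≡ insR l (wd F) × ValidF G
coverF⁺ {n} {F} V l@(a , b , u) (lt , a∉ , b∉)
  with ∈-map⁻ νF (∉his⇒root V a∉) | ∈-map⁻ νF (∉his⇒root V b∉)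
... | X , i , refl | Y , j , refl
  with pairs-complete (λ p q → ℕ.<-asym p q) (sorted V) i j ν<
  where
  ν< : ν X < ν Y
  ν< = subst₂ _<_ (toℕ-νF X (All.lookup (lyndon V) i)) (toℕ-νF Y (All.lookup (lyndon V) j)) lt
... | rest , k with pairs-sound F k (sorted V)
... | p , ν< , so = insertν (umerge u X Y) rest
    , any⁺ _ k (any⁺ (λ v → listEq treeEq (insertν (umerge u X Y) rest)
          (insertν (if ν X <ᵇ ν Y then umerge v X Y else umerge v Y X) rest)) (∈-allFin u)
        (subst (λ t → T (listEq treeEq (insertν (umerge u X Y) rest) (insertν t rest)))
          (sym (if-yes {y = umerge u Y X} (ℕ.<⇒<ᵇ ν<))) (listEq-refl treeEq-refl (insertν (umerge u X Y) rest))))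
    , M.wd-merged , M.merged-valid
  where module M = UMerge V u p ν< so

-- Forests and ascent-free chains

-- A tree is recovered from its labels: the labels with first entry a are the left spine above leaf a.
grow build : ∀ {n} → (Fin n → Word n) → ℕ → Fin n → Word n → Tree n
grow W f a []      = leaf a
grow W f a (l ∷ v) = node (tint l) (grow W f a v) (build W f (hi l) (W (hi l)))
build W zero    a v = leaf a
build W (suc f) a v = grow W f a v

leaves-nonempty : ∀ {n} (t : Tree n) → 1 ≤ length (leaves t)
leaves-nonempty t = ∈-length (νF∈leaves t)

-- The spine of the root is a separate argument because it shrinks while the recursion goes to left
-- children; `W` holds the complete spines of the other leaves. A right subtree has fewer leaves
-- than the tree, which pays for the fuel.
rebuild : ∀ {n} (W : Fin n → Word n) f t → Unique (leaves t) → length (leaves t) ≤ suc f →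
  (∀ {c} → c ∈ leaves t → c ≢ νF t → labels t at c ≡ W c) → t ≡ grow W f (νF t) (labels t at νF t)
rebuild W f (leaf i) _ _ _ = refl
rebuild {n} W f (node u L R) un le h with Unique-++⁻ (leaves L) un
... | uL , uR , d = begin
  node u L R ≡⟨ cong₂ (node u) ihL (right f le) ⟩
  grow W f a (x ∷ (labels L at a)) ≡⟨ cong (λ w → grow W f a (x ∷ w)) (sym at-a) ⟩
  grow W f a (x ∷ ((labels L ++ labels R) at a)) ≡⟨ cong (grow W f a) (at-yes x (labels L ++ labels R) refl) ⟨
  grow W f a (labels (node u L R) at a) ∎
  where
  open ≡-Reasoning
  a = νF L
  x = rootLabel u L R
  len : length (leaves L) + length (leaves R) ≤ suc f
  len = ℕ.≤-trans (ℕ.≤-reflexive (sym (length-++ (leaves L)))) le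
  at-a : (labels L ++ labels R) at a ≡ labels L at a
  at-a = trans (at-++ (labels L) (labels R))
    (trans (cong ((labels L at a) ++_) (labels-none R (d (νF∈leaves L)))) (++-identityʳ _))
  ihL : L ≡ grow W f a (labels L at a)
  ihL = rebuild W f L uL (ℕ.≤-trans (ℕ.m≤m+n _ _) len) λ {c} i ne → begin
    labels L at c ≡⟨ ++-identityʳ _ ⟨
    (labels L at c) ++ [] ≡⟨ cong ((labels L at c) ++_) (labels-none R (d i)) ⟨
    (labels L at c) ++ (labels R at c) ≡⟨ at-++ (labels L) (labels R) ⟨
    (labels L ++ labels R) at c ≡⟨ at-no x (labels L ++ labels R) (ne ∘ sym) ⟨
    labels (node u L R) at c ≡⟨ h (∈-++⁺ˡ i) ne ⟩
    W c ∎
  atR : ∀ {c} → c ∈ leaves R → labels R at c ≡ W c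
  atR {c} i = begin
    labels R at c ≡⟨ cong (_++ (labels R at c)) (labels-none L (λ j → d j i)) ⟨
    (labels L at c) ++ (labels R at c) ≡⟨ at-++ (labels L) (labels R) ⟨
    (labels L ++ labels R) at c ≡⟨ at-no x (labels L ++ labels R) (λ e → d (νF∈leaves L) (subst (_∈ leaves R) (sym e) i)) ⟨
    labels (node u L R) at c ≡⟨ h (∈-++⁺ʳ (leaves L) i) (λ e → d (νF∈leaves L) (subst (_∈ leaves R) e i)) ⟩
    W c ∎
  right : ∀ f → length (leaves (node u L R)) ≤ suc f → R ≡ build W f (νF R) (W (νF R))
  right f le with ℕ.≤-trans (ℕ.+-mono-≤ (leaves-nonempty L) (leaves-nonempty R))
                     (ℕ.≤-trans (ℕ.≤-reflexive (sym (length-++ (leaves L)))) le)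
  right (suc f) le | _ = trans
    (rebuild W f R uR (ℕ.≤-pred (ℕ.≤-trans (ℕ.+-monoˡ-≤ _ (leaves-nonempty L))
        (ℕ.≤-trans (ℕ.≤-reflexive (sym (length-++ (leaves L)))) le))) (λ i _ → atR i))
    (cong (grow W f (νF R)) (atR (νF∈leaves R)))
  right zero le | s≤s ()

StrictlySorted : ∀ {n} → List (Fin n) → Set
StrictlySorted = AllPairs (λ i j → toℕ i < toℕ j)

StrictlySorted-ext : ∀ {n} (xs ys : List (Fin n)) → StrictlySorted xs → StrictlySorted ys →
  (∀ {c} → c ∈ xs → c ∈ ys) → (∀ {c} → c ∈ ys → c ∈ xs) → xs ≡ ys
StrictlySorted-ext [] [] _ _ _ _ = refl
StrictlySorted-ext [] (y ∷ ys) _ _ _ t with t (here refl)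
... | ()
StrictlySorted-ext (x ∷ xs) [] _ _ s _ with s (here refl)
... | ()
StrictlySorted-ext (x ∷ xs) (y ∷ ys) (h ∷ sx) (g ∷ sy) s t
  with Fin.toℕ-injective (ℕ.≤-antisym (le h (t (here refl))) (le g (s (here refl))))
  where
  le : ∀ {x y xs} → All (λ j → toℕ x < toℕ j) xs → y ∈ x ∷ xs → toℕ x ≤ toℕ y
  le h (here refl) = ℕ.≤-refl
  le h (there i) = ℕ.<⇒≤ (All.lookup h i)
... | refl = cong (x ∷_) (StrictlySorted-ext xs ys sx sy (drop-head h s) (drop-head g t))
  where
  drop-head : ∀ {xs ys} → All (λ j → toℕ x < toℕ j) xs → (∀ {c} → c ∈ x ∷ xs → c ∈ x ∷ ys) →
    ∀ {c} → c ∈ xs → c ∈ ys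
  drop-head h s i with s (there i)
  ... | here refl = ⊥-elim (ℕ.<-irrefl refl (All.lookup h i))
  ... | there j = j

roots-StrictlySorted : ∀ {n} (F : Forest n) → Sorted F → All BL F → StrictlySorted (map νF F)
roots-StrictlySorted [] _ _ = []
roots-StrictlySorted (t ∷ F) (h ∷ s) (b ∷ bs) =
  All.tabulate (λ i → let y , j , e = ∈-map⁻ νF i in
    subst₂ _<_ (sym (toℕ-νF t b)) (trans (sym (toℕ-νF y (All.lookup bs j))) (cong toℕ (sym e))) (All.lookup h j))
  ∷ roots-StrictlySorted F s bs

labelsF-at-∈ : ∀ {n} {F : Forest n} {t c} → Unique (leavesF F) → t ∈ F → c ∈ leaves t →
  labelsF F at c ≡ labels t at c
labelsF-at-∈ {F = t ∷ F} u (here refl) i = trans (labelsF-at t F)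
  (trans (cong ((labels t at _) ++_) (labelsF-none F (proj₂ (proj₂ (Unique-++⁻ (leaves t) u)) i))) (++-identityʳ _))
labelsF-at-∈ {F = s ∷ F} u (there m) i with Unique-++⁻ (leaves s) u
... | _ , uF , d = trans (labelsF-at s F)
  (trans (cong (_++ (labelsF F at _)) (labels-none s (λ j → d j (∈⇒leavesF m i)))) (labelsF-at-∈ uF m i))

length-leaves≤ : ∀ {n} {F : Forest n} {t} → t ∈ F → length (leaves t) ≤ length (leavesF F)
length-leaves≤ {F = t ∷ F} (here refl) = ℕ.≤-trans (ℕ.m≤m+n _ _) (ℕ.≤-reflexive (sym (length-++ (leaves t))))
length-leaves≤ {F = s ∷ F} (there m) =
  ℕ.≤-trans (length-leaves≤ m) (ℕ.≤-trans (ℕ.m≤n+m _ _) (ℕ.≤-reflexive (sym (length-++ (leaves s)))))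

length-leavesF : ∀ {n} {F : Forest n} → ValidF F → length (leavesF F) ≡ n
length-leavesF {n} V = trans (Perm.↭-length (leaves↭ V)) (length-tabulate {n = n} id)

forest-from-wd : ∀ {n} {F : Forest n} → ValidF F →
  F ≡ map (λ a → grow (wd F at_) n a (wd F at a)) (map νF F)
forest-from-wd {n} {F} V = go F id
  where
  tree : ∀ {t} → t ∈ F → t ≡ grow (wd F at_) n (νF t) (wd F at νF t)
  tree {t} m = trans
    (rebuild (wd F at_) n t (Unique-leaves (Unique-leavesF V) m)
      (ℕ.m≤n⇒m≤1+n (ℕ.≤-trans (length-leaves≤ m) (ℕ.≤-reflexive (length-leavesF V)))) (λ i _ → at-t i))
    (cong (grow (wd F at_) n (νF t)) (at-t (νF∈leaves t)))
    where
    at-t : ∀ {c} → c ∈ leaves t → labels t at c ≡ wd F at c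
    at-t {c} i = trans (sym (labelsF-at-∈ (Unique-leavesF V) m i)) (sym (isort-at (labelsF F) c))
  go : ∀ G → (∀ {t} → t ∈ G → t ∈ F) → G ≡ map (λ a → grow (wd F at_) n a (wd F at a)) (map νF G)
  go [] _ = refl
  go (t ∷ G) s = cong₂ _∷_ (tree (s (here refl))) (go G (s ∘ there))

wd-injective : ∀ {n} {F G : Forest n} → ValidF F → ValidF G → wd F ≡ wd G → F ≡ G
wd-injective {n} {F} {G} V V′ e = begin
  F ≡⟨ forest-from-wd V ⟩
  map (λ a → grow (wd F at_) n a (wd F at a)) (map νF F) ≡⟨ cong₂ (λ w → map (λ a → grow (w at_) n a (w at a))) e roots ⟩
  map (λ a → grow (wd G at_) n a (wd G at a)) (map νF G) ≡⟨ forest-from-wd V′ ⟨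
  G ∎
  where
  open ≡-Reasoning
  -- The word determines the roots as the points that are no second entry, and a forest lists them
  -- in increasing order.
  roots : map νF F ≡ map νF G
  roots = StrictlySorted-ext _ _ (roots-StrictlySorted F (sorted V) (lyndon V)) (roots-StrictlySorted G (sorted V′) (lyndon V′))
    (λ i → ∉his⇒root V′ (subst (λ w → _ ∉ his w) e (root⇒∉his V i)))
    (λ i → ∉his⇒root V (subst (λ w → _ ∉ his w) (sym e) (root⇒∉his V′ i)))

botF : ∀ n → Forest n
botF n = map leaf (allFin n)

labelsF-leaf : ∀ {n} (is : List (Fin n)) → labelsF (map leaf is) ≡ []
labelsF-leaf [] = refl
labelsF-leaf (i ∷ is) = labelsF-leaf is

leavesF-leaf : ∀ {n} (is : List (Fin n)) → leavesF (map leaf is) ≡ is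
leavesF-leaf [] = refl
leavesF-leaf (i ∷ is) = cong (i ∷_) (leavesF-leaf is)

wd-bot : ∀ n → wd (botF n) ≡ []
wd-bot n = cong isort (labelsF-leaf (allFin n))

botF-valid : ∀ n → ValidF (botF n)
botF-valid n = record
  { sorted = AllPairs.map⁺ (AllPairs.tabulate⁺-< id)
  ; lyndon = All.tabulate (λ i → leafBL (∈-map⁻ leaf i))
  ; leaves↭ = ↭-reflexive (leavesF-leaf (allFin n)) }
  where
  leafBL : ∀ {t : Tree n} → (∃ λ i → i ∈ allFin n × t ≡ leaf i) → BL t
  leafBL (i , _ , refl) = tt

-- Inserting the latest label of a falling word just puts it in front. So the labels, applied one by
-- one, trace a saturated chain of forests, which also serves for the grading.
wd-surjective : ∀ {n} (v : Word n) → Val v → Fall v →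
  ∃ λ F → ValidF F × wd F ≡ v × Reach (FLynW n) (length v) (botF n) F
wd-surjective {n} [] _ _ = botF n , botF-valid n , wd-bot n , refl
wd-surjective (l ∷ v) (A , V) Fa with wd-surjective v V (Linked.tail Fa)
... | F , VF , refl , r with coverF⁺ VF l A
... | G , c , e , VG = G , VG , trans e (insR-Fall Fa) ,
  Reach-snoc {FLynW _} (length v) r (validF⁺ VG) c

listVec : ∀ {A : Set} {as : List A} (xs : List A) → (∀ {x} → x ∈ xs → x ∈ as) →
  ∃ λ v → v ∈ allVecs as (length xs) × Vec.toList v ≡ xs
listVec [] h = Vec.[] , here refl , refl
listVec (x ∷ xs) h with listVec xs (h ∘ there)
... | v , i , e = x Vec.∷ v , ∈-cartesianProductWith⁺ Vec._∷_ (h (here refl)) i , cong (x ∷_) e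

allListsBelow-complete : ∀ {A : Set} {as : List A} {m} (xs : List A) → length xs < m →
  (∀ {x} → x ∈ xs → x ∈ as) → xs ∈ allListsBelow as m
allListsBelow-complete {as = as} xs lt h with listVec xs h
... | v , i , e = ∈-concatMap⁺ (λ k → map Vec.toList (allVecs as k))
  (lose (∈-upTo⁺ lt) (subst (_∈ map Vec.toList (allVecs as (length xs))) e (∈-map⁺ Vec.toList i)))

treesDepth-complete : ∀ {n} d (t : Tree n) → length (leaves t) ≤ suc d → t ∈ treesDepth n d
treesDepth-complete zero (leaf i) _ = ∈-map⁺ leaf (∈-allFin i)
treesDepth-complete (suc d) (leaf i) _ = ∈-++⁺ˡ (∈-map⁺ leaf (∈-allFin i))
treesDepth-complete zero (node c L R) le = ⊥-elim (ℕ.<⇒≱ (ℕ.+-mono-≤ (leaves-nonempty L) (leaves-nonempty R))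
  (ℕ.≤-trans (ℕ.≤-reflexive (sym (length-++ (leaves L)))) le))
treesDepth-complete {n} (suc d) (node c L R) le = ∈-++⁺ʳ (map leaf (allFin n))
  (∈-concatMap⁺ (λ c → concatMap (λ l → map (node c l) (treesDepth n d)) (treesDepth n d)) (lose (∈-allFin c)
    (∈-concatMap⁺ (λ l → map (node c l) (treesDepth n d)) (lose (treesDepth-complete d L leL)
      (∈-map⁺ (node c L) (treesDepth-complete d R leR))))))
  where
  len : length (leaves L) + length (leaves R) ≤ suc (suc d)
  len = ℕ.≤-trans (ℕ.≤-reflexive (sym (length-++ (leaves L)))) le
  leL : length (leaves L) ≤ suc d
  leL = ℕ.≤-pred (ℕ.≤-trans (ℕ.≤-reflexive (ℕ.+-comm 1 _)) (ℕ.≤-trans (ℕ.+-monoʳ-≤ _ (leaves-nonempty R)) len))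
  leR : length (leaves R) ≤ suc d
  leR = ℕ.≤-pred (ℕ.≤-trans (ℕ.+-monoˡ-≤ _ (leaves-nonempty L)) len)

length≤n : ∀ {n} {F : Forest n} → ValidF F → length F ≤ n
length≤n {n} {F} V = ℕ.≤-trans (ℕ.≤-reflexive (sym (length-map νF F)))
  (ℕ.≤-trans (ℕ.m≤m+n _ _) (ℕ.≤-reflexive (trans (sym (length-++ (map νF F)))
    (trans (Perm.↭-length (roots-his-wd V)) (length-tabulate {n = n} id)))))

length-insR : ∀ {n} (l : Label n) v → length (insR l v) ≡ suc (length v)
length-insR l v = Perm.↭-length (insR-↭ l v)

FLynW-graded : ∀ n → Graded (FLynW n)
FLynW-graded n = record
  { ==-sound = listEq-sound treeEq-sound
  ; ==-refl = listEq-refl treeEq-refl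
  ; complete = λ {F} t → complete (validF⁻ F t)
  ; rk = length ∘ wd
  ; ⊥-valid = validF⁺ (botF-valid n)
  ; rk-⊥ = cong length (wd-bot n)
  ; rk-⋖ = λ {F} {G} v _ c → let l , _ , e , _ = coverF⁻ {G = G} (validF⁻ F v) c in
      trans (cong length e) (length-insR l (wd F))
  ; from-⊥ = λ {F} v → from (validF⁻ F v) }
  where
  complete : ∀ {F} → ValidF F → F ∈ FinPoset.rawAll (FLynW n)
  complete {F} V = allListsBelow-complete F (s≤s (length≤n V)) λ {t} m → treesDepth-complete n t
    (ℕ.m≤n⇒m≤1+n (ℕ.≤-trans (length-leaves≤ m) (ℕ.≤-reflexive (length-leavesF V))))
  from : ∀ {F} → ValidF F → Reach (FLynW n) (length (wd F)) (botF n) F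
  from {F} V with wd-surjective (wd F) (wd-Val V) (wd-Fall V)
  ... | G , VG , e , r = subst (Reach (FLynW n) (length (wd F)) (botF n)) (wd-injective VG V e) r

-- Label sequences of chains and the isomorphism

Val-ʳ++⁻ : ∀ {n} (w v : Word n) → Val (w ʳ++ v) → Val v
Val-ʳ++⁻ [] v V = V
Val-ʳ++⁻ (l ∷ w) v V = proj₂ (Val-ʳ++⁻ w (l ∷ v) V)

module _ {n : ℕ} where
  open Graded-Properties (PiW-graded n)

  -- Reading the sequence `w` onwards from the state of `v` pushes its labels in front of `v`, hence
  -- the reversed append.
  chainWord⁺ : ∀ (w v : Word n) → Val (w ʳ++ v) → T (chainWord (st v) w (st (w ʳ++ v)))
  chainWord⁺ [] v V = PiW-==-refl (st v)
  chainWord⁺ (l ∷ w) v V with Val-ʳ++⁻ w (l ∷ v) V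
  ... | A , Vv = any⁺ (λ z → coverLΠ (st v) z l ∧ chainWord z w (st (w ʳ++ (l ∷ v))))
    (∈-elems⁺ (validΠ⁺ (st-valid (l ∷ v) (A , Vv))))
    (∧-intro (coverLΠ⁺ l (st-valid v Vv) (app⇒appΠ l v Vv A)) (chainWord⁺ w (l ∷ v) V))

  chainWord⁻ : ∀ (w v : Word n) x → Val v → T (chainWord (st v) w x) → Val (w ʳ++ v) × x ≡ st (w ʳ++ v)
  chainWord⁻ [] v x V t = V , sym (PiW-==-sound t)
  chainWord⁻ (l ∷ w) v x V t with any⁻ (λ z → coverLΠ (st v) z l ∧ chainWord z w x) (elems (PiW n)) t
  ... | z , _ , h with coverLΠ⁻ {z = z} l (st-valid v V) (∧-fst h)
  ... | A , refl = chainWord⁻ w (l ∷ v) x (appΠ⇒app l v V A , V) (∧-snd {coverLΠ (st v) z l} h)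

toR : ∀ {n} → Forest n → RawR n
toR F = st (wd F) , reverse (wd F)

module _ (n : ℕ) where
  private
    toElem : Elem (FLynW n) → Elem (RPiW n)
    toElem (F , t) = toR F , ∧-intro {validΠ (st v)} (validΠ⁺ (st-valid v V)) (∧-intro
        (subst (λ x → T (chainWord (botΠ n) (reverse v) (st x))) (reverse-involutive v)
          (chainWord⁺ (reverse v) [] (subst Val (sym (reverse-involutive v)) V)))
        (T-not⁺ (hasAscent⁺ (Linked-reverse (wd-Fall VF)))))
      where
      VF = validF⁻ F t
      v = wd F
      V = wd-Val VF

    Elem-≡ : ∀ {P} {x y : Elem P} → proj₁ x ≡ proj₁ y → x ≡ y
    Elem-≡ {x = x , s} {.x , t} refl = cong (x ,_) (T-irrelevant s t)

    injective : ∀ {x y} → toElem x ≡ toElem y → x ≡ y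
    injective {F , s} {G , t} e = Elem-≡ {FLynW n} (wd-injective (validF⁻ F s) (validF⁻ G t)
      (reverse-injective (cong (proj₂ ∘ proj₁) e)))

    surjective : ∀ y → ∃ λ x → ∀ {z} → z ≡ x → toElem z ≡ y
    surjective ((x , w) , t) with chainWord⁻ w [] x tt (∧-fst (∧-snd {validΠ x} t))
    ... | V , refl with wd-surjective (reverse w) V
        (Linked-reverse (hasAscent⁻ w (T-not⁻ (∧-snd {chainWord (botΠ n) w x} (∧-snd {validΠ x} t)))))
    ... | F , VF , e , _ = (F , validF⁺ VF) , λ { refl → Elem-≡ {RPiW n}
        (cong₂ _,_ (cong st e) (trans (cong reverse e) (reverse-involutive w))) }

    covers : ∀ x y → T (coverF (proj₁ x) (proj₁ y))
      ⇔ T (FinPoset._⋖_ (RPiW n) (proj₁ (toElem x)) (proj₁ (toElem y)))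
    covers (F , s) (G , t) = mk⇔ to from
      where
      VF = validF⁻ F s
      VG = validF⁻ G t
      v = wd F
      V = wd-Val VF
      step : Label n → Bool
      step l = coverLΠ (st v) (st (wd G)) l ∧ listEq eqLabel (reverse (wd G)) (sortW (reverse v ++ [ l ]))
      to : T (coverF F G) → T (any step (allLabels n))
      to c with coverF⁻ {G = G} VF c
      ... | l , A , e , _ = any⁺ step (∈-allLabels l) (∧-intro
        (subst (λ z → T (coverLΠ (st v) z l)) (trans (sym (st-insR l v (A , V))) (cong st (sym e)))
          (coverLΠ⁺ l (st-valid v V) (app⇒appΠ l v V A)))
        (subst (λ w → T (listEq eqLabel (reverse (wd G)) w))
          (sym (trans (sortW-insR v l (wd-Fall VF)) (cong reverse (sym e)))) (listEq-refl eqLabel-refl (reverse (wd G)))))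
      from : T (any step (allLabels n)) → T (coverF F G)
      from h with any⁻ step (allLabels n) h
      ... | l , _ , c with coverLΠ⁻ {z = st (wd G)} l (st-valid v V) (∧-fst c)
      -- The label yields some cover of `F`, and its word is the sorted word that `G` has;
      -- injectivity of `wd` identifies the two.
      ... | A , _ with coverF⁺ VF l (appΠ⇒app l v V A)
      ... | G′ , c′ , e , VG′ = subst (T ∘ coverF F) (wd-injective VG′ VG (trans e (sym wdG))) c′
        where
        wdG : wd G ≡ insR l v
        wdG = reverse-injective (trans (listEq-sound {e = eqLabel} eqLabel-sound
          (∧-snd {coverLΠ (st v) (st (wd G)) l} c)) (sortW-insR v l (wd-Fall VF)))

  FLynW≅RPiW : FLynW n ≅ RPiW n
  FLynW≅RPiW = mk⤖ (injective , surjective) , covers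

-- Whitney numbers

filterᵇ-map : ∀ {A B : Set} (p : B → Bool) (f : A → B) xs → filterᵇ p (map f xs) ≡ map f (filterᵇ (p ∘ f) xs)
filterᵇ-map p f [] = refl
filterᵇ-map p f (x ∷ xs) with p (f x)
... | true  = cong (f x ∷_) (filterᵇ-map p f xs)
... | false = filterᵇ-map p f xs

-- After exchanging the sums, an `x` contributes through the single `y` equal to `g x` when that
-- lies in `ys`, and not at all otherwise.
sumℤ-fibres : ∀ {A B : Set} (e : B → B → Bool) → (∀ {x y} → T (e x y) → x ≡ y) → (∀ x → T (e x x)) →
  (g : A → B) (f : A → ℤ) (q : A → Bool) (ys : List B) (xs : List A) → Unique ys →
  (∀ {x} → x ∈ xs → T (q x) ⇔ g x ∈ ys) →
  sumℤ (map (λ y → sumℤ (map f (filterᵇ (λ x → e (g x) y) xs))) ys) ≡ sumℤ (map f (filterᵇ q xs))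
sumℤ-fibres e sound rfl g f q ys xs u h = begin
  sumℤ (map (λ y → sumℤ (map f (filterᵇ (λ x → e (g x) y) xs))) ys)
    ≡⟨ sumℤ-cong _ _ ys (λ {y} _ → sumℤ-filter (λ x → e (g x) y) f xs) ⟩
  sumℤ (map (λ y → sumℤ (map (λ x → if e (g x) y then f x else ℤ.+ 0) xs)) ys)
    ≡⟨ sumℤ-swap (λ y x → if e (g x) y then f x else ℤ.+ 0) ys xs ⟩
  sumℤ (map (λ x → sumℤ (map (λ y → if e (g x) y then f x else ℤ.+ 0) ys)) xs)
    ≡⟨ sumℤ-cong _ _ xs inner ⟩
  sumℤ (map (λ x → if q x then f x else ℤ.+ 0) xs)
    ≡⟨ sumℤ-filter q f xs ⟨
  sumℤ (map f (filterᵇ q xs)) ∎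
  where
  open ≡-Reasoning
  inner : ∀ {x} → x ∈ xs → sumℤ (map (λ y → if e (g x) y then f x else ℤ.+ 0) ys) ≡ (if q x then f x else ℤ.+ 0)
  inner {x} i with T? (q x)
  ... | yes t = begin
    sumℤ (map (λ y → if e (g x) y then f x else ℤ.+ 0) ys) ≡⟨ sumℤ-filter (e (g x)) (λ _ → f x) ys ⟨
    sumℤ (map (λ _ → f x) (filterᵇ (e (g x)) ys)) ≡⟨ sumℤ-↭ (Perm.map⁺ (λ _ → f x) single) ⟩
    f x ℤ.+ ℤ.+ 0 ≡⟨ ℤ.+-identityʳ (f x) ⟩
    f x ≡⟨ if-yes t ⟨
    (if q x then f x else ℤ.+ 0) ∎
    where
    single : filterᵇ (e (g x)) ys ↭ g x ∷ []
    single = Unique-≈⇒↭ (Unique-filterᵇ (e (g x)) u) ([] ∷ [])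
      (λ j → here (sym (sound (proj₂ (∈-filterᵇ⁻ (e (g x)) {xs = ys} j)))))
      (λ { (here refl) → ∈-filterᵇ⁺ (e (g x)) (Equivalence.to (h i) t) (rfl (g x)) })
  ... | no ¬t = begin
    sumℤ (map (λ y → if e (g x) y then f x else ℤ.+ 0) ys) ≡⟨ sumℤ-filter (e (g x)) (λ _ → f x) ys ⟨
    sumℤ (map (λ _ → f x) (filterᵇ (e (g x)) ys)) ≡⟨ cong (λ zs → sumℤ (map (λ _ → f x) zs)) none ⟩
    ℤ.+ 0 ≡⟨ if-no ¬t ⟨
    (if q x then f x else ℤ.+ 0) ∎
    where
    none : filterᵇ (e (g x)) ys ≡ []
    none = filterᵇ-none (e (g x)) ys λ j t → ¬t (Equivalence.from (h i) (subst (_∈ ys) (sym (sound t)) j))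

app? : ∀ {n} (l : Label n) v → Dec (app l v)
app? (a , b , u) v =
  (toℕ a <? toℕ b) ×-dec ¬? (Any.any? (a ≟_) (his v)) ×-dec ¬? (Any.any? (b ≟_) (his v))

Val? : ∀ {n} (v : Word n) → Dec (Val v)
Val? [] = yes tt
Val? (l ∷ v) = app? l v ×-dec Val? v

Good? : ∀ {n} (v : Word n) → Dec (Good v)
Good? v = linked? _⊏?_ v ×-dec Val? (reverse v)

goodᵇ : ∀ {n} → Word n → Bool
goodᵇ v = ⌊ Good? v ⌋

Val-lo<hi : ∀ {n} (v : Word n) → Val v → ∀ {l} → l ∈ v → toℕ (lo l) < toℕ (hi l)
Val-lo<hi (l ∷ v) ((lt , _) , _) (here refl) = lt
Val-lo<hi (l ∷ v) (_ , V) (there i) = Val-lo<hi v V i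

Val-Unique : ∀ {n} (v : Word n) → Val v → Unique (his v)
Val-Unique [] _ = []
Val-Unique (l ∷ v) ((_ , _ , b∉) , V) = All.tabulate (λ { i refl → b∉ i }) ∷ Val-Unique v V

-- Increasing labels have weakly increasing first entries, so `LoSorted⇒Val` makes the word valid in
-- the stored direction too. This turns a good word into the word of a forest.
Good⇒Val : ∀ {n} {v : Word n} → Good v → Val v
Good⇒Val {v = v} (L , V) = LoSorted⇒Val v (AllPairs.map ⊏⇒lo≤ (Linked⇒AllPairs ⊏-trans L))
  (λ i → Val-lo<hi (reverse v) V (Perm.∈-resp-↭ (↭-sym (Perm.↭-reverse v)) i))
  (Unique-resp-↭ (Perm.map⁺ hi (Perm.↭-reverse v)) (Val-Unique (reverse v) V))

dropLast : ∀ {A : Set} → List A → List A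
dropLast [] = []
dropLast (x ∷ []) = []
dropLast (x ∷ xs@(_ ∷ _)) = x ∷ dropLast xs

dropLast-snoc : ∀ {A : Set} (xs : List A) x → dropLast (xs ++ [ x ]) ≡ xs
dropLast-snoc [] x = refl
dropLast-snoc (y ∷ []) x = refl
dropLast-snoc (y ∷ ys@(_ ∷ _)) x = cong (y ∷_) (dropLast-snoc ys x)

snoc-view : ∀ {A : Set} (xs : List A) → xs ≢ [] → ∃ λ ys → ∃ λ y → xs ≡ ys ++ [ y ]
snoc-view [] ne = ⊥-elim (ne refl)
snoc-view (x ∷ []) ne = [] , x , refl
snoc-view (x ∷ xs@(_ ∷ _)) ne with snoc-view xs (λ ())
... | ys , y , e = x ∷ ys , y , cong (x ∷_) e

flipLast : ∀ {n} → Label n → Word n → Word n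
flipLast f v = if ⌊ Any.any? (f ≟L_) v ⌋ then dropLast v else v ++ [ f ]

flipLast-∈ : ∀ {n} {f : Label n} {v} → f ∈ v → flipLast f v ≡ dropLast v
flipLast-∈ {f = f} {v} i with Any.any? (f ≟L_) v
... | yes _ = refl
... | no ¬i = ⊥-elim (¬i i)

flipLast-∉ : ∀ {n} {f : Label n} {v} → f ∉ v → flipLast f v ≡ v ++ [ f ]
flipLast-∉ {f = f} {v} ¬i with Any.any? (f ≟L_) v
... | yes i = ⊥-elim (¬i i)
... | no _ = refl

sgn-snoc : ∀ {A : Set} (xs : List A) x → sgn (length (xs ++ [ x ])) ≡ ℤ.- sgn (length xs)
sgn-snoc xs x = cong sgn (trans (length-++ xs) (ℕ.+-comm (length xs) 1))

-- The good words below w form a Boolean lattice in which the first label of the chain of w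
-- can be freely added or removed.
flipLast-spec : ∀ {n} {f : Label n} {w′ v} → Good v → v ⊑ (w′ ++ [ f ]) →
  (Good (flipLast f v) × flipLast f v ⊑ (w′ ++ [ f ])) × flipLast f (flipLast f v) ≡ v
  × sgn (length (flipLast f v)) ≡ ℤ.- sgn (length v)
flipLast-spec {f = f} {w′} {v} G r with Any.any? (f ≟L_) v
... | no f∉ with ⊑-add-last r refl f∉
... | h , A , r′ = (Good-snoc G h A , r′)
  , trans (flipLast-∈ (∈-++⁺ʳ v (here refl))) (dropLast-snoc v f) , sgn-snoc v f
flipLast-spec {f = f} {w′} {v} G r | yes f∈ with ⊑-last r refl f∈
... | v′ , refl with Good-unsnoc v′ G
... | G′ , h , A = subst Claim (sym (dropLast-snoc v′ f))
    ((G′ , ⊑-step f A (subst (_⊑ (w′ ++ [ f ])) (sym (insR-all h)) r))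
    , flipLast-∉ (λ i → ⊏-irrefl (All.lookup h i))
    , sym (trans (cong ℤ.-_ (sgn-snoc v′ f)) (ℤ.neg-involutive _)))
  where
  Claim : Word _ → Set
  Claim u = (Good u × u ⊑ (w′ ++ [ f ])) × flipLast f u ≡ v′ ++ [ f ] × sgn (length u) ≡ ℤ.- sgn (length (v′ ++ [ f ]))

module Whitney (n : ℕ) where
  private
    module F = Graded-Properties (FLynW-graded n)
    module Π = Graded-Properties (PiW-graded n)

  forests : List (Forest n)
  forests = elems (FLynW n)

  ∈forests⁻ : ∀ {F} → F ∈ forests → ValidF F
  ∈forests⁻ {F} i = validF⁻ F (F.∈-elems⁻ i)

  ∈forests⁺ : ∀ {F} → ValidF F → F ∈ forests
  ∈forests⁺ V = F.∈-elems⁺ (validF⁺ V)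

  words : List (Word n)
  words = map wd forests

  ∈words⁻ : ∀ {v} → v ∈ words → Val v × Fall v
  ∈words⁻ i with ∈-map⁻ wd i
  ... | F , j , refl = wd-Val (∈forests⁻ j) , wd-Fall (∈forests⁻ j)

  ∈words⁺ : ∀ {v} → Val v → Fall v → v ∈ words
  ∈words⁺ V Fa with wd-surjective _ V Fa
  ... | F , VF , refl , _ = ∈-map⁺ wd (∈forests⁺ VF)

  Unique-words : Unique words
  Unique-words = Unique-map⁺ wd (λ i j → wd-injective (∈forests⁻ i) (∈forests⁻ j)) F.Unique-elems

  sign : Word n → ℤ
  sign v = sgn (length v)

  st∈elems : ∀ {v} → v ∈ words → st v ∈ elems (PiW n)
  st∈elems {v} i = Π.∈-elems⁺ (validΠ⁺ (st-valid v (proj₁ (∈words⁻ i))))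

  length-words : ∀ k → length (filterᵇ (λ v → length v ≡ᵇ k) words) ≡ whitney2 (FLynW n) k
  length-words k = begin
    length (filterᵇ (λ v → length v ≡ᵇ k) words) ≡⟨ cong length (filterᵇ-map _ wd forests) ⟩
    length (map wd (filterᵇ (λ F → length (wd F) ≡ᵇ k) forests)) ≡⟨ length-map wd (filterᵇ (λ F → length (wd F) ≡ᵇ k) forests) ⟩
    length (filterᵇ (λ F → length (wd F) ≡ᵇ k) forests) ≡⟨ cong length (filterᵇ-cong _ _ forests λ {F} i → T-ext
        (λ t → F.rankIs⁺ {k} {F} (F.∈-elems⁻ i) (ℕ.≡ᵇ⇒≡ _ _ t)) (λ t → ℕ.≡⇒≡ᵇ _ _ (F.rankIs⁻ {k} {F} t))) ⟩
    whitney2 (FLynW n) k ∎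
    where open ≡-Reasoning

  μΠ : RawΠ n → ℤ
  μΠ y = sumℤ (map sign (filterᵇ (λ v → eqΠ (st v) y) words))

  μΠ-⊥ : μΠ (botΠ n) ≡ ℤ.+ 1
  μΠ-⊥ = sumℤ-↭ (Perm.map⁺ sign single)
    where
    single : filterᵇ (λ v → eqΠ (st v) (botΠ n)) words ↭ [] ∷ []
    single = Unique-≈⇒↭ (Unique-filterᵇ _ Unique-words) ([] ∷ []) into
      (λ { (here refl) → ∈-filterᵇ⁺ (λ v → eqΠ (st v) (botΠ n)) (∈words⁺ tt []) (PiW-==-refl (botΠ n)) })
      where
      into : ∀ {v} → v ∈ filterᵇ (λ v → eqΠ (st v) (botΠ n)) words → v ∈ [] ∷ []
      into {v} i with ∈-filterᵇ⁻ (λ v → eqΠ (st v) (botΠ n)) {xs = words} i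
      into {[]} i | _ = here refl
      into {l ∷ v} i | j , t = ⊥-elim (ℕ.0≢1+n (trans (sym (rkΠ-bot n))
        (trans (cong rkΠ (sym (PiW-==-sound {x = st (l ∷ v)} {botΠ n} t))) (rkΠ-st (l ∷ v) (proj₁ (∈words⁻ j))))))

  μΠ-sum : ∀ {x} → T (validΠ x) → x ≢ botΠ n →
    sumℤ (map μΠ (filterᵇ (λ y → leq (PiW n) y x) (elems (PiW n)))) ≡ ℤ.+ 0
  μΠ-sum {x} vx x≢⊥ = trans
    (sumℤ-fibres eqΠ PiW-==-sound PiW-==-refl st sign q _ words (Unique-filterᵇ _ Π.Unique-elems)
      (λ i → mk⇔ (∈-filterᵇ⁺ (λ y → leq (PiW n) y x) (st∈elems i))
                 (λ j → proj₂ (∈-filterᵇ⁻ (λ y → leq (PiW n) y x) {xs = elems (PiW n)} j))))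
    (sumℤ-involution sign (toggle Vx) (filterᵇ q words) (Unique-filterᵇ q Unique-words) spec)
    where
    Vx = validΠ⁻ {y = x} vx
    q : Word n → Bool
    q v = leq (PiW n) (st v) x
    spec : ∀ {v} → v ∈ filterᵇ q words →
      toggle Vx v ∈ filterᵇ q words × toggle Vx (toggle Vx v) ≡ v × sign (toggle Vx v) ≡ ℤ.- sign v
    spec {v} i with ∈-filterᵇ⁻ q {xs = words} i
    ... | j , t with ∈words⁻ j | Π.leq⁻ {st v} {x} t
    ... | V , Fa | k , r with toggle-spec Vx x≢⊥ (V , Fa , Reach⇒Below k (st-valid v V) r)
    ... | (V′ , Fa′ , B) , inv , sg with Below⇒Reach (suc n) (ℕ.m≤n+m (suc n) (rkΠ (st (toggle Vx v)))) Vx (st-valid _ V′) B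
    ... | k′ , r′ = ∈-filterᵇ⁺ q (∈words⁺ V′ Fa′) (Π.leq⁺ k′ (validΠ⁺ (st-valid _ V′)) r′) , inv , sg

  -- A word ending at rank `k` has length `k`, so all terms carry one sign and the absolute value
  -- counts words, that is, forests.
  ∣whitney1-PiW∣ : ∀ k → ∣ whitney1 (PiW n) k ∣ ≡ whitney2 (FLynW n) k
  ∣whitney1-PiW∣ k = begin
    ∣ whitney1 (PiW n) k ∣
      ≡⟨ cong ∣_∣ (sumℤ-cong _ μΠ level λ {x} i →
           Π.mobius-unique μΠ μΠ-⊥ μΠ-sum {x} (Π.∈-elems⁻ (proj₁ (∈-filterᵇ⁻ _ {xs = elems (PiW n)} i)))) ⟩
    ∣ sumℤ (map μΠ level) ∣
      ≡⟨ cong ∣_∣ (sumℤ-fibres eqΠ PiW-==-sound PiW-==-refl st sign q level words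
           (Unique-filterᵇ (rankIs (PiW n) k) Π.Unique-elems) q⇔) ⟩
    ∣ sumℤ (map sign (filterᵇ q words)) ∣
      ≡⟨ ∣sumℤ-sgn∣ sign k (filterᵇ q words) (λ {v} i → cong sgn (ℕ.≡ᵇ⇒≡ (length v) k (proj₂ (∈-filterᵇ⁻ q {xs = words} i)))) ⟩
    length (filterᵇ q words)
      ≡⟨ length-words k ⟩
    whitney2 (FLynW n) k ∎
    where
    open ≡-Reasoning
    level = filterᵇ (rankIs (PiW n) k) (elems (PiW n))
    q : Word n → Bool
    q v = length v ≡ᵇ k
    q⇔ : ∀ {v} → v ∈ words → T (q v) ⇔ st v ∈ level
    q⇔ {v} i = mk⇔
      (λ t → ∈-filterᵇ⁺ (rankIs (PiW n) k) (st∈elems i)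
        (Π.rankIs⁺ {k} {st v} (Π.∈-elems⁻ (st∈elems i)) (trans (rkΠ-st v (proj₁ (∈words⁻ i))) (ℕ.≡ᵇ⇒≡ _ _ t))))
      (λ j → ℕ.≡⇒≡ᵇ _ _ (trans (sym (rkΠ-st v (proj₁ (∈words⁻ i))))
        (Π.rankIs⁻ {k} {st v} (proj₂ (∈-filterᵇ⁻ (rankIs (PiW n) k) {xs = elems (PiW n)} j)))))

  ⊑⇒Reach : ∀ {v w} → v ⊑ w → ∀ {F G} → ValidF F → ValidF G → wd F ≡ v → wd G ≡ w →
    ∃ λ k → Reach (FLynW n) k F G
  ⊑⇒Reach ⊑-refl VF VG e e′ = 0 , wd-injective VF VG (trans e (sym e′))
  ⊑⇒Reach (⊑-step l A r) {F} VF VG refl e′ with coverF⁺ VF l A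
  ... | H , c , e , VH with ⊑⇒Reach r VH VG e e′
  ... | k , r′ = suc k , H , validF⁺ VH , c , r′

  Reach⇒⊑ : ∀ k {F G} → ValidF F → Reach (FLynW n) k F G → wd F ⊑ wd G
  Reach⇒⊑ zero VF refl = ⊑-refl
  Reach⇒⊑ (suc k) VF (H , _ , c , r) with coverF⁻ {G = H} VF c
  ... | l , A , e , VH = ⊑-step l A (subst (_⊑ _) e (Reach⇒⊑ k VH r))

  μF : Forest n → ℤ
  μF F = if goodᵇ (wd F) then sign (wd F) else ℤ.+ 0

  μF-⊥ : μF (botF n) ≡ ℤ.+ 1
  μF-⊥ = cong (λ v → if goodᵇ v then sign v else ℤ.+ 0) (wd-bot n)

  μF-sum : ∀ {F} → T (validF F) → F ≢ botF n →
    sumℤ (map μF (filterᵇ (λ G → leq (FLynW n) G F) forests)) ≡ ℤ.+ 0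
  -- The final letter `f` of the stored word is the first label of the chain; it exists because only
  -- the bottom forest has the empty word.
  μF-sum {F} t F≢⊥ with snoc-view (wd F) (λ e → F≢⊥ (wd-injective (validF⁻ F t) (botF-valid n) (trans e (sym (wd-bot n)))))
  ... | w′ , f , wdF = begin
    sumℤ (map μF below) ≡⟨ sumℤ-filter (goodᵇ ∘ wd) (sign ∘ wd) below ⟨
    sumℤ (map (sign ∘ wd) (filterᵇ (goodᵇ ∘ wd) below)) ≡⟨ cong sumℤ (map-∘ (filterᵇ (goodᵇ ∘ wd) below)) ⟩
    sumℤ (map sign L) ≡⟨ sumℤ-involution sign (flipLast f) L unique spec ⟩
    ℤ.+ 0 ∎
    where
    open ≡-Reasoning
    below = filterᵇ (λ G → leq (FLynW n) G F) forests
    L = map wd (filterᵇ (goodᵇ ∘ wd) below)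
    valid∈ : ∀ {G} → G ∈ filterᵇ (goodᵇ ∘ wd) below → ValidF G
    valid∈ i = ∈forests⁻ (proj₁ (∈-filterᵇ⁻ (λ G → leq (FLynW n) G F) {xs = forests}
      (proj₁ (∈-filterᵇ⁻ (goodᵇ ∘ wd) {xs = below} i))))
    unique : Unique L
    unique = Unique-map⁺ wd (λ i j → wd-injective (valid∈ i) (valid∈ j))
      (Unique-filterᵇ (goodᵇ ∘ wd) (Unique-filterᵇ _ F.Unique-elems))
    L⁻ : ∀ {v} → v ∈ L → Good v × v ⊑ (w′ ++ [ f ])
    L⁻ i with ∈-map⁻ wd i
    ... | G , j , refl with ∈-filterᵇ⁻ (goodᵇ ∘ wd) {xs = below} j
    ... | j′ , g with F.leq⁻ {G} {F} (proj₂ (∈-filterᵇ⁻ (λ G → leq (FLynW n) G F) {xs = forests} j′))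
    ... | k , r = toWitness g , subst (wd G ⊑_) wdF (Reach⇒⊑ k (valid∈ j) r)
    L⁺ : ∀ {v} → Good v → v ⊑ (w′ ++ [ f ]) → v ∈ L
    L⁺ {v} g r with wd-surjective v (Good⇒Val g) (ascending⇒Fall (proj₁ g))
    ... | G , VG , refl , _ with ⊑⇒Reach r VG (validF⁻ F t) refl wdF
    ... | k , r′ = ∈-map⁺ wd (∈-filterᵇ⁺ (goodᵇ ∘ wd)
      (∈-filterᵇ⁺ (λ G → leq (FLynW n) G F) (∈forests⁺ VG) (F.leq⁺ k (validF⁺ VG) r′)) (fromWitness g))
    spec : ∀ {v} → v ∈ L → flipLast f v ∈ L × flipLast f (flipLast f v) ≡ v × sign (flipLast f v) ≡ ℤ.- sign v
    spec i with L⁻ i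
    ... | g , r with flipLast-spec g r
    ... | (g′ , r′) , inv , sg = L⁺ g′ r′ , inv , sg

  Good⇒Inc : ∀ {v : Word n} → Good v → Inc (reverse v)
  Good⇒Inc (L , V) = Linked-reverse L , V

  -- The good words of length `k` all count with the same sign. Read backwards they are the
  -- increasing chains of length `k`, and `inc-exists` and `inc-unique` match these with the
  -- partitions of rank `k`.
  ∣whitney1-FLynW∣ : ∀ k → ∣ whitney1 (FLynW n) k ∣ ≡ whitney2 (PiW n) k
  ∣whitney1-FLynW∣ k = begin
    ∣ whitney1 (FLynW n) k ∣
      ≡⟨ cong ∣_∣ (sumℤ-cong _ μF level λ {F} i → F.mobius-unique μF μF-⊥ μF-sum {F} (valid∈ i)) ⟩
    ∣ sumℤ (map μF level) ∣
      ≡⟨ cong ∣_∣ (sumℤ-filter (goodᵇ ∘ wd) (sign ∘ wd) level) ⟨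
    ∣ sumℤ (map (sign ∘ wd) goods) ∣
      ≡⟨ ∣sumℤ-sgn∣ (sign ∘ wd) k goods (λ i → cong sgn (proj₂ (proj₂ (goods⁻ i)))) ⟩
    length goods
      ≡⟨ length-map (st ∘ reverse ∘ wd) goods ⟨
    length (map (st ∘ reverse ∘ wd) goods)
      ≡⟨ Perm.↭-length matching ⟩
    whitney2 (PiW n) k ∎
    where
    open ≡-Reasoning
    level = filterᵇ (rankIs (FLynW n) k) forests
    goods = filterᵇ (goodᵇ ∘ wd) level
    levelΠ = filterᵇ (rankIs (PiW n) k) (elems (PiW n))
    valid∈ : ∀ {F} → F ∈ level → T (validF F)
    valid∈ i = F.∈-elems⁻ (proj₁ (∈-filterᵇ⁻ (rankIs (FLynW n) k) {xs = forests} i))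
    goods⁻ : ∀ {F} → F ∈ goods → ValidF F × Good (wd F) × length (wd F) ≡ k
    goods⁻ {F} i with ∈-filterᵇ⁻ (goodᵇ ∘ wd) {xs = level} i
    ... | j , g = validF⁻ F (valid∈ j) , toWitness g
        , F.rankIs⁻ {k} {F} (proj₂ (∈-filterᵇ⁻ (rankIs (FLynW n) k) {xs = forests} j))
    into : ∀ {x} → x ∈ map (st ∘ reverse ∘ wd) goods → x ∈ levelΠ
    into i with ∈-map⁻ (st ∘ reverse ∘ wd) i
    ... | F , j , refl with goods⁻ j
    ... | VF , (_ , V) , e = ∈-filterᵇ⁺ (rankIs (PiW n) k) (Π.∈-elems⁺ v)
        (Π.rankIs⁺ {k} {st (reverse (wd F))} v (trans (rkΠ-st (reverse (wd F)) V) (trans (length-reverse (wd F)) e)))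
      where v = validΠ⁺ (st-valid (reverse (wd F)) V)
    back : ∀ {x} → x ∈ levelΠ → x ∈ map (st ∘ reverse ∘ wd) goods
    back {x} i with ∈-filterᵇ⁻ (rankIs (PiW n) k) {xs = elems (PiW n)} i
    ... | j , t with inc-exists (validΠ⁻ {y = x} (Π.∈-elems⁻ j))
    -- The increasing chain to the given partition, reversed, is a falling valid word and hence
    -- belongs to a forest.
    ... | v , (L , V) , refl = lift (wd-surjective (reverse v) (Good⇒Val g) (ascending⇒Fall (proj₁ g)))
      where
      g : Good (reverse v)
      g = Linked-reverse L , subst Val (sym (reverse-involutive v)) V
      lift : (∃ λ F → ValidF F × wd F ≡ reverse v × Reach (FLynW n) (length (reverse v)) (botF n) F) →
        st v ∈ map (st ∘ reverse ∘ wd) goods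
      lift (F , VF , e , _) = subst (_∈ map (st ∘ reverse ∘ wd) goods)
        (cong st (trans (cong reverse e) (reverse-involutive v)))
        (∈-map⁺ (st ∘ reverse ∘ wd) (∈-filterᵇ⁺ (goodᵇ ∘ wd)
          (∈-filterᵇ⁺ (rankIs (FLynW n) k) (∈forests⁺ VF) (F.rankIs⁺ {k} {F} (validF⁺ VF)
            (trans (cong length e) (trans (length-reverse v) (trans (sym (rkΠ-st v V)) (Π.rankIs⁻ {k} {st v} t))))))
          (fromWitness (subst Good (sym e) g))))
    matching : map (st ∘ reverse ∘ wd) goods ↭ levelΠ
    matching = Unique-≈⇒↭
      (Unique-map⁺ (st ∘ reverse ∘ wd) inj (Unique-filterᵇ (goodᵇ ∘ wd) (Unique-filterᵇ (rankIs (FLynW n) k) F.Unique-elems)))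
      (Unique-filterᵇ (rankIs (PiW n) k) Π.Unique-elems) into back
      where
      inj : ∀ {F G} → F ∈ goods → G ∈ goods → st (reverse (wd F)) ≡ st (reverse (wd G)) → F ≡ G
      inj {F} {G} i j e with goods⁻ i | goods⁻ j
      ... | VF , g , _ | VG , g′ , _ = wd-injective VF VG (reverse-injective
        (inc-unique (st-valid (reverse (wd G)) (proj₂ g′)) (Good⇒Inc {wd F} g) (Good⇒Inc {wd G} g′) e refl))

theorem3p10 : ∀ (n : ℕ) → 1 ≤ n → WhitneyDual (FLynW n) (PiW n) × (FLynW n ≅ RPiW n)
theorem3p10 n _ = (λ k → Whitney.∣whitney1-FLynW∣ n k , Whitney.∣whitney1-PiW∣ n k) , FLynW≅RPiW n
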